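{- For every integer $d\ge 2$, the dual polytope of a cyclic $d$-polytope with $d+2$ vertices is $\lfloor d/2\rfloor$-linked.
   Context: The moment curve in $\mathbb{R}^d$ is $x(t)=(t,t^2,\ldots,t^d)$, $t\in\mathbb{R}$. For $n>d$, a cyclic $d$-polytope with $n$ vertices is the convex hull of $n$ distinct points on the moment curve in $\mathbb{R}^d$; its face lattice does not depend on the choice of the points. For a $d$-polytope $P\subset\mathbb{R}^d$ containing the origin in its interior, the dual polytope is $P^*=\{y\in\mathbb{R}^d : x\cdot y\le 1 \text{ for all } x\in P\}$; if $P$ does not contain the origin in its interior, it is first translated so that it does (this does not affect the face lattice of $P^*$, which is the face lattice of $P$ with inclusion reversed). The graph of a polytope is the undirected graph formed by its vertices and edges; thus the graph of $P^*$ is isomorphic to the graph on the facets of $P$ in which two facets are adjacent if they share a $(d-2)$-face. A polytope is called $k$-linked if its graph is $k$-linked. For an integer $k\ge 0$, a graph $G$ is $k$-linked if it has at least $2k$ vertices and, for every set $X$ of exactly $2k$ distinct vertices of $G$ and every partition of $X$ into pairs $\{s_1,t_1\},\ldots,\{s_k,t_k\}$, there exist $k$ pairwise vertex-disjoint paths $L_1,\ldots,L_k$ in $G$ such that $L_i$ joins $s_i$ to $t_i$ for each $i\in\{1,\ldots,k\}$. -}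

module Defs where

open import Level using (_⊔_) renaming (suc to lsuc)
open import Algebra.Apartness.Bundles using (HeytingField)
open import Algebra.Bundles using (CommutativeRing; Semiring)
import Algebra.Definitions.RawSemiring as RawSemiring
open import Data.Fin.Base using (Fin; zero; suc; toℕ)
open import Data.List.Base using (List; head; last)
import Data.List.Relation.Binary.Disjoint.Setoid as DisjointSetoid
import Data.List.Relation.Unary.Linked as Linked
import Data.List.Relation.Unary.Unique.Setoid as UniqueSetoid
open import Data.Maybe.Base using (just)
open import Data.Nat.Base as ℕ using (ℕ; suc)
open import Data.Product.Base using (∃; ∃-syntax; _×_; _,_; proj₁; proj₂)
open import Data.Sum.Base using (_⊎_)
open import Data.Vec.Functional using (Vector; []; _∷_; replicate; zipWith)
import Data.Vec.Functional.Relation.Binary.Equality.Setoid as VectorEquality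
open import Function.Base using (_∘_)
open import Function.Bundles using (_⇔_)
open import Function.Definitions using (Injective)
open import Relation.Binary.Bundles using (Setoid)
import Relation.Binary.Construct.On as On
open import Relation.Binary.Core using (Rel)
open import Relation.Binary.Definitions using (Irreflexive; Symmetric; _Respects₂_)
open import Relation.Binary.PropositionalEquality.Core using (_≡_; _≢_)
open import Relation.Binary.Structures using (IsStrictPartialOrder)
open import Relation.Nullary.Negation using (¬_)
open import Relation.Unary using (Pred; _∈_; _≐_)

-- The real numbers, described up to isomorphism as a Cauchy complete
-- Archimedean ordered field. Neither trichotomy nor decidability of the order
-- is required, so that Cauchy reals are a model without excluded middle.

record RealNumbers c ℓ₁ ℓ₂ : Set (lsuc (c ⊔ ℓ₁ ⊔ ℓ₂)) where
  infix 4 _<_ _≤_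

  field
    heytingField : HeytingField c ℓ₁ ℓ₂

  open HeytingField heytingField public

  commutativeRing : CommutativeRing c ℓ₁
  commutativeRing = record { isCommutativeRing = isCommutativeRing }

  open RawSemiring (Semiring.rawSemiring (CommutativeRing.semiring commutativeRing)) public
    using (sum; _^_)
    renaming (_×_ to _×ℕ_)

  field
    _<_                  : Rel Carrier ℓ₂
    isStrictPartialOrder : IsStrictPartialOrder _≈_ _<_
    #⇔<⊎>                : ∀ {x y} → x # y ⇔ (x < y ⊎ y < x)
    +-monoˡ-<            : ∀ z {x y} → x < y → x + z < y + z
    *-pos                : ∀ {x y} → 0# < x → 0# < y → 0# < x * y
    archimedean          : ∀ x → ∃[ n ] x < n ×ℕ 1#
    complete             : ∀ (x : ℕ → Carrier) →
      (∀ ε → 0# < ε → ∃[ N ] ∀ m n → N ℕ.≤ m → N ℕ.≤ n → x m < x n + ε) →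
      ∃[ l ] ∀ ε → 0# < ε → ∃[ N ] ∀ n → N ℕ.≤ n → x n < l + ε × l < x n + ε

  _≤_ : Rel Carrier ℓ₂
  x ≤ y = ¬ (y < x)

record Graph v e q : Set (lsuc (v ⊔ e ⊔ q)) where
  infix 4 _~_

  field
    vertexSetoid : Setoid v q

  open Setoid vertexSetoid public using (_≈_) renaming (Carrier to Vertex)

  field
    _~_      : Rel Vertex e
    ~-sym    : Symmetric _~_
    ~-irrefl : Irreflexive _≈_ _~_
    ~-resp-≈ : _~_ Respects₂ _≈_

module _ {v e q} (G : Graph v e q) where
  open Graph G
  open UniqueSetoid vertexSetoid using (Unique)
  open DisjointSetoid vertexSetoid using (Disjoint)

  record Path (s t : Vertex) : Set (v ⊔ e ⊔ q) where
    field
      vertices : List Vertex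
      starts   : head vertices ≡ just s
      ends     : last vertices ≡ just t
      adjacent : Linked.Linked _~_ vertices
      simple   : Unique vertices

  -- The 2k distinct vertices together with their partition into pairs are
  -- given by the two families s and t; the i-th pair is {s i, t i}.

  IsLinked : ℕ → Set (v ⊔ e ⊔ q)
  IsLinked k =
    (∃ λ (f : Fin (2 ℕ.* k) → Vertex) → Injective _≡_ _≈_ f) ×
    (∀ (s t : Fin k → Vertex) →
      Injective _≡_ _≈_ s → Injective _≡_ _≈_ t → (∀ i j → ¬ s i ≈ t j) →
      ∃ λ (L : ∀ i → Path (s i) (t i)) →
        ∀ i j → i ≢ j → Disjoint (Path.vertices (L i)) (Path.vertices (L j)))

module Polytopes {c ℓ₁ ℓ₂} (ℝ : RealNumbers c ℓ₁ ℓ₂) where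
  open RealNumbers ℝ hiding (zero)

  open VectorEquality setoid using (_≋_; ≋-setoid; ≋-sym; ≋-trans)

  Point : ℕ → Set c
  Point d = Vector Carrier d

  PointSet : ℕ → Set (lsuc (c ⊔ ℓ₁ ⊔ ℓ₂))
  PointSet d = Pred (Point d) (c ⊔ ℓ₁ ⊔ ℓ₂)

  origin : ∀ {d} → Point d
  origin = replicate _ 0#

  infix 7 _·_
  _·_ : ∀ {d} → Point d → Point d → Carrier
  x · y = sum (zipWith _*_ x y)

  convexHull : ∀ {d n} → Vector (Point d) n → PointSet d
  convexHull {n = n} p x = ∃ λ (w : Vector Carrier n) →
    (∀ i → 0# ≤ w i) × sum w ≈ 1# × (∀ k → x k ≈ sum (λ i → w i * p i k))

  segment : ∀ {d} → Point d → Point d → PointSet d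
  segment x y = convexHull (x ∷ y ∷ [])

  -- Open cubes are used in place of open balls.

  Interior : ∀ {d} → PointSet d → PointSet d
  Interior P x = ∃ λ ε → 0# < ε ×
    (∀ y → (∀ k → x k < y k + ε × y k < x k + ε) → y ∈ P)

  translate : ∀ {d} → PointSet d → Point d → PointSet d
  translate P a x = zipWith _-_ x a ∈ P

  dual : ∀ {d} → PointSet d → PointSet d
  dual P y = ∀ x → x ∈ P → x · y ≤ 1#

  IsFace : ∀ {d ℓ} → PointSet d → Pred (Point d) ℓ → Set (c ⊔ ℓ₁ ⊔ ℓ₂ ⊔ ℓ)
  IsFace P F = ∃ λ a → ∃ λ b →
    (∀ x → x ∈ P → a · x ≤ b) × F ≐ (λ x → x ∈ P × a · x ≈ b)

  IsVertex : ∀ {d} → PointSet d → PointSet d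
  IsVertex P v = IsFace P (_≋ v)

  IsEdge : ∀ {d} → PointSet d → Rel (Point d) (c ⊔ ℓ₁ ⊔ ℓ₂)
  IsEdge P v w = ¬ (v ≋ w) × IsFace P (segment v w)

  private
    isFace-resp : ∀ {d ℓ ℓ′} {P : PointSet d} {F : Pred (Point d) ℓ} {F′ : Pred (Point d) ℓ′} →
                  F ≐ F′ → IsFace P F → IsFace P F′
    isFace-resp (F⊆F′ , F′⊆F) (a , b , valid , F⊆ , ⊆F) =
      a , b , valid , (λ y∈F′ → F⊆ (F′⊆F y∈F′)) , (λ y∈ → F⊆F′ (⊆F y∈))

    swap-sum : ∀ x y → x + (y + 0#) ≈ y + (x + 0#)
    swap-sum x y =
      trans (+-congˡ (+-identityʳ y)) (trans (+-comm x y) (+-congˡ (sym (+-identityʳ x))))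

    segment-swap : ∀ {d} {v w : Point d} {x} → x ∈ segment v w → x ∈ segment w v
    segment-swap {v = v} {w} (μ , μ≥0 , Σμ≈1 , x≈) =
      (μ (suc zero) ∷ μ zero ∷ []) ,
      (λ { zero → μ≥0 (suc zero) ; (suc zero) → μ≥0 zero }) ,
      trans (swap-sum _ _) Σμ≈1 ,
      (λ k → trans (x≈ k) (swap-sum _ _))

    segment-cong : ∀ {d} {v v′ w w′ : Point d} {x} → v ≋ v′ → w ≋ w′ →
                   x ∈ segment v w → x ∈ segment v′ w′
    segment-cong v≋ w≋ (μ , μ≥0 , Σμ≈1 , x≈) =
      μ , μ≥0 , Σμ≈1 ,
      (λ k → trans (x≈ k) (+-cong (*-congˡ (v≋ k)) (+-congʳ (*-congˡ (w≋ k)))))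

  isEdge-sym : ∀ {d} (P : PointSet d) {v w} → IsEdge P v w → IsEdge P w v
  isEdge-sym P (v≉w , face) =
    (λ w≋v → v≉w (≋-sym w≋v)) , isFace-resp {P = P} (segment-swap , segment-swap) face

  isEdge-resp : ∀ {d} (P : PointSet d) {v v′ w w′} → v ≋ v′ → w ≋ w′ →
                IsEdge P v w → IsEdge P v′ w′
  isEdge-resp P v≋ w≋ (v≉w , face) =
    (λ v′≋w′ → v≉w (≋-trans v≋ (≋-trans v′≋w′ (≋-sym w≋)))) ,
    isFace-resp {P = P}
      (segment-cong v≋ w≋ , segment-cong (≋-sym v≋) (≋-sym w≋)) face

  graph : ∀ {d} → PointSet d → Graph (c ⊔ ℓ₁ ⊔ ℓ₂) (c ⊔ ℓ₁ ⊔ ℓ₂) ℓ₁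
  graph {d} P = record
    { vertexSetoid = On.setoid (≋-setoid d) (proj₁ {B = IsVertex P})
    ; _~_          = λ v w → IsEdge P (proj₁ v) (proj₁ w)
    ; ~-sym        = isEdge-sym P
    ; ~-irrefl     = λ v≋w edge → proj₁ edge v≋w
    ; ~-resp-≈     = (λ w≋ → isEdge-resp P (λ _ → refl) w≋)
                   , (λ v≋ → isEdge-resp P v≋ (λ _ → refl))
    }

  momentCurve : ∀ d → Carrier → Point d
  momentCurve d t k = t ^ suc (toℕ k)

  cyclicPolytope : ∀ d {n} → Vector Carrier n → PointSet d
  cyclicPolytope d t = convexHull (momentCurve d ∘ t)

{-# OPTIONS --safe #-}
module Submission where

-- Let w be the affine dependence of the d + 2 points, that is, Σ w l * f (t l) = 0 for all
-- polynomials f of degree at most d. A vertex of the dual polytope lies on all facets but two,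
-- and these two belong to points i and j with w i > 0 > w j; conversely, every such pair occurs.
-- Vertices whose pairs share an index are adjacent, so the graph contains a spanning rook's
-- graph, with a row for every positive and a column for every negative w l. There are more than
-- ⌊ d /2⌋ lines of each kind, since a square of degree at most d cannot vanish at all points
-- with a given sign of w.
--
-- A rook's graph with more than k rows and more than k columns is k-linked by induction on k.
-- A pair of terminals is linked inside one row and one column (or two pairs inside two rows and
-- two columns), whose other terminals each make one move to a free cell outside these lines. If
-- some line contains exactly one terminal, it can be used for this. Otherwise counting yields an
-- empty row and an empty column, which receive the displaced terminals.

open import Defs
open import Algebra.Bundles using (CommutativeMonoid; CommutativeRing; RawRing)
import Algebra.Apartness.Properties.HeytingCommutativeRing as HeytingProperties
import Algebra.Properties.AbelianGroup as AbelianGroupProperties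
import Algebra.Properties.CommutativeMonoid.Sum as MonoidSum
import Algebra.Properties.CommutativeSemigroup as CommutativeSemigroupProperties
import Algebra.Properties.Monoid.Mult as Mult
import Algebra.Properties.Ring as RingProperties
import Algebra.Properties.Semiring.Mult as SemiringMult
import Algebra.Properties.Semiring.Sum as SemiringSum
import Algebra.Solver.Ring as RingSolver
open import Algebra.Solver.Ring.AlmostCommutativeRing using (_-Raw-AlmostCommutative⟶_; fromCommutativeRing)
open import Data.Bool.Base using (Bool; true; false; not)
open import Data.Bool.Properties using () renaming (_≟_ to _≟ᵇ_)
open import Data.Empty using (⊥; ⊥-elim)
open import Data.Fin.Base as Fin using (Fin; zero; suc; combine; punchIn; punchOut; splitAt; toℕ)
open import Data.Fin.Properties as Fin using (_≟_)
open import Data.List.Base using (List; []; _∷_; last; map)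
open import Data.List.Membership.Propositional using () renaming (_∈_ to _∈ˡ_)
import Data.List.Membership.DecPropositional as DecMembership
import Data.List.Membership.Setoid as SetoidMembership
import Data.List.Relation.Binary.Disjoint.Setoid as DisjointSetoid
open import Data.List.Relation.Unary.All as All using (All; []; _∷_)
import Data.List.Relation.Unary.All.Properties as All
open import Data.List.Relation.Unary.AllPairs using ([]; _∷_)
open import Data.List.Relation.Unary.Any using (here; there)
open import Data.List.Relation.Unary.Linked using (Linked; [-]; _∷_)
import Data.List.Relation.Unary.Unique.Setoid as UniqueSetoid
open import Data.Maybe.Base using (Maybe; just; nothing)
open import Data.Nat.Base as ℕ using (ℕ; zero; suc; ⌊_/2⌋)
open import Data.Nat.Induction using (<-rec)
import Data.Nat.Properties as ℕ
open import Data.Product.Base using (∃; _×_; _,_; proj₁; proj₂; swap)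
open import Data.Product.Properties using (≡-dec)
open import Data.Sum.Base as Sum using (_⊎_; inj₁; inj₂)
open import Data.Unit.Base using (⊤; tt)
open import Data.Vec.Functional using (Vector)
import Data.Vec.Functional.Relation.Binary.Equality.Setoid as VectorEquality
open import Function.Base using (_∘_; case_of_)
open import Function.Bundles using (Equivalence)
open import Function.Definitions using (Injective)
import Level
open import Relation.Binary.Bundles using (Setoid)
open import Relation.Binary.PropositionalEquality as ≡ using (_≡_; _≢_)
import Relation.Binary.Reasoning.Setoid as SetoidReasoning
open import Relation.Binary.Structures using (IsStrictPartialOrder)
open import Relation.Nullary
open import Relation.Nullary.Decidable using (decidable-stable; ¬?; _×-dec_; _⊎-dec_)
open import Relation.Unary using (Pred; _∈_)

-- Finite choice and counting

-- The order of the reals is not decidable, which shapes the geometric half. Signs are decided only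
-- for numbers apart from zero: the weights `w` are of this kind, the slacks of an arbitrary point
-- of the dual are not. Positive slacks are therefore extracted from sums known to be positive. This
-- needs a second dependence `μ`, with positive coefficients only, which exists because the origin
-- is interior; it controls the constant 1 in the inequalities of the dual, while `w` relates the
-- slacks among each other. The parameters are pairwise apart but come in no particular order, so
-- the signs of `w` are counted with the square of a polynomial and not by alternation along the
-- curve.
--
-- In the combinatorial half the number of pairs, of rows and of columns drop together, so the
-- bounds `k < p` and `k < q` survive the induction. The obstacle is that a displaced terminal gets
-- a single move, and that different terminals must land on different cells. A terminal where a
-- deleted row crosses a deleted column would have to leave both lines; hence the role of the corner
-- of a pair.

Term : ℕ → Set
Term k = Fin k × Bool

mate : ∀ {k} → Term k → Term k
mate (i , b) = i , not b

mate≢ : ∀ {k} (x : Term k) → mate x ≢ x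
mate≢ (i , false) ()
mate≢ (i , true)  ()

_≟ᵗ_ : ∀ {k} (x y : Term k) → Dec (x ≡ y)
_≟ᵗ_ = ≡-dec _≟_ _≟ᵇ_

-- `P` and `Q` need not be complementary, so either outcome carries positive evidence.
finChoice : ∀ {n} {P Q : Fin n → Set} → (∀ c → P c ⊎ Q c) → ∃ P ⊎ (∀ c → Q c)
finChoice {zero}  h = inj₂ λ ()
finChoice {suc n} h with h zero | finChoice (h ∘ suc)
... | inj₁ p | _              = inj₁ (zero , p)
... | inj₂ _ | inj₁ (c , p)   = inj₁ (suc c , p)
... | inj₂ q | inj₂ qs        = inj₂ λ { zero → q ; (suc c) → qs c }

termChoice : ∀ {k} {P Q : Term k → Set} → (∀ x → P x ⊎ Q x) → ∃ P ⊎ (∀ x → Q x)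
termChoice {k} {P} {Q} h with finChoice {P = λ i → ∃ λ b → P (i , b)} {Q = λ i → ∀ b → Q (i , b)} pair
  where
  pair : ∀ i → (∃ λ b → P (i , b)) ⊎ (∀ b → Q (i , b))
  pair i with h (i , false) | h (i , true)
  ... | inj₁ p | _      = inj₁ (false , p)
  ... | inj₂ _ | inj₁ p = inj₁ (true , p)
  ... | inj₂ p | inj₂ q = inj₂ λ { false → p ; true → q }
... | inj₁ (i , b , p) = inj₁ ((i , b) , p)
... | inj₂ q           = inj₂ λ (i , b) → q i b

termAny? : ∀ {k} {P : Term k → Set} → (∀ x → Dec (P x)) → ∃ P ⊎ (∀ x → ¬ P x)
termAny? P? = termChoice λ x → case P? x of λ { (yes p) → inj₁ p ; (no ¬p) → inj₂ ¬p }

bit : Bool → Fin 2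
bit false = zero
bit true  = suc zero

bit-injective : ∀ {b b′} → bit b ≡ bit b′ → b ≡ b′
bit-injective {false} {false} _ = ≡.refl
bit-injective {true}  {true}  _ = ≡.refl
bit-injective {false} {true}  ()
bit-injective {true}  {false} ()

term-bound : ∀ {m k} (f : Fin m → Term k) → Injective _≡_ _≡_ f → m ℕ.≤ k ℕ.* 2
term-bound f f-inj = Fin.injective⇒≤ {f = λ i → code (f i)} (f-inj ∘ code-inj)
  where
  code : ∀ {k} → Term k → Fin (k ℕ.* 2)
  code (i , b) = combine i (bit b)
  code-inj : ∀ {k} {x y : Term k} → code x ≡ code y → x ≡ y
  code-inj {x = i , b} {j , b′} eq with Fin.combine-injective i (bit b) j (bit b′) eq
  ... | ≡.refl , eq′ = ≡.cong (i ,_) (bit-injective eq′)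

toBool : Fin 2 → Bool
toBool zero    = false
toBool (suc _) = true

toBool-injective : ∀ {i j} → toBool i ≡ toBool j → i ≡ j
toBool-injective {zero}     {zero}     _ = ≡.refl
toBool-injective {suc zero} {suc zero} _ = ≡.refl
toBool-injective {zero}     {suc _}    ()
toBool-injective {suc _}    {zero}     ()

module Lines {k q} (line : Term k → Fin q) where

  -- `Two` allows more than two terminals. Its two witnesses are data, so that counting can turn
  -- them into an injection.
  Empty Single Two : Fin q → Set
  Empty  c = ∀ x → line x ≢ c
  Single c = ∃ λ x → line x ≡ c × (∀ y → line y ≡ c → y ≡ x)
  Two    c = ∃ λ x → ∃ λ y → x ≢ y × line x ≡ c × line y ≡ c

  classify : ∀ c → Single c ⊎ (Empty c ⊎ Two c)
  classify c with termAny? (λ x → line x ≟ c)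
  ... | inj₂ none = inj₂ (inj₁ none)
  ... | inj₁ (x , x∈) with termChoice {P = λ y → line y ≡ c × x ≢ y} {Q = λ y → line y ≡ c → y ≡ x} decide
    where
    decide : ∀ y → (line y ≡ c × x ≢ y) ⊎ (line y ≡ c → y ≡ x)
    decide y with line y ≟ c | x ≟ᵗ y
    ... | no y∉  | _        = inj₂ λ y∈ → ⊥-elim (y∉ y∈)
    ... | yes _  | yes x≡y  = inj₂ λ _ → ≡.sym x≡y
    ... | yes y∈ | no x≢y   = inj₁ (y∈ , x≢y)
  ... | inj₁ (y , y∈ , x≢y) = inj₂ (inj₂ (x , y , x≢y , x∈ , y∈))
  ... | inj₂ only           = inj₁ (x , x∈ , only)

  choose : ∀ {c} → Two c → Bool → Term k
  choose (x , y , _) false = x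
  choose (x , y , _) true  = y

  choose-line : ∀ {c} (w : Two c) b → line (choose w b) ≡ c
  choose-line (x , y , _ , x∈ , y∈) false = x∈
  choose-line (x , y , _ , x∈ , y∈) true  = y∈

  choose-inj : ∀ {c} (w : Two c) {b b′} → choose w b ≡ choose w b′ → b ≡ b′
  choose-inj w {false} {false} _ = ≡.refl
  choose-inj w {true}  {true}  _ = ≡.refl
  choose-inj w {false} {true}  e = ⊥-elim (proj₁ (proj₂ (proj₂ w)) e)
  choose-inj w {true}  {false} e = ⊥-elim (proj₁ (proj₂ (proj₂ w)) (≡.sym e))

  -- The map `ι` selects some of the lines. Terminals on different lines differ, so two witnesses
  -- per line give an injection from a set of size `m * 2`.
  module Picks {m} (ι : Fin m → Fin q) (ι-inj : Injective _≡_ _≡_ ι) (two : ∀ c → Two (ι c)) where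

    pick₂ : Fin m × Fin 2 → Term k
    pick₂ (c , b) = choose (two c) (toBool b)

    pick₂-injective : ∀ {u v} → pick₂ u ≡ pick₂ v → u ≡ v
    pick₂-injective {c , b} {c′ , b′} e
      with ≡.refl ← ι-inj (≡.trans (≡.sym (choose-line (two c) (toBool b))) (≡.trans (≡.cong line e) (choose-line (two c′) (toBool b′))))
      = ≡.cong (c ,_) (toBool-injective (choose-inj (two c) e))

    pick : Fin (m ℕ.* 2) → Term k
    pick = pick₂ ∘ Fin.remQuot 2

    pick-injective : Injective _≡_ _≡_ pick
    pick-injective {z} {z′} e =
      ≡.trans (≡.sym (Fin.combine-remQuot {m} 2 z))
        (≡.trans (≡.cong (λ u → combine (proj₁ u) (proj₂ u)) (pick₂-injective {Fin.remQuot 2 z} {Fin.remQuot 2 z′} e))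
          (Fin.combine-remQuot {m} 2 z′))

    two-bound : m ℕ.* 2 ℕ.≤ k ℕ.* 2
    two-bound = term-bound pick pick-injective

    two-bound⁺ : ∀ x → (∀ z → pick z ≢ x) → suc (m ℕ.* 2) ℕ.≤ k ℕ.* 2
    two-bound⁺ x x∉ = term-bound g g-inj
      where
      g : Fin (suc (m ℕ.* 2)) → Term k
      g zero    = x
      g (suc z) = pick z
      g-inj : Injective _≡_ _≡_ g
      g-inj {zero}  {zero}   _  = ≡.refl
      g-inj {zero}  {suc z}  e  = ⊥-elim (x∉ z (≡.sym e))
      g-inj {suc z} {zero}   e  = ⊥-elim (x∉ z e)
      g-inj {suc z} {suc z′} e  = ≡.cong suc (pick-injective e)

  not-all-two : k ℕ.< q → (∀ c → Two c) → ⊥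
  not-all-two k<q two = ℕ.<⇒≱ (ℕ.*-monoˡ-< 2 k<q) (Picks.two-bound (λ c → c) (λ e → e) two)

-- If every line but one meets two terminals, counting leaves no room for a third one.
module _ {k q} (line : Term k → Fin (suc q)) where
  open Lines line

  exactly-two : k ℕ.< suc q → ∀ {c₀} → (∀ c → c ≢ c₀ → Two c) →
                ∀ {c x y z} → c ≢ c₀ → line x ≡ c → line y ≡ c → line z ≡ c →
                x ≢ y → z ≡ x ⊎ z ≡ y
  exactly-two k<q {c₀} two {c} {x} {y} {z} c≢c₀ x∈ y∈ z∈ x≢y =
    conclude (chosen x x∈) (chosen y y∈) (chosen z z∈)
    where
    ι   = punchIn c₀
    ι-inj : Injective _≡_ _≡_ ι
    ι-inj = Fin.punchIn-injective c₀ _ _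
    tw : ∀ c → Two (ι c)
    tw c = two (ι c) (Fin.punchInᵢ≢i c₀ c)
    open Picks ι ι-inj tw
    c* = punchOut (c≢c₀ ∘ ≡.sym)
    chosen : ∀ v → line v ≡ c → ∃ λ b → choose (tw c*) b ≡ v
    chosen v v∈ with Fin.any? (λ u → pick u ≟ᵗ v)
    -- Together with an unpicked `v`, the picks would be `2q + 1` distinct terminals, but there are
    -- only `2k` and `k ≤ q`. Hence all terminals are picked.
    ... | no ¬h = ⊥-elim (ℕ.<⇒≱ (two-bound⁺ v λ u e → ¬h (u , e)) (ℕ.*-monoˡ-≤ 2 (ℕ.≤-pred k<q)))
    ... | yes (u , e) = found (Fin.remQuot 2 u) e
      where
      found : ∀ r → pick₂ r ≡ v → ∃ λ b → choose (tw c*) b ≡ v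
      found (c′ , b) ≡.refl
        with ≡.refl ← ι-inj {c′} {c*} (≡.trans (≡.sym (choose-line (tw c′) (toBool b))) (≡.trans v∈ (≡.sym (Fin.punchIn-punchOut (c≢c₀ ∘ ≡.sym)))))
        = toBool b , ≡.refl
    conclude : (∃ λ b → choose (tw c*) b ≡ x) → (∃ λ b → choose (tw c*) b ≡ y) →
               (∃ λ b → choose (tw c*) b ≡ z) → z ≡ x ⊎ z ≡ y
    conclude (false , e) (false , e′) _ = ⊥-elim (x≢y (≡.trans (≡.sym e) e′))
    conclude (true  , e) (true  , e′) _ = ⊥-elim (x≢y (≡.trans (≡.sym e) e′))
    conclude (false , e) (true  , e′) (false , e″) = inj₁ (≡.trans (≡.sym e″) e)
    conclude (false , e) (true  , e′) (true  , e″) = inj₂ (≡.trans (≡.sym e″) e′)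
    conclude (true  , e) (false , e′) (false , e″) = inj₂ (≡.trans (≡.sym e″) e′)
    conclude (true  , e) (false , e′) (true  , e″) = inj₁ (≡.trans (≡.sym e″) e)

-- Linkages in the rook's graph

Cell : ℕ → ℕ → Set
Cell p q = Fin p × Fin q

infix 4 _∼_
-- Reflexive on purpose: a terminal that need not move, or a degenerate corner, takes a step in
-- place. `erase-loops` removes the repetitions.
_∼_ : ∀ {p q} → Cell p q → Cell p q → Set
(a , b) ∼ (c , e) = a ≡ c ⊎ b ≡ e

∼-sym : ∀ {p q} {x y : Cell p q} → x ∼ y → y ∼ x
∼-sym (inj₁ e) = inj₁ (≡.sym e)
∼-sym (inj₂ e) = inj₂ (≡.sym e)

data Walk {p q} (D : Cell p q → Set) : Cell p q → Cell p q → Set where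
  stop : ∀ {x} → D x → Walk D x x
  step : ∀ {x y z} → D x → x ∼ y → Walk D y z → Walk D x z

module _ {p q} {D : Cell p q → Set} where

  start∈ : ∀ {x y} → Walk D x y → D x
  start∈ (stop x∈)     = x∈
  start∈ (step x∈ _ _) = x∈

  end∈ : ∀ {x y} → Walk D x y → D y
  end∈ (stop x∈)    = x∈
  end∈ (step _ _ w) = end∈ w

  snoc : ∀ {x y z} → Walk D x y → y ∼ z → D z → Walk D x z
  snoc (stop x∈)     e z∈ = step x∈ e (stop z∈)
  snoc (step x∈ d w) e z∈ = step x∈ d (snoc w e z∈)

  reverse : ∀ {x y} → Walk D x y → Walk D y x
  reverse (stop x∈)     = stop x∈
  reverse (step x∈ e w) = snoc (reverse w) (∼-sym e) x∈

map-walk : ∀ {p q p′ q′} {D : Cell p q → Set} {D′ : Cell p′ q′ → Set} (f : Cell p q → Cell p′ q′) →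
           (∀ {x y} → x ∼ y → f x ∼ f y) → (∀ {x} → D x → D′ (f x)) →
           ∀ {x y} → Walk D x y → Walk D′ (f x) (f y)
map-walk f f-∼ f-D (stop x∈)     = stop (f-D x∈)
map-walk f f-∼ f-D (step x∈ e w) = step (f-D x∈) (f-∼ e) (map-walk f f-∼ f-D w)

-- Disjointness is demanded of sets that contain the walks, so that linkages are extended without
-- handling lists of cells. `Active` and `Live` hold the pairs and cells that remain, which
-- postpones all renumbering to `restrict`.
record Linkage {p q k} (Active : Fin k → Set) (Live : Cell p q → Set) (T : Term k → Cell p q) : Set₁ where
  field
    part     : Fin k → Cell p q → Set
    live     : ∀ {i} → Active i → ∀ {x} → part i x → Live x
    walk     : ∀ {i} → Active i → Walk (part i) (T (i , false)) (T (i , true))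
    disjoint : ∀ {i j} → Active i → Active j → i ≢ j → ∀ {x} → part i x → ¬ part j x

  terminal∈ : ∀ x → Active (proj₁ x) → part (proj₁ x) (T x)
  terminal∈ (i , false) act = start∈ (walk act)
  terminal∈ (i , true)  act = end∈ (walk act)

All-cells : ∀ {p q} → Cell p q → Set
All-cells _ = ⊤

Linkable : ℕ → ℕ → ℕ → Set₁
Linkable k p q = ∀ (T : Term k → Cell p q) → Injective _≡_ _≡_ T → Linkage (λ _ → ⊤) All-cells T

-- One pair is linked through the cells ds outside Live′; every other terminal that is
-- not in Live′ makes one move into it.
extend : ∀ {p q k} {A A′ : Fin k → Set} {Live Live′ : Cell p q → Set} {T : Term k → Cell p q}
         (T′ : Term k → Cell p q) (x : Term k) →
         (∀ j → A j → j ≡ proj₁ x ⊎ A′ j) →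
         (ds : List (Cell p q)) → Walk (_∈ˡ ds) (T x) (T (mate x)) →
         All (λ c → Live c × ¬ Live′ c) ds →
         (∀ y → A′ (proj₁ y) → All (T y ≢_) ds) →
         (∀ {c} → Live′ c → Live c) →
         (∀ y → A′ (proj₁ y) → Live (T y) × T y ∼ T′ y × (Live′ (T y) → T′ y ≡ T y)) →
         (∀ y z → A′ (proj₁ y) → A′ (proj₁ z) → T y ≡ T z → y ≡ z) →
         Linkage A′ Live′ T′ → Linkage A Live T
extend {A = A} {A′} {Live} {Live′} {T} T′ x A⊆ ds ds-walk ds-dead ds-free Live′⊆ moves T-inj ℓ = record
  { part     = part
  ; live     = λ _ → part-live
  ; walk     = λ {j} a → walk j (A⊆ j a)
  ; disjoint = λ _ _ → disjoint
  }
  where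
  module ℓ = Linkage ℓ
  part : Fin _ → Cell _ _ → Set
  -- Another pair keeps its part in the smaller linkage and adds its two original terminals, which
  -- may lie outside `Live′`.
  part j c = (j ≡ proj₁ x × c ∈ˡ ds) ⊎ (A′ j × (ℓ.part j c ⊎ ∃ λ b → c ≡ T (j , b)))

  part-live : ∀ {j c} → part j c → Live c
  part-live (inj₁ (_ , c∈))              = proj₁ (All.lookup ds-dead c∈)
  part-live (inj₂ (a , inj₁ c∈))         = Live′⊆ (ℓ.live a c∈)
  part-live (inj₂ (a , inj₂ (b , ≡.refl))) = proj₁ (moves (_ , b) a)

  walk : ∀ j → j ≡ proj₁ x ⊎ A′ j → Walk (part j) (T (j , false)) (T (j , true))
  walk j (inj₁ ≡.refl) = map-walk (λ c → c) (λ e → e) (λ c∈ → inj₁ (≡.refl , c∈)) (orient x ds-walk)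
    where
    orient : ∀ y → Walk (_∈ˡ ds) (T y) (T (mate y)) →
             Walk (_∈ˡ ds) (T (proj₁ y , false)) (T (proj₁ y , true))
    orient (i , false) w = w
    orient (i , true)  w = reverse w
  walk j (inj₂ a) =
    step (inj₂ (a , inj₂ (false , ≡.refl))) (proj₁ (proj₂ (moves (j , false) a)))
      (snoc (map-walk (λ c → c) (λ e → e) (λ c∈ → inj₂ (a , inj₁ c∈)) (ℓ.walk a))
        (∼-sym (proj₁ (proj₂ (moves (j , true) a)))) (inj₂ (a , inj₂ (true , ≡.refl))))

  away : ∀ {j c} → c ∈ˡ ds → A′ j → ¬ (ℓ.part j c ⊎ ∃ λ b → c ≡ T (j , b))
  away c∈ a (inj₁ c∈′)         = proj₂ (All.lookup ds-dead c∈) (ℓ.live a c∈′)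
  away c∈ a (inj₂ (b , ≡.refl))  = All.lookup (ds-free (_ , b) a) c∈ ≡.refl

  apart : ∀ {i j b c} → A′ i → A′ j → i ≢ j → ℓ.part i c → c ≢ T (j , b)
  -- A terminal of `j` met by part `i` lies in `Live′`, hence it did not move and belongs to part
  -- `j` as well.
  apart a a′ i≢j c∈ ≡.refl = ℓ.disjoint a a′ i≢j c∈
    (≡.subst (ℓ.part _) (proj₂ (proj₂ (moves _ a′)) (ℓ.live a c∈)) (ℓ.terminal∈ _ a′))

  disjoint : ∀ {i j} → i ≢ j → ∀ {c} → part i c → ¬ part j c
  disjoint i≢j (inj₁ (e , _))  (inj₁ (e′ , _)) = i≢j (≡.trans e (≡.sym e′))
  disjoint i≢j (inj₁ (_ , c∈)) (inj₂ (a , c∈′)) = away c∈ a c∈′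
  disjoint i≢j (inj₂ (a , c∈)) (inj₁ (_ , c∈′)) = away c∈′ a c∈
  disjoint i≢j (inj₂ (a , inj₁ c∈)) (inj₂ (a′ , inj₁ c∈′)) = ℓ.disjoint a a′ i≢j c∈ c∈′
  disjoint i≢j (inj₂ (a , inj₁ c∈)) (inj₂ (a′ , inj₂ (b , e))) = apart a a′ i≢j c∈ e
  disjoint i≢j (inj₂ (a , inj₂ (b , e))) (inj₂ (a′ , inj₁ c∈)) = apart a′ a (i≢j ∘ ≡.sym) c∈ e
  disjoint i≢j (inj₂ (a , inj₂ (b , e))) (inj₂ (a′ , inj₂ (b′ , e′))) =
    i≢j (≡.cong proj₁ (T-inj (_ , b) (_ , b′) a a′ (≡.trans (≡.sym e) e′)))

-- Renumbering the remaining pairs, rows and columns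

-- A numbering of the subset `P`. It serves for the lines and pairs that survive a deletion, and
-- later for the indices of either sign.
record Embed {ℓ} (m n : ℕ) (P : Fin n → Set ℓ) : Set ℓ where
  field
    f    : Fin m → Fin n
    inj  : ∀ {i j} → f i ≡ f j → i ≡ j
    into : ∀ i → P (f i)
    onto : ∀ j → P j → ∃ λ i → f i ≡ j

skip : ∀ {n} (i : Fin (suc n)) → Embed n (suc n) (_≢ i)
skip i = record
  { f    = punchIn i
  ; inj  = Fin.punchIn-injective i _ _
  ; into = Fin.punchInᵢ≢i i
  ; onto = λ j j≢i → punchOut (j≢i ∘ ≡.sym) , Fin.punchIn-punchOut (j≢i ∘ ≡.sym)
  }

skip₂ : ∀ {n} (i j : Fin (suc (suc n))) → i ≢ j → Embed n (suc (suc n)) (λ x → x ≢ i × x ≢ j)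
skip₂ i j i≢j = record
  { f    = punchIn i ∘ punchIn j′
  ; inj  = Fin.punchIn-injective j′ _ _ ∘ Fin.punchIn-injective i _ _
  ; into = λ x → Fin.punchInᵢ≢i i _ ,
                 λ e → Fin.punchInᵢ≢i j′ x (Fin.punchIn-injective i _ _ (≡.trans e (≡.sym (Fin.punchIn-punchOut i≢j))))
  ; onto = onto
  }
  where
  j′ = punchOut i≢j
  onto : ∀ x → x ≢ i × x ≢ j → ∃ λ y → punchIn i (punchIn j′ y) ≡ x
  onto x (x≢i , x≢j) = punchOut j′≢ , ≡.trans (≡.cong (punchIn i) (Fin.punchIn-punchOut j′≢)) (Fin.punchIn-punchOut (x≢i ∘ ≡.sym))
    where
    j′≢ : j′ ≢ punchOut (x≢i ∘ ≡.sym)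
    j′≢ e = x≢j (≡.trans (≡.sym (Fin.punchIn-punchOut (x≢i ∘ ≡.sym))) (≡.trans (≡.cong (punchIn i) (≡.sym e)) (Fin.punchIn-punchOut i≢j)))

-- The induction hypothesis speaks of a complete smaller board. The live cells form such a board
-- after renumbering, since they are a product of a set of rows and a set of columns.
restrict : ∀ {k p q k′ p′ q′} {A : Fin k → Set} {R : Fin p → Set} {C : Fin q → Set} →
           Embed k′ k A → Embed p′ p R → Embed q′ q C → Linkable k′ p′ q′ →
           (T : Term k → Cell p q) →
           (∀ y → A (proj₁ y) → R (proj₁ (T y)) × C (proj₂ (T y))) →
           (∀ y z → A (proj₁ y) → A (proj₁ z) → T y ≡ T z → y ≡ z) →
           Linkage A (λ c → R (proj₁ c) × C (proj₂ c)) T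
restrict {k} {p} {q} {k′} {p′} {q′} {A} π ρ γ linked T T-live T-inj = record
  { part     = part
  ; live     = λ { _ (_ , (r , c) , _ , ≡.refl , _) → ρ.into r , γ.into c }
  ; walk     = λ {j} a → walk j (π.onto j a)
  ; disjoint = λ { _ _ i≢j (i , x , ≡.refl , ≡.refl , x∈) (j , y , ≡.refl , e , y∈) →
                   ℓ.disjoint tt tt (i≢j ∘ ≡.cong π.f) x∈ (≡.subst (ℓ.part j) (embed-inj e) y∈) }
  }
  where
  module π = Embed π
  module ρ = Embed ρ
  module γ = Embed γ
  embed : Cell p′ q′ → Cell p q
  embed (r , c) = ρ.f r , γ.f c
  embed-inj : ∀ {x y} → embed x ≡ embed y → x ≡ y
  embed-inj e = ≡.cong₂ _,_ (ρ.inj (≡.cong proj₁ e)) (γ.inj (≡.cong proj₂ e))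
  T′ : Term k′ → Cell p′ q′
  T′ (i , b) = let r , c = T-live (π.f i , b) (π.into i) in
    proj₁ (ρ.onto _ r) , proj₁ (γ.onto _ c)
  embed-T′ : ∀ i b → embed (T′ (i , b)) ≡ T (π.f i , b)
  embed-T′ i b = let r , c = T-live (π.f i , b) (π.into i) in
    ≡.cong₂ _,_ (proj₂ (ρ.onto _ r)) (proj₂ (γ.onto _ c))
  T′-inj : Injective _≡_ _≡_ T′
  T′-inj {i , b} {j , b′} e with T-inj (π.f i , b) (π.f j , b′) (π.into i) (π.into j)
                                   (≡.trans (≡.sym (embed-T′ i b)) (≡.trans (≡.cong embed e) (embed-T′ j b′)))
  ... | e′ = ≡.cong₂ _,_ (π.inj (≡.cong proj₁ e′)) (≡.cong proj₂ e′)
  ℓ = linked T′ T′-inj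
  module ℓ = Linkage ℓ
  part : Fin k → Cell p q → Set
  part j c = ∃ λ i → ∃ λ x → π.f i ≡ j × embed x ≡ c × ℓ.part i x
  walk : ∀ j → (∃ λ i → π.f i ≡ j) → Walk (part j) (T (j , false)) (T (j , true))
  walk j (i , ≡.refl) = ≡.subst₂ (Walk (part j)) (embed-T′ i false) (embed-T′ i true)
    (map-walk embed (λ { (inj₁ e) → inj₁ (≡.cong ρ.f e) ; (inj₂ e) → inj₂ (≡.cong γ.f e) })
      (λ {x} x∈ → i , x , ≡.refl , ≡.refl , x∈) (ℓ.walk tt))

-- Rows and columns play symmetric roles, so each construction is carried out in one orientation
-- only.
transpose : ∀ {k p q} {A : Fin k → Set} {Live : Cell p q → Set} {T : Term k → Cell p q} →
            Linkage A (Live ∘ swap) (swap ∘ T) → Linkage A Live T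
transpose ℓ = record
  { part     = λ i → ℓ.part i ∘ swap
  ; live     = λ a x∈ → ℓ.live a x∈
  ; walk     = λ a → map-walk swap (λ { (inj₁ e) → inj₂ e ; (inj₂ e) → inj₁ e }) (λ x∈ → x∈) (ℓ.walk a)
  ; disjoint = λ a a′ i≢j → ℓ.disjoint a a′ i≢j
  }
  where module ℓ = Linkage ℓ

weaken : ∀ {k p q} {A : Fin k → Set} {Live Live′ : Cell p q → Set} {T : Term k → Cell p q} →
         (∀ {c} → Live′ c → Live c) → Linkage A Live′ T → Linkage A Live T
weaken Live′⊆ ℓ = record
  { part     = ℓ.part
  ; live     = λ a x∈ → Live′⊆ (ℓ.live a x∈)
  ; walk     = ℓ.walk
  ; disjoint = ℓ.disjoint
  }
  where module ℓ = Linkage ℓ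

-- Evacuating lines

module _ {n : ℕ} where

  -- One coordinate of a move: line `a` is evacuated to `R`. It stays injective on indices different
  -- from `R`, that is, if the target was empty.
  replace : (a R r : Fin n) → Fin n
  replace a R r with r ≟ a
  ... | yes _ = R
  ... | no _  = r

  replace-cases : ∀ a R r → (r ≡ a × replace a R r ≡ R) ⊎ (r ≢ a × replace a R r ≡ r)
  replace-cases a R r with r ≟ a
  ... | yes r≡a = inj₁ (r≡a , ≡.refl)
  ... | no r≢a  = inj₂ (r≢a , ≡.refl)

  replace-≢ : ∀ {a R} r → R ≢ a → replace a R r ≢ a
  replace-≢ {a} {R} r R≢a with replace-cases a R r
  ... | inj₁ (_ , e)   = R≢a ∘ ≡.trans (≡.sym e)
  ... | inj₂ (r≢a , e) = r≢a ∘ ≡.trans (≡.sym e)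

  replace-inj : ∀ {a R r r′} → r ≢ R → r′ ≢ R → replace a R r ≡ replace a R r′ → r ≡ r′
  replace-inj {a} {R} {r} {r′} r≢R r′≢R eq with replace-cases a R r | replace-cases a R r′
  ... | inj₁ (≡.refl , _) | inj₁ (≡.refl , _) = ≡.refl
  ... | inj₁ (_ , e)    | inj₂ (_ , e′)   = ⊥-elim (r′≢R (≡.trans (≡.sym e′) (≡.trans (≡.sym eq) e)))
  ... | inj₂ (_ , e)    | inj₁ (_ , e′)   = ⊥-elim (r≢R (≡.trans (≡.sym e) (≡.trans eq e′)))
  ... | inj₂ (_ , e)    | inj₂ (_ , e′)   = ≡.trans (≡.sym e) (≡.trans eq e′)

  replace₂ : (a R c R′ r : Fin n) → Fin n
  replace₂ a R c R′ r with r ≟ a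
  ... | yes _ = R
  ... | no _  = replace c R′ r

  data Replaced (a R c R′ r s : Fin n) : Set where
    first  : r ≡ a → s ≡ R → Replaced a R c R′ r s
    second : r ≡ c → s ≡ R′ → Replaced a R c R′ r s
    other  : r ≢ a → r ≢ c → s ≡ r → Replaced a R c R′ r s

  replaced : ∀ a R c R′ r → Replaced a R c R′ r (replace₂ a R c R′ r)
  replaced a R c R′ r with r ≟ a
  ... | yes r≡a = first r≡a ≡.refl
  ... | no r≢a with replace-cases c R′ r
  ...   | inj₁ (r≡c , e) = second r≡c e
  ...   | inj₂ (r≢c , e) = other r≢a r≢c e

  replace₂-first : ∀ a R c R′ → replace₂ a R c R′ a ≡ R
  replace₂-first a R c R′ with a ≟ a
  ... | yes _  = ≡.refl
  ... | no a≢a = ⊥-elim (a≢a ≡.refl)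

  replace₂-≢ : ∀ {a R c R′} r → R ≢ a × R ≢ c → R′ ≢ a × R′ ≢ c →
               replace₂ a R c R′ r ≢ a × replace₂ a R c R′ r ≢ c
  replace₂-≢ {a} {R} {c} {R′} r (R≢a , R≢c) (R′≢a , R′≢c) with replaced a R c R′ r
  ... | first  _ e       = R≢a ∘ ≡.trans (≡.sym e) , R≢c ∘ ≡.trans (≡.sym e)
  ... | second _ e       = R′≢a ∘ ≡.trans (≡.sym e) , R′≢c ∘ ≡.trans (≡.sym e)
  ... | other r≢a r≢c e  = r≢a ∘ ≡.trans (≡.sym e) , r≢c ∘ ≡.trans (≡.sym e)

  -- The two targets may coincide. Only then can an index from `a` collide with one from `c`, which
  -- the two implications exclude.
  replace₂-inj : ∀ {a R c R′ r r′} → r ≢ R → r ≢ R′ → r′ ≢ R → r′ ≢ R′ →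
                 (R ≡ R′ → r ≡ a → r′ ≡ c → ⊥) → (R ≡ R′ → r′ ≡ a → r ≡ c → ⊥) →
                 replace₂ a R c R′ r ≡ replace₂ a R c R′ r′ → r ≡ r′
  replace₂-inj {a} {R} {c} {R′} {r} {r′} r≢R r≢R′ r′≢R r′≢R′ h h′ eq
    with replaced a R c R′ r | replaced a R c R′ r′
  ... | first ≡.refl _  | first ≡.refl _   = ≡.refl
  ... | second ≡.refl _ | second ≡.refl _  = ≡.refl
  ... | first p e     | second p′ e′   = ⊥-elim (h (≡.trans (≡.sym e) (≡.trans eq e′)) p p′)
  ... | second p e    | first p′ e′    = ⊥-elim (h′ (≡.trans (≡.sym e′) (≡.trans (≡.sym eq) e)) p′ p)
  ... | first _ e     | other _ _ e′   = ⊥-elim (r′≢R (≡.trans (≡.sym e′) (≡.trans (≡.sym eq) e)))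
  ... | second _ e    | other _ _ e′   = ⊥-elim (r′≢R′ (≡.trans (≡.sym e′) (≡.trans (≡.sym eq) e)))
  ... | other _ _ e   | first _ e′     = ⊥-elim (r≢R (≡.trans (≡.sym e) (≡.trans eq e′)))
  ... | other _ _ e   | second _ e′    = ⊥-elim (r≢R′ (≡.trans (≡.sym e) (≡.trans eq e′)))
  ... | other _ _ e   | other _ _ e′   = ≡.trans (≡.sym e) (≡.trans eq e′)

remove : ∀ {n} (i : Fin n) {A : Fin n → Set} j → A j → j ≡ i ⊎ (j ≢ i)
remove i j _ with j ≟ i
... | yes e = inj₁ e
... | no ¬e = inj₂ ¬e

-- Linking one or two pairs and deleting their lines

row : ∀ {k p q} → (Term k → Cell p q) → Term k → Fin p
row T x = proj₁ (T x)

col : ∀ {k p q} → (Term k → Cell p q) → Term k → Fin q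
col T x = proj₂ (T x)

-- A pair, one of whose terminals is alone in its column, is linked through the corner
-- in that column.
link-single : ∀ {k p q} → Linkable k p q →
              (T : Term (suc k) → Cell (suc p) (suc q)) → Injective _≡_ _≡_ T →
              (w : Term (suc k)) → (∀ y → col T y ≡ col T w → y ≡ w) →
              (∀ c → ∃ λ r → ∀ y → T y ≢ (r , c)) →
              Linkage (λ _ → ⊤) All-cells T
link-single linked T T-inj w only free =
  extend T′ w (remove (proj₁ w)) (T w ∷ (a , c) ∷ T (mate w) ∷ [])
    (step (here ≡.refl) (inj₂ ≡.refl) (step (there (here ≡.refl)) (inj₁ ≡.refl) (stop (there (there (here ≡.refl))))))
    ((tt , λ l → proj₂ l ≡.refl) ∷ (tt , λ l → proj₂ l ≡.refl) ∷ (tt , λ l → proj₁ l ≡.refl) ∷ [])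
    (λ y y∉ → (λ e → y∉ (≡.cong proj₁ (T-inj e))) ∷ (λ e → y∉ (≡.cong proj₁ (only y (≡.cong proj₂ e)))) ∷
              (λ e → y∉ (≡.cong proj₁ (T-inj e))) ∷ [])
    (λ _ → tt)
    (λ y y∉ → tt , inj₂ ≡.refl , λ l → ≡.cong (_, col T y) (stays y (proj₁ l)))
    (λ _ _ _ _ → T-inj)
    (restrict (skip (proj₁ w)) (skip a) (skip c) linked T′
      (λ y y∉ → moved y , λ e → y∉ (≡.cong proj₁ (only y e)))
      (λ y z _ _ e → T-inj (≡.cong₂ _,_ (rows y z (≡.cong proj₁ e) (≡.cong proj₂ e)) (≡.cong proj₂ e))))
  where
  a = row T (mate w)
  c = col T w
  free-row : Fin _ → Fin _
  free-row c = proj₁ (free c)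
  T′ : Term _ → Cell _ _
  -- Terminals leaving row `a` stay in their columns. A column has only one cell in row `a`, so at
  -- most one terminal moves to its free cell.
  T′ y = replace a (free-row (col T y)) (row T y) , col T y
  stays : ∀ y → row T y ≢ a → row (T′) y ≡ row T y
  stays y r≢a with replace-cases a (free-row (col T y)) (row T y)
  ... | inj₁ (r≡a , _) = ⊥-elim (r≢a r≡a)
  ... | inj₂ (_ , e)   = e
  not-free : ∀ y → row T y ≢ free-row (col T y)
  not-free y e = proj₂ (free (col T y)) y (≡.cong (_, col T y) e)
  moved : ∀ y → row T′ y ≢ a
  moved y with replace-cases a (free-row (col T y)) (row T y)
  ... | inj₁ (r≡a , e) = λ e′ → not-free y (≡.trans r≡a (≡.trans (≡.sym e′) e))
  ... | inj₂ (r≢a , e) = r≢a ∘ ≡.trans (≡.sym e)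
  rows : ∀ y z → row T′ y ≡ row T′ z → col T y ≡ col T z → row T y ≡ row T z
  rows y z e e′ = replace-inj (not-free y) (not-free z ∘ λ e″ → ≡.trans e″ (≡.cong free-row e′))
    (≡.trans e (≡.cong (λ c → replace a (free-row c) (row T z)) (≡.sym e′)))

-- Row `a` is evacuated to `R` and column `e` to `C`. As no terminal of another pair is on the
-- corner, none is in both lines and one move suffices. The corner may be a terminal of the pair
-- itself.
link-corner : ∀ {k p q} → Linkable k p q →
              (T : Term (suc k) → Cell (suc p) (suc q)) → Injective _≡_ _≡_ T →
              ∀ {R C} → (∀ y → row T y ≢ R) → (∀ y → col T y ≢ C) →
              (x : Term (suc k)) → (∀ y → proj₁ y ≢ proj₁ x → T y ≢ (row T x , col T (mate x))) →
              Linkage (λ _ → ⊤) All-cells T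
link-corner linked T T-inj {R} {C} R∅ C∅ x corner =
  extend T′ x (remove (proj₁ x)) (T x ∷ (a , e) ∷ T (mate x) ∷ [])
    (step (here ≡.refl) (inj₁ ≡.refl) (step (there (here ≡.refl)) (inj₂ ≡.refl) (stop (there (there (here ≡.refl))))))
    ((tt , λ l → proj₁ l ≡.refl) ∷ (tt , λ l → proj₁ l ≡.refl) ∷ (tt , λ l → proj₂ l ≡.refl) ∷ [])
    (λ y y∉ → (λ e → y∉ (≡.cong proj₁ (T-inj e))) ∷ corner y y∉ ∷ (λ e → y∉ (≡.cong proj₁ (T-inj e))) ∷ [])
    (λ _ → tt)
    (λ y y∉ → tt , near y (corner y y∉) , λ l → stays y l)
    (λ _ _ _ _ → T-inj)
    (restrict (skip (proj₁ x)) (skip a) (skip e) linked T′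
      (λ y _ → replace-≢ (row T y) (R∅ x ∘ ≡.sym) , replace-≢ (col T y) (C∅ (mate x) ∘ ≡.sym))
      (λ y z _ _ eq → T-inj (≡.cong₂ _,_ (replace-inj (R∅ y) (R∅ z) (≡.cong proj₁ eq)) (replace-inj (C∅ y) (C∅ z) (≡.cong proj₂ eq)))))
  where
  a = row T x
  e = col T (mate x)
  T′ : Term _ → Cell _ _
  T′ y = replace a R (row T y) , replace e C (col T y)
  near : ∀ y → T y ≢ (a , e) → T y ∼ T′ y
  near y ≢corner with replace-cases a R (row T y) | replace-cases e C (col T y)
  ... | inj₂ (_ , eq)   | _               = inj₁ (≡.sym eq)
  ... | inj₁ _          | inj₂ (_ , eq)   = inj₂ (≡.sym eq)
  ... | inj₁ (p , _)    | inj₁ (p′ , _)   = ⊥-elim (≢corner (≡.cong₂ _,_ p p′))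
  stays : ∀ y → row T y ≢ a × col T y ≢ e → T′ y ≡ T y
  stays y (r≢a , c≢e) with replace-cases a R (row T y) | replace-cases e C (col T y)
  ... | inj₂ (_ , eq)   | inj₂ (_ , eq′)  = ≡.cong₂ _,_ eq eq′
  ... | inj₁ (p , _)    | _               = ⊥-elim (r≢a p)
  ... | _               | inj₁ (p , _)    = ⊥-elim (c≢e p)

clear-rows : ∀ {k p q} → (Term k → Cell p q) → (a R c R′ : Fin p) → Term k → Cell p q
clear-rows T a R c R′ y = replace₂ a R c R′ (row T y) , col T y

-- The pair runs along its own two rows and changes rows in column `C`; the other terminals of these
-- rows slide along their columns to `R` and `R′`. The active pairs and live cells are arbitrary so
-- that two applications can be nested, one of them transposed.
link-rows : ∀ {k p q} {A A′ : Fin k → Set} {Live : Cell p q → Set} (T : Term k → Cell p q) (x : Term k)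
            (R R′ : Fin p) (C : Fin q) →
            (∀ j → A j → j ≡ proj₁ x ⊎ A′ j) → (∀ j → A′ j → j ≢ proj₁ x) →
            (∀ y z → T y ≡ T z → y ≡ z) → (∀ y → A (proj₁ y) → Live (T y)) → A (proj₁ x) →
            (∀ {j} → A′ j → A j) →
            Live (row T x , C) → Live (row T (mate x) , C) →
            (∀ y → A′ (proj₁ y) → T y ≢ (row T x , C)) →
            (∀ y → A′ (proj₁ y) → T y ≢ (row T (mate x) , C)) →
            Linkage A′ (λ z → Live z × (proj₁ z ≢ row T x × proj₁ z ≢ row T (mate x)))
              (clear-rows T (row T x) R (row T (mate x)) R′) →
            Linkage A Live T
link-rows T x R R′ C A⊆ A′∌ T-inj T-live x-act A′⊆ live₁ live₂ free₁ free₂ =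
  extend (clear-rows T a R c R′) x A⊆ (T x ∷ (a , C) ∷ (c , C) ∷ T (mate x) ∷ [])
    (step (here ≡.refl) (inj₁ ≡.refl) (step (there (here ≡.refl)) (inj₂ ≡.refl)
      (step (there (there (here ≡.refl))) (inj₁ ≡.refl) (stop (there (there (there (here ≡.refl))))))))
    ((T-live x x-act , λ l → proj₁ (proj₂ l) ≡.refl) ∷ (live₁ , λ l → proj₁ (proj₂ l) ≡.refl) ∷
     (live₂ , λ l → proj₂ (proj₂ l) ≡.refl) ∷ (T-live (mate x) x-act , λ l → proj₂ (proj₂ l) ≡.refl) ∷ [])
    (λ y y∈ → (λ e → A′∌ _ y∈ (≡.cong proj₁ (T-inj _ _ e))) ∷ free₁ y y∈ ∷ free₂ y y∈ ∷
              (λ e → A′∌ _ y∈ (≡.cong proj₁ (T-inj _ _ e))) ∷ [])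
    proj₁
    (λ y y∈ → T-live y (A′⊆ y∈) , inj₂ ≡.refl , λ l → ≡.cong (_, col T y) (same y (proj₂ l)))
    (λ y z _ _ → T-inj y z)
  where
  a = row T x
  c = row T (mate x)
  same : ∀ y → row T y ≢ a × row T y ≢ c → replace₂ a R c R′ (row T y) ≡ row T y
  same y (r≢a , r≢c) with replaced a R c R′ (row T y)
  ... | first p _   = ⊥-elim (r≢a p)
  ... | second p _  = ⊥-elim (r≢c p)
  ... | other _ _ e = e

remove₂ : ∀ {n} (i i′ : Fin n) j → j ≢ i → j ≡ i′ ⊎ (j ≢ i × j ≢ i′)
remove₂ i i′ j j≢i with j ≟ i′
... | yes e = inj₁ e
... | no ¬e = inj₂ (j≢i , ¬e)

-- With two empty rows and two empty columns, the pair of u uses up two columns and the pair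
-- of x two rows.
link-via-two-columns :
  ∀ {k p q} → Linkable k p q →
  (T : Term (suc (suc k)) → Cell (suc (suc p)) (suc (suc q))) → Injective _≡_ _≡_ T →
  ∀ {R R′ C C′} → (∀ y → row T y ≢ R) → (∀ y → row T y ≢ R′) → R ≢ R′ →
  (∀ y → col T y ≢ C) → (∀ y → col T y ≢ C′) → C ≢ C′ →
  (x u : Term (suc (suc k))) → proj₁ u ≢ proj₁ x → T u ≡ (row T x , col T (mate x)) →
  col T u ≢ col T (mate u) → Linkage (λ _ → ⊤) All-cells T
link-via-two-columns linked T T-inj {R} {R′} {C} {C′} R∅ R′∅ R≢R′ C∅ C′∅ C≢C′ x u u≢x u-corner e≢e′ =
  transpose {Live = All-cells} (link-rows {A = λ _ → ⊤} {A′ = _≢ proj₁ u} {Live = All-cells} (swap ∘ T) u C C′ R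
    (remove (proj₁ u)) (λ _ j≢ → j≢) (λ _ _ → T-inj ∘ ≡.cong swap) (λ _ _ → tt) tt (λ _ → tt) tt tt
    (λ y _ eq → R∅ y (≡.cong proj₂ eq)) (λ y _ eq → R∅ y (≡.cong proj₂ eq))
    (transpose {Live = Live₁ ∘ swap} {T = swap ∘ T₁} (link-rows {A = _≢ proj₁ u} {A′ = λ j → j ≢ proj₁ u × j ≢ proj₁ x} {Live = Live₁} T₁ x R R′ C
      (remove₂ (proj₁ u) (proj₁ x)) (λ _ → proj₂)
      (λ y z eq → T₁-inj eq) (λ y _ → tt , cols y) (u≢x ∘ ≡.sym) proj₁
      (tt , C∅ _ ∘ ≡.sym , C∅ _ ∘ ≡.sym) (tt , C∅ _ ∘ ≡.sym , C∅ _ ∘ ≡.sym)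
      -- After the first evacuation the crossing cells in column `C` are the places of `u`, whose
      -- pair is already linked, and of `mate x`. So no terminal still to be linked is in the way.
      (λ y act eq → proj₁ act (≡.cong proj₁ (T₁-inj (≡.trans eq (≡.sym T₁u)))))
      (λ y act eq → proj₂ act (≡.cong proj₁ (T₁-inj {z = mate x} (≡.trans eq (≡.sym T₁mate)))))
      (weaken (λ { (rows , cols) → (tt , cols) , rows })
        (restrict (skip₂ (proj₁ u) (proj₁ x) u≢x) (skip₂ (row T x) (row T (mate x)) a≢c) (skip₂ e e′ e≢e′) linked T₂
          (λ y _ → replace₂-≢ (row T y) (R∅ _ ∘ ≡.sym , R∅ _ ∘ ≡.sym) (R′∅ _ ∘ ≡.sym , R′∅ _ ∘ ≡.sym) , cols y)
          (λ y z _ _ eq → T₁-inj (≡.cong₂ _,_ (replace₂-inj (R∅ y) (R′∅ y) (R∅ z) (R′∅ z) (λ R≡ → ⊥-elim (R≢R′ R≡)) (λ R≡ → ⊥-elim (R≢R′ R≡)) (≡.cong proj₁ eq)) (≡.cong proj₂ eq))))))))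
  where
  e  = col T u
  e′ = col T (mate u)
  Live₁ : Cell _ _ → Set
  Live₁ z = ⊤ × (proj₂ z ≢ e × proj₂ z ≢ e′)
  T₁ T₂ : Term _ → Cell _ _
  T₁ y = row T y , replace₂ e C e′ C′ (col T y)
  T₂ = clear-rows T₁ (row T x) R (row T (mate x)) R′
  T₁-inj : ∀ {y z} → T₁ y ≡ T₁ z → y ≡ z
  T₁-inj {y} {z} eq = T-inj (≡.cong₂ _,_ (≡.cong proj₁ eq)
    (replace₂-inj (C∅ y) (C′∅ y) (C∅ z) (C′∅ z) (λ C≡ → ⊥-elim (C≢C′ C≡)) (λ C≡ → ⊥-elim (C≢C′ C≡)) (≡.cong proj₂ eq)))
  T₁u : T₁ u ≡ (row T x , C)
  T₁u = ≡.cong₂ _,_ (≡.cong proj₁ u-corner) (replace₂-first e C e′ C′)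
  T₁mate : T₁ (mate x) ≡ (row T (mate x) , C)
  T₁mate = ≡.cong (row T (mate x) ,_)
    (≡.trans (≡.cong (replace₂ e C e′ C′) (≡.sym (≡.cong proj₂ u-corner))) (replace₂-first e C e′ C′))
  cols : ∀ y → col T₁ y ≢ e × col T₁ y ≢ e′
  cols y = replace₂-≢ (col T y) (C∅ _ ∘ ≡.sym , C∅ _ ∘ ≡.sym) (C′∅ _ ∘ ≡.sym , C′∅ _ ∘ ≡.sym)
  a≢c : row T x ≢ row T (mate x)
  a≢c a≡c = u≢x (≡.cong proj₁ (T-inj (≡.trans u-corner (≡.cong (_, col T (mate x)) a≡c))))

-- The pair of x uses up two rows. This leaves v alone in its column, so that the pair of v is
-- linked through the corner in that column.
link-via-column :
  ∀ {k p q} → Linkable k p q →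
  (T : Term (suc (suc k)) → Cell (suc (suc p)) (suc (suc q))) → Injective _≡_ _≡_ T →
  ∀ {R R′ C} → (∀ y → row T y ≢ R) → (∀ y → row T y ≢ R′) → (∀ y → col T y ≢ C) →
  (x v : Term (suc (suc k))) → proj₁ v ≢ proj₁ x → T v ≡ (row T (mate x) , col T x) →
  (∀ y → col T y ≡ col T x → y ≡ x ⊎ y ≡ v) →
  (R ≡ R′ → ∀ y z → proj₁ y ≢ proj₁ x → proj₁ z ≢ proj₁ x →
    row T y ≡ row T x → row T z ≡ row T (mate x) → col T y ≢ col T z) →
  Linkage (λ _ → ⊤) All-cells T
link-via-column linked T T-inj {R} {R′} {C} R∅ R′∅ C∅ x v v≢x v-corner only spread =
  link-rows {A = λ _ → ⊤} {A′ = _≢ proj₁ x} {Live = All-cells} T x R R′ C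
    (remove (proj₁ x)) (λ _ j≢ → j≢) (λ _ _ → T-inj) (λ _ _ → tt) tt (λ _ → tt) tt tt
    (λ y _ eq → C∅ y (≡.cong proj₂ eq)) (λ y _ eq → C∅ y (≡.cong proj₂ eq))
    -- Clearing the rows keeps `v` in column `b`, now without other active terminals, and its path
    -- turns in the row of `mate v`. Column `C` can still receive the terminals of column `e`: the
    -- pair of `x` used only its cells in the two deleted rows.
    (extend {A = _≢ proj₁ x} {A′ = λ j → j ≢ proj₁ x × j ≢ proj₁ v} {Live′ = λ z → (proj₁ z ≢ a × proj₁ z ≢ c) × (proj₂ z ≢ b × proj₂ z ≢ e)}
      T₂ v (remove₂ (proj₁ x) (proj₁ v)) (T₁ v ∷ (row T₁ (mate v) , b) ∷ T₁ (mate v) ∷ [])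
      (step (here ≡.refl) (inj₂ (≡.cong proj₂ v-corner)) (step (there (here ≡.refl)) (inj₁ ≡.refl) (stop (there (there (here ≡.refl))))))
      (((tt , rows v) , λ l → proj₁ (proj₂ l) (≡.cong proj₂ v-corner)) ∷ ((tt , rows (mate v)) , λ l → proj₁ (proj₂ l) ≡.refl) ∷
       ((tt , rows (mate v)) , λ l → proj₂ (proj₂ l) ≡.refl) ∷ [])
      (λ y act → (λ eq → proj₂ act (≡.cong proj₁ (T₁-inj y v (proj₁ act) v≢x eq))) ∷ (λ eq → not-b y act (≡.cong proj₂ eq)) ∷
                 (λ eq → proj₂ act (≡.cong proj₁ (T₁-inj y (mate v) (proj₁ act) v≢x eq))) ∷ [])
      (λ l → tt , proj₁ l)
      (λ y act → (tt , rows y) , inj₁ ≡.refl , λ l → ≡.cong (row T₁ y ,_) (stays y (proj₂ (proj₂ l))))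
      (λ y z act act′ → T₁-inj y z (proj₁ act) (proj₁ act′))
      (restrict (skip₂ (proj₁ x) (proj₁ v) (v≢x ∘ ≡.sym)) (skip₂ a c a≢c) (skip₂ b e b≢e) linked T₂
        (λ y act → rows y , live-b y act , replace-≢ (col T y) (C∅ (mate v) ∘ ≡.sym))
        (λ y z act act′ eq → T₁-inj y z (proj₁ act) (proj₁ act′)
          (≡.cong₂ _,_ (≡.cong proj₁ eq) (replace-inj (C∅ y) (C∅ z) (≡.cong proj₂ eq))))))
  where
  a = row T x
  c = row T (mate x)
  b = col T x
  e = col T (mate v)
  T₁ T₂ : Term _ → Cell _ _
  T₁ = clear-rows T a R c R′
  T₂ y = row T₁ y , replace e C (col T y)
  rows : ∀ y → row T₁ y ≢ a × row T₁ y ≢ c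
  rows y = replace₂-≢ (row T y) (R∅ _ ∘ ≡.sym , R∅ _ ∘ ≡.sym) (R′∅ _ ∘ ≡.sym , R′∅ _ ∘ ≡.sym)
  T₁-inj : ∀ y z → proj₁ y ≢ proj₁ x → proj₁ z ≢ proj₁ x → T₁ y ≡ T₁ z → y ≡ z
  T₁-inj y z y≢x z≢x eq = T-inj (≡.cong₂ _,_
    (replace₂-inj (R∅ y) (R′∅ y) (R∅ z) (R′∅ z)
      (λ R≡ y∈ z∈ → spread R≡ y z y≢x z≢x y∈ z∈ (≡.cong proj₂ eq))
      (λ R≡ z∈ y∈ → spread R≡ z y z≢x y≢x z∈ y∈ (≡.sym (≡.cong proj₂ eq)))
      (≡.cong proj₁ eq))
    (≡.cong proj₂ eq))
  a≢c : a ≢ c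
  a≢c a≡c = v≢x (≡.cong proj₁ (T-inj (≡.trans v-corner (≡.cong (_, b) (≡.sym a≡c)))))
  not-b : ∀ y → proj₁ y ≢ proj₁ x × proj₁ y ≢ proj₁ v → col T y ≢ b
  not-b y (y≢x , y≢v) y∈ with only y y∈
  ... | inj₁ y≡x = y≢x (≡.cong proj₁ y≡x)
  ... | inj₂ y≡v = y≢v (≡.cong proj₁ y≡v)
  b≢e : b ≢ e
  b≢e b≡e with only (mate v) (≡.sym b≡e)
  ... | inj₁ m≡x = v≢x (≡.cong proj₁ m≡x)
  ... | inj₂ m≡v = mate≢ v m≡v
  live-b : ∀ y → proj₁ y ≢ proj₁ x × proj₁ y ≢ proj₁ v → replace e C (col T y) ≢ b
  live-b y act with replace-cases e C (col T y)
  ... | inj₁ (_ , eq) = λ eq′ → C∅ x (≡.trans (≡.sym eq′) eq)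
  ... | inj₂ (_ , eq) = λ eq′ → not-b y act (≡.trans (≡.sym eq) eq′)
  stays : ∀ y → col T y ≢ e → replace e C (col T y) ≡ col T y
  stays y c≢e with replace-cases e C (col T y)
  ... | inj₁ (p , _)  = ⊥-elim (c≢e p)
  ... | inj₂ (_ , eq) = eq

-- Case distinction for the induction step

Full-column : ∀ {k p q} → (Term k → Cell p q) → Fin q → Set
Full-column T c = ∀ r → ∃ λ y → T y ≡ (r , c)

full-or-free : ∀ {k p q} (T : Term k → Cell p q) c → Full-column T c ⊎ ∃ λ r → ∀ y → T y ≢ (r , c)
full-or-free T c = Sum.swap (finChoice λ r → Sum.swap (termAny? λ y → ≡-dec _≟_ _≟_ (T y) (r , c)))

-- A full row and a full column would hold more than 2k terminals.
no-cross : ∀ {k p q} (T : Term k → Cell p q) → k ℕ.< p → k ℕ.< q →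
           ∀ {a c} → Full-column T c → Full-column (swap ∘ T) a → ⊥
no-cross {k} {suc p} {q} T k<p k<q {a} {c} full-c full-a =
  ℕ.<⇒≱ (ℕ.+-mono-<-≤ k<q (ℕ.≤-pred k<p)) (≡.subst (q ℕ.+ p ℕ.≤_) (≡.trans (ℕ.*-comm k 2) (≡.cong (k ℕ.+_) (ℕ.+-identityʳ k))) bound)
  where
  -- The row contributes all its `q` cells, the column all but the shared one, which `punchIn a`
  -- leaves out.
  f : Fin q ⊎ Fin p → Term k
  f (inj₁ s) = proj₁ (full-a s)
  f (inj₂ r) = proj₁ (full-c (punchIn a r))
  cell : Fin q ⊎ Fin p → Cell (suc p) q
  cell (inj₁ s) = a , s
  cell (inj₂ r) = punchIn a r , c
  cell-inj : ∀ {u v} → cell u ≡ cell v → u ≡ v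
  cell-inj {inj₁ _} {inj₁ _} ≡.refl = ≡.refl
  cell-inj {inj₂ _} {inj₂ _} e    = ≡.cong inj₂ (Fin.punchIn-injective a _ _ (≡.cong proj₁ e))
  cell-inj {inj₁ _} {inj₂ r} e    = ⊥-elim (Fin.punchInᵢ≢i a r (≡.sym (≡.cong proj₁ e)))
  cell-inj {inj₂ r} {inj₁ _} e    = ⊥-elim (Fin.punchInᵢ≢i a r (≡.cong proj₁ e))
  T-f : ∀ u → T (f u) ≡ cell u
  T-f (inj₁ s) = ≡.cong swap (proj₂ (full-a s))
  T-f (inj₂ r) = proj₂ (full-c (punchIn a r))
  bound : q ℕ.+ p ℕ.≤ k ℕ.* 2
  bound = term-bound (f ∘ splitAt q) λ {i} {j} e →
    ≡.trans (≡.sym (Fin.join-splitAt q p i))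
      (≡.trans (≡.cong (Fin.join q p) (cell-inj (≡.trans (≡.sym (T-f (splitAt q i))) (≡.trans (≡.cong T e) (T-f (splitAt q j))))))
        (Fin.join-splitAt q p j))

module _ {k q} (line : Term k → Fin q) (k<q : k ℕ.< q) (kinds : ∀ c → Lines.Empty line c ⊎ Lines.Two line c) where
  open Lines line

  some-empty : ∃ Empty
  some-empty with finChoice kinds
  ... | inj₁ C   = C
  ... | inj₂ two = ⊥-elim (not-all-two k<q two)

  not-all-occupied : (∀ c → ∃ λ y → line y ≡ c) → ⊥
  not-all-occupied occupied = let C , C∅ = some-empty ; y , y∈ = occupied C in C∅ y y∈

  -- The second alternative is the hypothesis of `exactly-two`.
  second-empty : ∀ C → (∃ λ C′ → C′ ≢ C × Empty C′) ⊎ (∀ c → c ≢ C → Two c)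
  second-empty C = finChoice decide
    where
    decide : ∀ c → (c ≢ C × Empty c) ⊎ (c ≢ C → Two c)
    decide c with c ≟ C | kinds c
    ... | yes c≡C | _        = inj₂ λ c≢C → ⊥-elim (c≢C c≡C)
    ... | no c≢C  | inj₁ c∅  = inj₁ (c≢C , c∅)
    ... | no _    | inj₂ two = inj₂ λ _ → two

IH : ℕ → Set₁
IH k = ∀ {k′} → k′ ℕ.< k → ∀ {p q} → k′ ℕ.< p → k′ ℕ.< q → Linkable k′ p q

-- By counting, the column of `x` holds `x` and `v` only, as `link-via-column` requires. If `R` is
-- the only empty row, both rows of the pair are cleared into it: counting in the rows then shows
-- that at most `u` and `v` move, and these are in different columns.
crowded-columns :
  ∀ {k p q} → Linkable k p q → suc k ℕ.< suc p → suc k ℕ.< suc q →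
  (T : Term (suc (suc k)) → Cell (suc (suc p)) (suc (suc q))) → Injective _≡_ _≡_ T →
  ∀ {R C} → (∀ y → row T y ≢ R) → (∀ y → col T y ≢ C) →
  (∃ λ R′ → R′ ≢ R × (∀ y → row T y ≢ R′)) ⊎ (∀ r → r ≢ R → Lines.Two (row T) r) →
  (∀ c → c ≢ C → Lines.Two (col T) c) →
  (x u v : Term (suc (suc k))) → proj₁ u ≢ proj₁ x → proj₁ v ≢ proj₁ x →
  T u ≡ (row T x , col T (mate x)) → T v ≡ (row T (mate x) , col T x) →
  Linkage (λ _ → ⊤) All-cells T
crowded-columns linked k<p k<q T T-inj {R} {C} R∅ C∅ rows cols x u v u≢x v≢x u-corner v-corner = go rows
  where
  only : ∀ y → col T y ≡ col T x → y ≡ x ⊎ y ≡ v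
  only y y∈ = exactly-two (col T) (ℕ.s≤s k<q) cols (C∅ x) ≡.refl (≡.cong proj₂ v-corner) y∈ (v≢x ∘ ≡.cong proj₁ ∘ ≡.sym)
  go : (∃ λ R′ → R′ ≢ R × (∀ y → row T y ≢ R′)) ⊎ (∀ r → r ≢ R → Lines.Two (row T) r) → Linkage (λ _ → ⊤) All-cells T
  go (inj₁ (R′ , R′≢R , R′∅)) =
    link-via-column linked T T-inj R∅ R′∅ C∅ x v v≢x v-corner only (λ R≡R′ → ⊥-elim (R′≢R (≡.sym R≡R′)))
  go (inj₂ two) = link-via-column linked T T-inj R∅ R∅ C∅ x v v≢x v-corner only spread
    where
    only-u : ∀ y → proj₁ y ≢ proj₁ x → row T y ≡ row T x → y ≡ u
    only-u y y≢x y∈ with exactly-two (row T) (ℕ.s≤s k<p) two (R∅ x) ≡.refl (≡.cong proj₁ u-corner) y∈ (u≢x ∘ ≡.cong proj₁ ∘ ≡.sym)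
    ... | inj₁ y≡x = ⊥-elim (y≢x (≡.cong proj₁ y≡x))
    ... | inj₂ y≡u = y≡u
    only-v : ∀ y → proj₁ y ≢ proj₁ x → row T y ≡ row T (mate x) → y ≡ v
    only-v y y≢x y∈ with exactly-two (row T) (ℕ.s≤s k<p) two (R∅ (mate x)) ≡.refl (≡.cong proj₁ v-corner) y∈ (v≢x ∘ ≡.cong proj₁ ∘ ≡.sym)
    ... | inj₁ y≡x = ⊥-elim (y≢x (≡.cong proj₁ y≡x))
    ... | inj₂ y≡v = y≡v
    spread : R ≡ R → ∀ y z → proj₁ y ≢ proj₁ x → proj₁ z ≢ proj₁ x →
             row T y ≡ row T x → row T z ≡ row T (mate x) → col T y ≢ col T z
    -- If `u` and `v` shared a column, so would `x` and `mate x`, and `u` would be on the cell of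
    -- `x`.
    spread _ y z y≢x z≢x y∈ z∈ e with ≡.refl ← only-u y y≢x y∈ | ≡.refl ← only-v z z≢x z∈ =
      u≢x (≡.cong proj₁ (T-inj {_} {x} (≡.trans u-corner (≡.cong (row T x ,_) (≡.trans (≡.sym (≡.cong proj₂ u-corner)) (≡.trans e (≡.cong proj₂ v-corner)))))))

-- Empty lines exist here and can take displaced terminals, so a pair with an unobstructed corner is
-- linked at once. If every corner is taken by another pair, the terminals `u` and `v` on the two
-- corners of one pair determine a second pair to be linked simultaneously.
no-single-line :
  ∀ {k p q} → IH (suc k) → suc k ℕ.< p → suc k ℕ.< q →
  (T : Term (suc k) → Cell p q) → Injective _≡_ _≡_ T →
  (∀ c → Lines.Empty (col T) c ⊎ Lines.Two (col T) c) →
  (∀ r → Lines.Empty (row T) r ⊎ Lines.Two (row T) r) →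
  Linkage (λ _ → ⊤) All-cells T
no-single-line {k} {suc p} {suc q} ih k<p k<q T T-inj col-kinds row-kinds
  with some-empty (row T) k<p row-kinds | some-empty (col T) k<q col-kinds
... | R , R∅ | C , C∅ = go (termChoice corner)
  where
  corner : ∀ x → (∀ y → proj₁ y ≢ proj₁ x → T y ≢ (row T x , col T (mate x))) ⊎
                 (∃ λ u → proj₁ u ≢ proj₁ x × T u ≡ (row T x , col T (mate x)))
  corner x with termAny? (λ u → ¬? (proj₁ u ≟ proj₁ x) ×-dec ≡-dec _≟_ _≟_ (T u) (row T x , col T (mate x)))
  ... | inj₁ u    = inj₂ u
  ... | inj₂ none = inj₁ λ y y≢x e → none y (y≢x , e)

  crowded : ∀ {k p q} → IH (suc k) → suc k ℕ.< suc p → suc k ℕ.< suc q →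
            (T : Term (suc k) → Cell (suc p) (suc q)) → Injective _≡_ _≡_ T →
            ∀ {R C} → (∀ y → row T y ≢ R) → (∀ y → col T y ≢ C) →
            (∃ λ R′ → R′ ≢ R × (∀ y → row T y ≢ R′)) ⊎ (∀ r → r ≢ R → Lines.Two (row T) r) →
            (∃ λ C′ → C′ ≢ C × (∀ y → col T y ≢ C′)) ⊎ (∀ c → c ≢ C → Lines.Two (col T) c) →
            (∀ x → ∃ λ u → proj₁ u ≢ proj₁ x × T u ≡ (row T x , col T (mate x))) →
            Linkage (λ _ → ⊤) All-cells T
  -- With a single pair, no other pair can occupy its corners.
  crowded {zero} ih k<p k<q T T-inj R∅ C∅ rows cols corners with corners (zero , false)
  ... | (zero , _) , 0≢0 , _ = ⊥-elim (0≢0 ≡.refl)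
  crowded {suc k} {zero}  ih (ℕ.s≤s ()) _
  crowded {suc k} {suc p} {zero}  ih _ (ℕ.s≤s ())
  crowded {suc k} {suc p} {suc q} ih k<p k<q T T-inj R∅ C∅ rows cols corners = two-cases rows cols
    where
    x y : Term (suc (suc k))
    x = zero , false
    y = zero , true
    u = corners x
    v = corners y
    smaller : ∀ {p q} → suc (suc k) ℕ.< suc (suc p) → suc (suc k) ℕ.< suc (suc q) → Linkable k p q
    smaller (ℕ.s≤s (ℕ.s≤s k<p)) (ℕ.s≤s (ℕ.s≤s k<q)) = ih (ℕ.s≤s (ℕ.n≤1+n k)) k<p k<q
    two-cases : (∃ λ R′ → R′ ≢ _ × (∀ y → row T y ≢ R′)) ⊎ (∀ r → r ≢ _ → Lines.Two (row T) r) →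
                (∃ λ C′ → C′ ≢ _ × (∀ y → col T y ≢ C′)) ⊎ (∀ c → c ≢ _ → Lines.Two (col T) c) →
                Linkage (λ _ → ⊤) All-cells T
    two-cases (inj₁ (R′ , R′≢R , R′∅)) (inj₁ (C′ , C′≢C , C′∅)) =
      link-via-two-columns (smaller k<p k<q) T T-inj R∅ R′∅ (R′≢R ∘ ≡.sym) C∅ C′∅ (C′≢C ∘ ≡.sym)
        x (proj₁ u) (proj₁ (proj₂ u)) (proj₂ (proj₂ u)) distinct
      where
      distinct : col T (proj₁ u) ≢ col T (mate (proj₁ u))
      -- Otherwise `u` would be on its own corner, but that cell belongs to a terminal of another
      -- pair.
      distinct e = let w , w≢u , w-corner = corners (proj₁ u) in
        w≢u (≡.cong proj₁ (T-inj (≡.trans w-corner (≡.cong (row T (proj₁ u) ,_) (≡.sym e)))))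
    two-cases rows (inj₂ cols) =
      crowded-columns (smaller k<p k<q) (ℕ.≤-pred k<p) (ℕ.≤-pred k<q) T T-inj R∅ C∅ rows cols
        x (proj₁ u) (proj₁ v) (proj₁ (proj₂ u)) (proj₁ (proj₂ v)) (proj₂ (proj₂ u)) (proj₂ (proj₂ v))
    two-cases (inj₂ rows) cols =
      -- Transposition exchanges the two corners of the pair, hence `u` and `v`.
      transpose (crowded-columns (smaller k<q k<p) (ℕ.≤-pred k<q) (ℕ.≤-pred k<p) (swap ∘ T) (T-inj ∘ ≡.cong swap) C∅ R∅ cols rows
        x (proj₁ v) (proj₁ u) (proj₁ (proj₂ v)) (proj₁ (proj₂ u)) (≡.cong swap (proj₂ (proj₂ v))) (≡.cong swap (proj₂ (proj₂ u))))

  go : _ → Linkage (λ _ → ⊤) All-cells T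
  go (inj₁ (x , free)) = link-corner (ih (ℕ.n<1+n k) (ℕ.≤-pred k<p) (ℕ.≤-pred k<q)) T T-inj R∅ C∅ x free
  go (inj₂ corners) = crowded ih k<p k<q T T-inj R∅ C∅
    (second-empty (row T) k<p row-kinds R) (second-empty (col T) k<q col-kinds C) corners

-- A terminal alone in its column helps only while every column has a free cell. A full column meets
-- every row, so by counting some row has exactly one terminal, and by `no-cross` no row is full:
-- the transposed construction applies. A full row is treated likewise.
link-step : ∀ {k p q} → IH k → k ℕ.< p → k ℕ.< q → Linkable k p q
link-step {zero} _ _ _ _ _ = record
  { part = λ _ _ → ⊥ ; live = λ { {()} } ; walk = λ { {()} } ; disjoint = λ { {()} } }
link-step {suc k} {suc p} {suc q} ih k<p k<q T T-inj
  with finChoice (Lines.classify (col T)) | finChoice (Lines.classify (row T))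
     | finChoice (full-or-free T) | finChoice (full-or-free (swap ∘ T))
... | inj₂ cols | inj₂ rows | _ | _ = no-single-line ih k<p k<q T T-inj cols rows
... | inj₁ (_ , w , ≡.refl , only) | _ | inj₂ free | _ =
  link-single (ih (ℕ.n<1+n k) (ℕ.≤-pred k<p) (ℕ.≤-pred k<q)) T T-inj w only free
... | _ | inj₁ (_ , w , ≡.refl , only) | _ | inj₂ free =
  transpose (link-single (ih (ℕ.n<1+n k) (ℕ.≤-pred k<q) (ℕ.≤-pred k<p)) (swap ∘ T) (T-inj ∘ ≡.cong swap) w only free)
... | _ | inj₂ rows | inj₁ (_ , full) | _ =
  ⊥-elim (not-all-occupied (row T) k<p rows λ r → let y , e = full r in y , ≡.cong proj₁ e)
... | inj₂ cols | _ | _ | inj₁ (_ , full) =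
  ⊥-elim (not-all-occupied (col T) k<q cols λ c → let y , e = full c in y , ≡.cong proj₁ e)
... | _ | _ | inj₁ (_ , full) | inj₁ (_ , full′) = ⊥-elim (no-cross T k<p k<q full full′)

-- Well-founded induction, since some cases link two pairs at once.
rook-linked : ∀ k {p q} → k ℕ.< p → k ℕ.< q → Linkable k p q
rook-linked = <-rec (λ k → ∀ {p q} → k ℕ.< p → k ℕ.< q → Linkable k p q) λ _ ih → link-step ih

enumerate : ∀ {ℓ n} {P : Fin n → Set ℓ} → (∀ i → Dec (P i)) → ∃ λ m → Embed m n P
enumerate {n = zero}  P? = zero , record { f = λ () ; inj = λ { {()} } ; into = λ () ; onto = λ () }
enumerate {n = suc n} {P} P? with P? zero | enumerate (P? ∘ suc)
... | no ¬p | m , E = m , record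
  { f = suc ∘ E.f ; inj = E.inj ∘ Fin.suc-injective ; into = E.into
  ; onto = λ { zero p → ⊥-elim (¬p p) ; (suc j) p → let i , e = E.onto j p in i , ≡.cong suc e } }
  where module E = Embed E
... | yes p | m , E = suc m , record
  { f = f ; inj = inj ; into = λ { zero → p ; (suc i) → E.into i }
  ; onto = λ { zero p → zero , ≡.refl ; (suc j) p → let i , e = E.onto j p in suc i , ≡.cong suc e } }
  where
  module E = Embed E
  f : Fin (suc m) → Fin (suc n)
  f zero    = zero
  f (suc i) = suc (E.f i)
  inj : ∀ {i j} → f i ≡ f j → i ≡ j
  inj {zero}  {zero}  _ = ≡.refl
  inj {suc i} {suc j} e = ≡.cong suc (E.inj (Fin.suc-injective e))

-- Paths

-- A walk without repetitions. The list omits the start, so the list of all its cells is visibly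
-- nonempty.
data Track {p q} (D : Cell p q → Set) : Cell p q → Cell p q → List (Cell p q) → Set where
  stop : ∀ {x} → D x → Track D x x []
  step : ∀ {x y z ys} → D x → x ∼ y → All (x ≢_) (y ∷ ys) → Track D y z ys → Track D x z (y ∷ ys)

module _ {p q} {D : Cell p q → Set} where

  cut : ∀ {x y z ys} → Track D y z ys → x ∈ˡ y ∷ ys → ∃ (Track D x z)
  cut τ              (here ≡.refl) = _ , τ
  cut (step _ _ _ τ) (there x∈)    = cut τ x∈

  erase-loops : ∀ {x z} → Walk D x z → ∃ (Track D x z)
  erase-loops (stop x∈) = [] , stop x∈
  erase-loops {x} (step {y = y} x∈ e w) with erase-loops w
  ... | ys , τ with DecMembership._∈?_ (≡-dec _≟_ _≟_) x (y ∷ ys)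
  -- The walk returns to `x`; only what follows this return is kept.
  ...   | yes x∈ys = cut τ x∈ys
  ...   | no x∉ys  = y ∷ ys , step x∈ e (All.¬Any⇒All¬ (y ∷ ys) x∉ys) τ

module _ {v e q′} (G : Graph v e q′) {p q} (φ : Cell p q → Graph.Vertex G)
         (φ-adjacent : ∀ {x y} → x ∼ y → x ≢ y → Graph._~_ G (φ x) (φ y))
         (φ-injective : ∀ {x y} → Graph._≈_ G (φ x) (φ y) → x ≡ y) where
  open Graph G
  open SetoidMembership vertexSetoid using () renaming (_∈_ to _∈ᴳ_)

  track-last : ∀ {D x z ys} → Track D x z ys → last (map φ (x ∷ ys)) ≡ just (φ z)
  track-last (stop _)       = ≡.refl
  track-last (step _ _ _ τ) = track-last τ

  track-adjacent : ∀ {D x z ys} → Track D x z ys → Linked _~_ (map φ (x ∷ ys))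
  track-adjacent (stop _)                = [-]
  track-adjacent (step _ e (x≢y ∷ _) τ)  = φ-adjacent e x≢y ∷ track-adjacent τ

  track-simple : ∀ {D x z ys} → Track D x z ys → UniqueSetoid.Unique vertexSetoid (map φ (x ∷ ys))
  track-simple (stop _)          = [] ∷ []
  track-simple (step _ _ x∉ys τ) = All.map⁺ (All.map (λ x≢y φx≈φy → x≢y (φ-injective φx≈φy)) x∉ys) ∷ track-simple τ

  track-support : ∀ {D x z ys} → Track D x z ys → ∀ {u} → u ∈ᴳ map φ (x ∷ ys) → ∃ λ y → D y × u ≈ φ y
  track-support (stop x∈)       (here u≈)  = _ , x∈ , u≈
  track-support (step x∈ _ _ _) (here u≈)  = _ , x∈ , u≈
  track-support (step _ _ _ τ)  (there u∈) = track-support τ u∈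

  link-vertices : ∀ {k} {T : Term k → Cell p q} → Linkage (λ _ → ⊤) All-cells T →
                  (s t : Fin k → Vertex) → (∀ i → φ (T (i , false)) ≡ s i) → (∀ i → φ (T (i , true)) ≡ t i) →
                  ∃ λ (L : ∀ i → Path G (s i) (t i)) →
                    ∀ i j → i ≢ j → DisjointSetoid.Disjoint vertexSetoid (Path.vertices (L i)) (Path.vertices (L j))
  link-vertices {k} {T} ℓ s t φs φt = path , disjoint
    where
    module ℓ = Linkage ℓ
    track : ∀ i → ∃ (Track (ℓ.part i) (T (i , false)) (T (i , true)))
    track i = erase-loops (ℓ.walk tt)
    path : ∀ i → Path G (s i) (t i)
    path i = record
      { vertices = map φ (T (i , false) ∷ proj₁ (track i))
      ; starts   = ≡.cong just (φs i)
      ; ends     = ≡.trans (track-last (proj₂ (track i))) (≡.cong just (φt i))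
      ; adjacent = track-adjacent (proj₂ (track i))
      ; simple   = track-simple (proj₂ (track i))
      }
    disjoint : ∀ i j → i ≢ j → DisjointSetoid.Disjoint vertexSetoid (Path.vertices (path i)) (Path.vertices (path j))
    disjoint i j i≢j (u∈i , u∈j) with track-support (proj₂ (track i)) u∈i | track-support (proj₂ (track j)) u∈j
    ... | x , x∈ , u≈φx | y , y∈ , u≈φy with φ-injective (Setoid.trans vertexSetoid (Setoid.sym vertexSetoid u≈φx) u≈φy)
    ...   | ≡.refl = ℓ.disjoint tt tt i≢j x∈ y∈

module _ {v e q′} (G : Graph v e q′) {p q} (vertex-at : Cell p q → Graph.Vertex G)
         (adjacent : ∀ {x y} → x ∼ y → x ≢ y → Graph._~_ G (vertex-at x) (vertex-at y))
         (injective : ∀ {x y} → Graph._≈_ G (vertex-at x) (vertex-at y) → x ≡ y)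
         (cell-of : ∀ u → ∃ λ x → Graph._≈_ G u (vertex-at x)) where
  open Graph G
  open Setoid vertexSetoid using (sym; trans; reflexive)

  module _ {k} (s t : Fin k → Vertex) (s-inj : Injective _≡_ _≈_ s) (t-inj : Injective _≡_ _≈_ t)
           (s≉t : ∀ i j → ¬ s i ≈ t j) where

    given : Term k → Vertex
    given (i , false) = s i
    given (i , true)  = t i

    given-injective : ∀ {x y} → given x ≈ given y → x ≡ y
    given-injective {i , false} {j , false} e = ≡.cong (_, false) (s-inj e)
    given-injective {i , true}  {j , true}  e = ≡.cong (_, true) (t-inj e)
    given-injective {i , false} {j , true}  e = ⊥-elim (s≉t i j e)
    given-injective {i , true}  {j , false} e = ⊥-elim (s≉t j i (sym e))

    terminal : Term k → Cell p q
    terminal x = proj₁ (cell-of (given x))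

    terminal-injective : Injective _≡_ _≡_ terminal
    terminal-injective {x} {y} e = given-injective {x} {y} (trans (proj₂ (cell-of (given x)))
      (trans (reflexive (≡.cong vertex-at e)) (sym (proj₂ (cell-of (given y))))))

    -- The paths have to start and end at the given vertices themselves, and not merely at
    -- equal vertices of the setoid.
    represent : Cell p q → Vertex
    represent x with termAny? (λ z → ≡-dec _≟_ _≟_ (terminal z) x)
    ... | inj₁ (z , _) = given z
    ... | inj₂ _       = vertex-at x

    represent≈ : ∀ x → represent x ≈ vertex-at x
    represent≈ x with termAny? (λ z → ≡-dec _≟_ _≟_ (terminal z) x)
    ... | inj₁ (z , ≡.refl) = proj₂ (cell-of (given z))
    ... | inj₂ _            = reflexive ≡.refl

    represent-terminal : ∀ z → represent (terminal z) ≡ given z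
    represent-terminal z with termAny? (λ z′ → ≡-dec _≟_ _≟_ (terminal z′) (terminal z))
    ... | inj₁ (z′ , e) = ≡.cong given (terminal-injective {z′} {z} e)
    ... | inj₂ none     = ⊥-elim (none z ≡.refl)

    link-given : k ℕ.< p → k ℕ.< q →
      ∃ λ (L : ∀ i → Path G (s i) (t i)) →
        ∀ i j → i ≢ j → DisjointSetoid.Disjoint vertexSetoid (Path.vertices (L i)) (Path.vertices (L j))
    link-given k<p k<q = link-vertices G represent
      (λ {x} {y} e x≢y → proj₁ ~-resp-≈ (sym (represent≈ y)) (proj₂ ~-resp-≈ (sym (represent≈ x)) (adjacent e x≢y)))
      (λ {x} {y} e → injective (trans (sym (represent≈ x)) (trans e (represent≈ y))))
      (rook-linked k k<p k<q terminal terminal-injective)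
      s t (λ i → represent-terminal (i , false)) (λ i → represent-terminal (i , true))

  rook-graph-linked : ∀ {k} → 1 ℕ.≤ k → k ℕ.< p → k ℕ.< q → IsLinked G k
  rook-graph-linked {k} 1≤k k<p k<q = (vertex-at ∘ cell , cell-injective ∘ injective) ,
    λ s t s-inj t-inj s≉t → link-given s t s-inj t-inj s≉t k<p k<q
    where
    2≤p : 2 ℕ.≤ p
    2≤p = ℕ.≤-trans (ℕ.s≤s 1≤k) k<p
    cell : Fin (2 ℕ.* k) → Cell p q
    -- The `2k` vertices are taken from two rows and `k` columns; `1 ≤ k` provides the second row.
    cell i = Fin.inject≤ (proj₁ (Fin.remQuot k i)) 2≤p , Fin.inject≤ (proj₂ (Fin.remQuot {2} k i)) (ℕ.<⇒≤ k<q)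
    cell-injective : ∀ {i j} → cell i ≡ cell j → i ≡ j
    cell-injective {i} {j} e = ≡.trans (≡.sym (Fin.combine-remQuot {2} k i))
      (≡.trans (≡.cong₂ combine
          (Fin.inject≤-injective 2≤p 2≤p _ _ (≡.cong proj₁ e))
          (Fin.inject≤-injective (ℕ.<⇒≤ k<q) (ℕ.<⇒≤ k<q) _ _ (≡.cong proj₂ e)))
        (Fin.combine-remQuot {2} k j))

-- Ring solver with integer coefficients, represented as differences of natural numbers.
module DifferenceSolver {c ℓ} (R : CommutativeRing c ℓ) where
  open CommutativeRing R
  open SemiringMult semiring using (×1-homo-*)
  open Mult +-monoid using (×-homo-+) renaming (_×_ to _×ℕ_)
  open RingProperties ring using ([y-z]x≈yx-zx; x[y-z]≈xy-xz)
  open AbelianGroupProperties +-abelianGroup using (⁻¹-anti-homo‿-; ⁻¹-∙-comm; ε⁻¹≈ε)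
  open CommutativeMonoid +-commutativeMonoid using (commutativeSemigroup)
  open CommutativeSemigroupProperties commutativeSemigroup using (interchange)
  open SetoidReasoning setoid

  private
    N : ℕ → Carrier
    N n = n ×ℕ 1#

  -- Cancelling common units makes the representation of an integer unique.
  cancel : ℕ × ℕ → ℕ × ℕ
  cancel (suc a , suc b) = cancel (a , b)
  cancel x               = x

  differences : RawRing _ _
  differences = record
    { Carrier = ℕ × ℕ
    ; _≈_     = _≡_
    ; _+_     = λ { (a , b) (c , d) → cancel (a ℕ.+ c , b ℕ.+ d) }
    ; _*_     = λ { (a , b) (c , d) → cancel (a ℕ.* c ℕ.+ b ℕ.* d , a ℕ.* d ℕ.+ b ℕ.* c) }
    ; -_      = swap
    ; 0#      = 0 , 0
    ; 1#      = 1 , 0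
    }

  -- The first two clauses make the constants 0 and 1 of the solver evaluate to 0# and 1#.
  value : ℕ × ℕ → Carrier
  value (0 , 0) = 0#
  value (1 , 0) = 1#
  value (a , b) = N a - N b

  private
    value≈ : ∀ x → value x ≈ N (proj₁ x) - N (proj₂ x)
    value≈ (0 , 0)               = sym (-‿inverseʳ 0#)
    value≈ (1 , 0)               = sym (trans (+-congˡ ε⁻¹≈ε) (trans (+-identityʳ _) (+-identityʳ 1#)))
    value≈ (suc (suc a) , 0)     = refl
    value≈ (0 , suc b)           = refl
    value≈ (suc zero , suc b)    = refl
    value≈ (suc (suc a) , suc b) = refl

    sub-interchange : ∀ a b c d → (a + c) - (b + d) ≈ (a - b) + (c - d)
    sub-interchange a b c d = trans (+-congˡ (sym (⁻¹-∙-comm b d))) (interchange a c (- b) (- d))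

    value-cancel : ∀ x → value (cancel x) ≈ N (proj₁ x) - N (proj₂ x)
    value-cancel (0 , b)         = value≈ (0 , b)
    value-cancel (suc a , 0)     = value≈ (suc a , 0)
    value-cancel (suc a , suc b) = begin
      value (cancel (a , b))       ≈⟨ value-cancel (a , b) ⟩
      N a - N b                    ≈⟨ +-identityˡ _ ⟨
      0# + (N a - N b)             ≈⟨ +-congʳ (-‿inverseʳ 1#) ⟨
      (1# - 1#) + (N a - N b)      ≈⟨ sub-interchange 1# 1# (N a) (N b) ⟨
      N (suc a) - N (suc b)        ∎

    N-mul-add : ∀ a b c d → N (a ℕ.* c ℕ.+ b ℕ.* d) ≈ N a * N c + N b * N d
    N-mul-add a b c d = trans (×-homo-+ 1# (a ℕ.* c) (b ℕ.* d)) (+-cong (×1-homo-* a c) (×1-homo-* b d))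

  morphism : differences -Raw-AlmostCommutative⟶ fromCommutativeRing R
  morphism = record
    { ⟦_⟧    = value
    ; +-homo = λ { x@(a , b) y@(c , d) → begin
        value (cancel (a ℕ.+ c , b ℕ.+ d))     ≈⟨ value-cancel (a ℕ.+ c , b ℕ.+ d) ⟩
        N (a ℕ.+ c) - N (b ℕ.+ d)              ≈⟨ +-cong (×-homo-+ 1# a c) (-‿cong (×-homo-+ 1# b d)) ⟩
        (N a + N c) - (N b + N d)              ≈⟨ sub-interchange (N a) (N b) (N c) (N d) ⟩
        (N a - N b) + (N c - N d)              ≈⟨ +-cong (value≈ x) (value≈ y) ⟨
        value x + value y                      ∎ }
    ; *-homo = λ { x@(a , b) y@(c , d) → begin
        value (cancel (a ℕ.* c ℕ.+ b ℕ.* d , a ℕ.* d ℕ.+ b ℕ.* c))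
          ≈⟨ value-cancel (a ℕ.* c ℕ.+ b ℕ.* d , a ℕ.* d ℕ.+ b ℕ.* c) ⟩
        N (a ℕ.* c ℕ.+ b ℕ.* d) - N (a ℕ.* d ℕ.+ b ℕ.* c)
          ≈⟨ +-cong (N-mul-add a b c d) (-‿cong (trans (N-mul-add a b d c) (+-comm _ _))) ⟩
        (N a * N c + N b * N d) - (N b * N c + N a * N d)    ≈⟨ sub-interchange _ _ _ _ ⟩
        (N a * N c - N b * N c) + (N b * N d - N a * N d)    ≈⟨ +-congˡ (⁻¹-anti-homo‿- _ _) ⟨
        (N a * N c - N b * N c) - (N a * N d - N b * N d)
          ≈⟨ +-cong ([y-z]x≈yx-zx _ _ _) (-‿cong ([y-z]x≈yx-zx _ _ _)) ⟨
        (N a - N b) * N c - (N a - N b) * N d                ≈⟨ x[y-z]≈xy-xz _ _ _ ⟨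
        (N a - N b) * (N c - N d)                            ≈⟨ *-cong (value≈ x) (value≈ y) ⟨
        value x * value y                                    ∎ }
    ; -‿homo = λ { (a , b) → trans (value≈ (b , a)) (trans (sym (⁻¹-anti-homo‿- (N a) (N b))) (-‿cong (sym (value≈ (a , b))))) }
    ; 0-homo = refl
    ; 1-homo = refl
    }

  private
    value-≟ : ∀ x y → Maybe (value x ≈ value y)
    value-≟ (a , b) (c , d) with a ℕ.≟ c | b ℕ.≟ d
    ... | yes ≡.refl | yes ≡.refl = just refl
    ... | _          | _          = nothing

  open RingSolver differences (fromCommutativeRing R) morphism value-≟ public
    using (solve; _:=_; _:+_; _:*_; _:-_; :-_; con)

-- Order, apartness and finite sums in the constructive reals

module OrderedField {c ℓ₁ ℓ₂} (ℝ : RealNumbers c ℓ₁ ℓ₂) where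
  open RealNumbers ℝ hiding (zero)
  open CommutativeRing commutativeRing using (semiring; +-commutativeMonoid)
  open DifferenceSolver commutativeRing
  open IsStrictPartialOrder isStrictPartialOrder public
    using (<-respʳ-≈; <-respˡ-≈) renaming (irrefl to <-irrefl; trans to <-trans; asym to <-asym)
  open HeytingProperties heytingCommutativeRing
    using (1#0; x#0y#0→xy#0; #-congʳ)
  open SetoidReasoning setoid

  pos⇒# : ∀ {x} → 0# < x → x # 0#
  pos⇒# 0<x = Equivalence.from #⇔<⊎> (inj₂ 0<x)

  sign : ∀ {x} → x # 0# → 0# < x ⊎ x < 0#
  sign x#0 = Sum.swap (Equivalence.to #⇔<⊎> x#0)

  -- The substitute for trichotomy: apartness is cotransitive, and numbers that are apart are
  -- ordered one way or the other.
  <-cotrans : ∀ {x y} → x < y → ∀ z → x < z ⊎ z < y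
  <-cotrans x<y z with #-cotrans (Equivalence.from #⇔<⊎> (inj₁ x<y)) z
  ... | inj₁ x#z with Equivalence.to #⇔<⊎> x#z
  ...   | inj₁ x<z = inj₁ x<z
  ...   | inj₂ z<x = inj₂ (<-trans z<x x<y)
  <-cotrans x<y z | inj₂ z#y with Equivalence.to #⇔<⊎> z#y
  ...   | inj₁ z<y = inj₂ z<y
  ...   | inj₂ y<z = inj₁ (<-trans x<y y<z)

  ≤-antisym : ∀ {x y} → x ≤ y → y ≤ x → x ≈ y
  ≤-antisym x≤y y≤x = proj₁ (tight _ _) λ x#y → Sum.[ y≤x , x≤y ] (Equivalence.to #⇔<⊎> x#y)

  <⇒≤ : ∀ {x y} → x < y → x ≤ y
  <⇒≤ = <-asym

  ≈⇒≤ : ∀ {x y} → x ≈ y → x ≤ y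
  ≈⇒≤ x≈y = <-irrefl (sym x≈y)

  ≤-respʳ : ∀ {x y z} → y ≈ z → x ≤ y → x ≤ z
  ≤-respʳ y≈z x≤y z<x = x≤y (<-respˡ-≈ (sym y≈z) z<x)

  ≤-respˡ : ∀ {x y z} → x ≈ y → x ≤ z → y ≤ z
  ≤-respˡ x≈y x≤z z<y = x≤z (<-respʳ-≈ (sym x≈y) z<y)

  <⇒pos : ∀ {x y} → x < y → 0# < y - x
  <⇒pos {x} {y} x<y = <-respˡ-≈ (-‿inverseʳ x) (+-monoˡ-< (- x) x<y)

  pos⇒< : ∀ {x y} → 0# < y - x → x < y
  pos⇒< {x} {y} 0<y-x = <-respˡ-≈ (+-identityˡ x)
    (<-respʳ-≈ (solve 2 (λ x y → (y :- x) :+ x := y) refl x y) (+-monoˡ-< x 0<y-x))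

  ≤⇒nonneg : ∀ {x y} → x ≤ y → 0# ≤ y - x
  ≤⇒nonneg {x} {y} x≤y y-x<0 = x≤y (<-respʳ-≈ (+-identityˡ x)
    (<-respˡ-≈ (solve 2 (λ x y → (y :- x) :+ x := y) refl x y) (+-monoˡ-< x y-x<0)))

  nonneg⇒≤ : ∀ {x y} → 0# ≤ y - x → x ≤ y
  nonneg⇒≤ {x} {y} 0≤ y<x = 0≤ (<-respʳ-≈ (-‿inverseʳ x) (+-monoˡ-< (- x) y<x))

  neg⇒pos : ∀ {x} → x < 0# → 0# < - x
  neg⇒pos x<0 = <-respʳ-≈ (+-identityˡ _) (<⇒pos x<0)

  pos⇒neg : ∀ {x} → 0# < x → - x < 0#
  pos⇒neg {x} 0<x = pos⇒< (<-respʳ-≈ (solve 1 (λ x → x := con (0 , 0) :- (:- x)) refl x) 0<x)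

  0<1 : 0# < 1#
  0<1 with sign 1#0
  ... | inj₁ 0<1 = 0<1
  ... | inj₂ 1<0 = <-respʳ-≈ (solve 0 ((:- con (1 , 0)) :* (:- con (1 , 0)) := con (1 , 0)) refl)
                     (*-pos (neg⇒pos 1<0) (neg⇒pos 1<0))

  +-nonneg : ∀ {x y} → 0# ≤ x → 0# ≤ y → 0# ≤ x + y
  +-nonneg {x} {y} 0≤x 0≤y x+y<0 with <-cotrans x+y<0 x
  ... | inj₂ x<0   = 0≤x x<0
  ... | inj₁ x+y<x = 0≤y (<-respʳ-≈ (-‿inverseʳ x)
      (<-respˡ-≈ (solve 2 (λ x y → (x :+ y) :- x := y) refl x y) (+-monoˡ-< (- x) x+y<x)))

  +-pos : ∀ {x y} → 0# ≤ x → 0# < y → 0# < x + y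
  +-pos {x} {y} 0≤x 0<y with <-cotrans (<-respˡ-≈ (+-identityˡ x) (<-respʳ-≈ (+-comm y x) (+-monoˡ-< x 0<y))) 0#
  ... | inj₁ x<0   = ⊥-elim (0≤x x<0)
  ... | inj₂ 0<x+y = 0<x+y

  +-pos-cases : ∀ {x y} → 0# < x + y → 0# < x ⊎ 0# < y
  +-pos-cases {x} {y} 0<x+y with <-cotrans 0<x+y x
  ... | inj₁ 0<x   = inj₁ 0<x
  ... | inj₂ x<x+y = inj₂ (<-respʳ-≈ (solve 2 (λ x y → (x :+ y) :- x := y) refl x y) (<⇒pos x<x+y))

  *-# : ∀ {x y} → x # 0# → y # 0# → x * y # 0#
  *-# = x#0y#0→xy#0

  x-0≈x : ∀ x → x - 0# ≈ x
  x-0≈x = solve 1 (λ x → x :- con (0 , 0) := x) refl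

  recip : ∀ {x} → x # 0# → ∃ λ y → x * y ≈ 1#
  recip {x} x#0 with #⇒invertible x#0
  ... | y , _ , e = y , trans (*-congʳ (sym (x-0≈x x))) e

  -- Apartness from zero is invertibility, and `y * z` inverts `x` if `z` inverts `x * y`.
  *-#-factorˡ : ∀ {x y} → x * y # 0# → x # 0#
  *-#-factorˡ {x} {y} xy#0 with recip xy#0
  ... | z , e = invertible⇒# (y * z , trans (*-comm _ _) inverse , inverse)
    where
    inverse : (x - 0#) * (y * z) ≈ 1#
    inverse = trans (*-congʳ (x-0≈x x)) (trans (sym (*-assoc x y z)) e)

  *-#-factorʳ : ∀ {x y} → x * y # 0# → y # 0#
  *-#-factorʳ xy#0 = *-#-factorˡ (#-congʳ (*-comm _ _) xy#0)

  -‿# : ∀ {x} → x # 0# → - x # 0#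
  -‿# {x} x#0 = *-#-factorˡ {y = - 1#} (#-congʳ (solve 1 (λ x → x := (:- x) :* (:- con (1 , 0))) refl x) x#0)

  *-cancelˡ-pos : ∀ {x y} → 0# < x → 0# < x * y → 0# < y
  *-cancelˡ-pos {x} {y} 0<x 0<xy with sign (*-#-factorʳ (pos⇒# 0<xy))
  ... | inj₁ 0<y = 0<y
  ... | inj₂ y<0 = ⊥-elim (<-asym 0<xy (<-respˡ-≈ (solve 2 (λ x y → :- (x :* (:- y)) := x :* y) refl x y)
                     (pos⇒neg (*-pos 0<x (neg⇒pos y<0)))))

  recip-pos : ∀ {x} → 0# < x → ∃ λ y → 0# < y × x * y ≈ 1#
  recip-pos 0<x with recip (pos⇒# 0<x)
  ... | y , xy≈1 = y , *-cancelˡ-pos 0<x (<-respʳ-≈ (sym xy≈1) 0<1) , xy≈1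

  -- Nonnegative numbers have no decidable sign, but the assumption to be refuted makes the product,
  -- and so both factors, apart from zero.
  *-nonneg : ∀ {x y} → 0# ≤ x → 0# ≤ y → 0# ≤ x * y
  *-nonneg {x} {y} 0≤x 0≤y xy<0 with sign (*-#-factorˡ xy#0) | sign (*-#-factorʳ xy#0)
    where xy#0 = Equivalence.from #⇔<⊎> (inj₁ xy<0)
  ... | inj₂ x<0 | _        = 0≤x x<0
  ... | inj₁ _   | inj₂ y<0 = 0≤y y<0
  ... | inj₁ 0<x | inj₁ 0<y = <-asym xy<0 (*-pos 0<x 0<y)

  *-cancel-0 : ∀ {x y} → x # 0# → x * y ≈ 0# → y ≈ 0#
  *-cancel-0 {x} {y} x#0 xy≈0 with recip x#0
  ... | z , xz≈1 = begin
    y            ≈⟨ *-identityˡ y ⟨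
    1# * y       ≈⟨ *-congʳ xz≈1 ⟨
    (x * z) * y  ≈⟨ solve 3 (λ x y z → (x :* z) :* y := z :* (x :* y)) refl x y z ⟩
    z * (x * y)  ≈⟨ *-congˡ xy≈0 ⟩
    z * 0#       ≈⟨ zeroʳ z ⟩
    0#           ∎

  square-pos : ∀ {x} → x # 0# → 0# < x * x
  square-pos {x} x#0 with sign x#0
  ... | inj₁ 0<x = *-pos 0<x 0<x
  ... | inj₂ x<0 = <-respʳ-≈ (solve 1 (λ x → (:- x) :* (:- x) := x :* x) refl x) (*-pos (neg⇒pos x<0) (neg⇒pos x<0))

  #-sub : ∀ {x y} → x # y → x - y # 0#
  #-sub {x} {y} x#y with #⇒invertible x#y
  ... | z , e , e′ = invertible⇒# (z , trans (*-congˡ (x-0≈x _)) e , trans (*-congʳ (x-0≈x _)) e′)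

  #-resp : ∀ {x y} → x ≈ y → x # 0# → y # 0#
  #-resp = #-congʳ

  x-y≈0⇒x≈y : ∀ {x y} → x - y ≈ 0# → x ≈ y
  x-y≈0⇒x≈y {x} {y} e = begin
    x            ≈⟨ solve 2 (λ x y → x := (x :- y) :+ y) refl x y ⟩
    (x - y) + y  ≈⟨ +-congʳ e ⟩
    0# + y       ≈⟨ +-identityˡ y ⟩
    y            ∎

  -- The witness `xy / (x + y)` avoids deciding which number is smaller.
  common-lower-bound : ∀ {x y} → 0# < x → 0# < y → ∃ λ z → 0# < z × z ≤ x × z ≤ y
  common-lower-bound {x} {y} 0<x 0<y = x * y * r , *-pos (*-pos 0<x 0<y) 0<r , below x y 0<x e ,
    ≤-respˡ (*-congʳ (*-comm y x)) (below y x 0<y (trans (*-congʳ (+-comm y x)) e))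
    where
    inv = recip-pos (+-pos (<⇒≤ 0<x) 0<y)
    r   = proj₁ inv
    0<r = proj₁ (proj₂ inv)
    e   = proj₂ (proj₂ inv)
    below : ∀ x y → 0# < x → (x + y) * r ≈ 1# → x * y * r ≤ x
    below x y 0<x e = nonneg⇒≤ (≤-respʳ (begin
      x * (x * r)
        ≈⟨ solve 3 (λ x y r → x :* (x :* r) := x :* ((x :+ y) :* r) :- x :* y :* r) refl x y r ⟩
      x * ((x + y) * r) - x * y * r   ≈⟨ +-congʳ (trans (*-congˡ e) (*-identityʳ x)) ⟩
      x - x * y * r                   ∎) (<⇒≤ (*-pos 0<x (*-pos 0<x 0<r))))

  small-multiple : ∀ {x y} → 0# < x → 0# < y → ∃ λ m → 0# < m × (∀ {z} → z ≤ m → z * y ≤ x)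
  small-multiple {x} {y} 0<x 0<y = x * r , *-pos 0<x 0<r , below
    where
    inv = recip-pos 0<y
    r   = proj₁ inv
    0<r = proj₁ (proj₂ inv)
    below : ∀ {z} → z ≤ x * r → z * y ≤ x
    below {z} z≤ = nonneg⇒≤ (≤-respʳ (begin
      (x * r - z) * y          ≈⟨ solve 4 (λ x y r z → (x :* r :- z) :* y := x :* (y :* r) :- z :* y) refl x y r z ⟩
      x * (y * r) - z * y      ≈⟨ +-congʳ (trans (*-congˡ (proj₂ (proj₂ inv))) (*-identityʳ x)) ⟩
      x - z * y                ∎) (*-nonneg (≤⇒nonneg z≤) (<⇒≤ 0<y)))

  sum-cong-≋ : ∀ {n} {f g : Vector Carrier n} → (∀ i → f i ≈ g i) → sum f ≈ sum g
  sum-cong-≋ = MonoidSum.sum-cong-≋ +-commutativeMonoid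

  ∑-distrib-+ : ∀ {n} (f g : Vector Carrier n) → sum (λ i → f i + g i) ≈ sum f + sum g
  ∑-distrib-+ = MonoidSum.∑-distrib-+ +-commutativeMonoid

  ∑-comm : ∀ {m n} (f : Fin m → Fin n → Carrier) → sum (λ i → sum (λ j → f i j)) ≈ sum (λ j → sum (λ i → f i j))
  ∑-comm = MonoidSum.∑-comm +-commutativeMonoid

  sum-remove : ∀ {n} i (f : Vector Carrier (suc n)) → sum f ≈ f i + sum (f ∘ punchIn i)
  sum-remove i f = MonoidSum.sum-remove +-commutativeMonoid {i = i} f

  *-distribˡ-sum : ∀ {n} x (f : Vector Carrier n) → x * sum f ≈ sum (λ i → x * f i)
  *-distribˡ-sum = SemiringSum.*-distribˡ-sum semiring

  *-distribʳ-sum : ∀ {n} x (f : Vector Carrier n) → sum f * x ≈ sum (λ i → f i * x)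
  *-distribʳ-sum = SemiringSum.*-distribʳ-sum semiring

  sum-nonneg : ∀ {n} (f : Vector Carrier n) → (∀ i → 0# ≤ f i) → 0# ≤ sum f
  sum-nonneg {zero}  f 0≤f = <-irrefl refl
  sum-nonneg {suc n} f 0≤f = +-nonneg (0≤f zero) (sum-nonneg (f ∘ suc) (0≤f ∘ suc))

  sum-pos : ∀ {n} (f : Vector Carrier n) → (∀ i → 0# ≤ f i) → ∀ i → 0# < f i → 0# < sum f
  sum-pos f 0≤f zero    0<fi = <-respʳ-≈ (+-comm _ _) (+-pos (sum-nonneg (f ∘ suc) (0≤f ∘ suc)) 0<fi)
  sum-pos f 0≤f (suc i) 0<fi = +-pos (0≤f zero) (sum-pos (f ∘ suc) (0≤f ∘ suc) i 0<fi)

  -- The source of indices with a positive slack: cotransitivity finds the summand without deciding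
  -- any sign.
  sum-pos⇒ : ∀ {n} (f : Vector Carrier n) → 0# < sum f → ∃ λ i → 0# < f i
  sum-pos⇒ {zero}  f 0<0 = ⊥-elim (<-irrefl refl 0<0)
  sum-pos⇒ {suc n} f 0<Σ with +-pos-cases 0<Σ
  ... | inj₁ 0<f0 = zero , 0<f0
  ... | inj₂ 0<Σ′ with sum-pos⇒ (f ∘ suc) 0<Σ′
  ...   | i , 0<fi = suc i , 0<fi

  sum-nonneg-zero : ∀ {n} (f : Vector Carrier n) → (∀ i → 0# ≤ f i) → sum f ≈ 0# → ∀ i → f i ≈ 0#
  sum-nonneg-zero f 0≤f Σ≈0 i = ≤-antisym (λ 0<fi → <-irrefl (sym Σ≈0) (sum-pos f 0≤f i 0<fi)) (0≤f i)

  sum-zero : ∀ {n} (f : Vector Carrier n) → (∀ i → f i ≈ 0#) → sum f ≈ 0#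
  sum-zero {zero}  f f≈0 = refl
  sum-zero {suc n} f f≈0 = trans (+-cong (f≈0 zero) (sum-zero (f ∘ suc) (f≈0 ∘ suc))) (+-identityˡ 0#)

  sum-single : ∀ {n} (f : Vector Carrier n) i → (∀ j → j ≢ i → f j ≈ 0#) → sum f ≈ f i
  sum-single f zero    f≈0 = trans (+-congˡ (sum-zero (f ∘ suc) λ j → f≈0 (suc j) λ ())) (+-identityʳ _)
  sum-single f (suc i) f≈0 = trans (+-cong (f≈0 zero λ ()) (sum-single (f ∘ suc) i λ j j≢i → f≈0 (suc j) (j≢i ∘ Fin.suc-injective))) (+-identityˡ _)

  sum-sub : ∀ {n} (f g : Vector Carrier n) → sum (λ i → f i - g i) ≈ sum f - sum g
  sum-sub {zero}  f g = sym (-‿inverseʳ 0#)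
  sum-sub {suc n} f g = trans (+-congˡ (sum-sub (f ∘ suc) (g ∘ suc)))
    (solve 4 (λ a b c d → (a :- b) :+ (c :- d) := (a :+ c) :- (b :+ d)) refl _ _ _ _)

  sum-pair : ∀ {n} (f : Vector Carrier n) {i j} → i ≢ j → (∀ l → l ≢ i → l ≢ j → f l ≈ 0#) → sum f ≈ f i + f j
  sum-pair f {zero}  {zero}  i≢j _   = ⊥-elim (i≢j ≡.refl)
  sum-pair f {zero}  {suc j} i≢j f≈0 =
    +-congˡ (sum-single (f ∘ suc) j λ l l≢j → f≈0 (suc l) (λ ()) (l≢j ∘ Fin.suc-injective))
  sum-pair f {suc i} {zero}  i≢j f≈0 = trans
    (+-congˡ (sum-single (f ∘ suc) i λ l l≢i → f≈0 (suc l) (l≢i ∘ Fin.suc-injective) (λ ()))) (+-comm _ _)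
  sum-pair f {suc i} {suc j} i≢j f≈0 = trans
    (+-cong (f≈0 zero (λ ()) (λ ())) (sum-pair (f ∘ suc) (i≢j ∘ ≡.cong suc) λ l l≢i l≢j →
      f≈0 (suc l) (l≢i ∘ Fin.suc-injective) (l≢j ∘ Fin.suc-injective)))
    (+-identityˡ _)

  sum-neg : ∀ {n} (f : Vector Carrier n) → sum (λ i → - f i) ≈ - sum f
  sum-neg {zero}  f = solve 0 (con (0 , 0) := :- con (0 , 0)) refl
  sum-neg {suc n} f = trans (+-congˡ (sum-neg (f ∘ suc))) (solve 2 (λ a b → (:- a) :+ (:- b) := :- (a :+ b)) refl _ _)

  -- Individual bounds are added, since choosing the largest would need a decidable order.
  upper-bound : ∀ {n} (x : Vector Carrier n) → ∃ λ m → 0# < m × (∀ i → x i < m) × (∀ i → - x i < m)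
  upper-bound {zero}  x = 1# , 0<1 , (λ ()) , (λ ())
  upper-bound {suc n} x with bound (x zero) | bound (- x zero) | upper-bound (x ∘ suc)
    where
    bound : ∀ x → ∃ λ m → 0# < m × x < m
    bound x with <-cotrans 0<1 x
    ... | inj₂ x<1 = 1# , 0<1 , x<1
    ... | inj₁ 0<x = x + 1# , +-pos (<⇒≤ 0<x) 0<1 , pos⇒< (<-respʳ-≈ (solve 1 (λ x → con (1 , 0) := (x :+ con (1 , 0)) :- x) refl x) 0<1)
  ... | u , 0<u , x<u | v , 0<v , -x<v | m , 0<m , x<m , -x<m =
    (u + v) + m , +-pos (<⇒≤ (+-pos (<⇒≤ 0<u) 0<v)) 0<m ,
    (λ { zero → <-trans x<u (<-by (solve 3 (λ u v m → ((u :+ v) :+ m) :- u := v :+ m) refl u v m) (+-pos (<⇒≤ 0<v) 0<m))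
       ; (suc i) → <-trans (x<m i) (<-by (solve 3 (λ u v m → ((u :+ v) :+ m) :- m := u :+ v) refl u v m) (+-pos (<⇒≤ 0<u) 0<v)) }) ,
    (λ { zero → <-trans -x<v (<-by (solve 3 (λ u v m → ((u :+ v) :+ m) :- v := u :+ m) refl u v m) (+-pos (<⇒≤ 0<u) 0<m))
       ; (suc i) → <-trans (-x<m i) (<-by (solve 3 (λ u v m → ((u :+ v) :+ m) :- m := u :+ v) refl u v m) (+-pos (<⇒≤ 0<u) 0<v)) })
    where
    <-by : ∀ {x y z} → y - x ≈ z → 0# < z → x < y
    <-by e 0<z = pos⇒< (<-respʳ-≈ (sym e) 0<z)

-- Polynomials and the affine dependence of points on the moment curve

module Polynomials {c ℓ₁ ℓ₂} (ℝ : RealNumbers c ℓ₁ ℓ₂) where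
  open RealNumbers ℝ hiding (zero)
  open OrderedField ℝ
  open DifferenceSolver commutativeRing
  open SetoidReasoning setoid

  eval : ∀ {m} → Vector Carrier m → Carrier → Carrier
  eval {zero}  q x = 0#
  eval {suc m} q x = q zero + x * eval (q ∘ suc) x

  eval-sum : ∀ {m} (q : Vector Carrier m) x → eval q x ≈ sum (λ k → x ^ toℕ k * q k)
  eval-sum {zero}  q x = refl
  eval-sum {suc m} q x = +-cong (sym (*-identityˡ _)) (begin
    x * eval (q ∘ suc) x                            ≈⟨ *-congˡ (eval-sum (q ∘ suc) x) ⟩
    x * sum (λ k → x ^ toℕ k * q (suc k))           ≈⟨ *-distribˡ-sum x (λ k → x ^ toℕ k * q (suc k)) ⟩
    sum (λ k → x * (x ^ toℕ k * q (suc k)))         ≈⟨ sum-cong-≋ {m} (λ k → *-assoc x (x ^ toℕ k) (q (suc k))) ⟨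
    sum (λ k → x ^ suc (toℕ k) * q (suc k))         ∎)

  -- Synthetic division by `x - r`; the remainder is the value at `r`.
  quotient : ∀ {m} → Vector Carrier (suc m) → Carrier → Vector Carrier m
  quotient {suc m} q r zero    = eval (q ∘ suc) r
  quotient {suc m} q r (suc k) = quotient (q ∘ suc) r k

  eval-quotient : ∀ {m} (q : Vector Carrier (suc m)) r x →
                  eval q x ≈ eval q r + (x - r) * eval (quotient q r) x
  eval-quotient {zero}  q r x =
    solve 3 (λ a r x → a :+ x :* con (0 , 0) := (a :+ r :* con (0 , 0)) :+ (x :- r) :* con (0 , 0)) refl (q zero) r x
  eval-quotient {suc m} q r x = trans (+-congˡ (*-congˡ (eval-quotient (q ∘ suc) r x)))
    (solve 5 (λ a e d r x → a :+ x :* (e :+ (x :- r) :* d) := (a :+ r :* e) :+ (x :- r) :* (e :+ x :* d)) refl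
      (q zero) (eval (q ∘ suc) r) (eval (quotient (q ∘ suc) r) x) r x)

  quotient-zero : ∀ {m} (q : Vector Carrier (suc m)) r → eval q r ≈ 0# →
                  (∀ k → quotient q r k ≈ 0#) → ∀ k → q k ≈ 0#
  quotient-zero {zero}  q r q[r]≈0 _ zero = trans (sym (trans (+-congˡ (zeroʳ r)) (+-identityʳ _))) q[r]≈0
  quotient-zero {suc m} q r q[r]≈0 q/≈0 zero =
    trans (sym (trans (+-congˡ (trans (*-congˡ (q/≈0 zero)) (zeroʳ r))) (+-identityʳ _))) q[r]≈0
  quotient-zero {suc m} q r q[r]≈0 q/≈0 (suc k) = quotient-zero (q ∘ suc) r (q/≈0 zero) (q/≈0 ∘ suc) k

  Apart : ∀ {m} → Vector Carrier m → Set ℓ₂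
  Apart t = ∀ i j → i ≢ j → t i # t j

  -- One root after the other is divided out: the quotient vanishes at the remaining points because
  -- their differences to the root are invertible.
  vanishing : ∀ {m} (t : Vector Carrier m) → Apart t → (q : Vector Carrier m) →
              (∀ i → eval q (t i) ≈ 0#) → ∀ k → q k ≈ 0#
  vanishing {suc m} t t# q q≈0 = quotient-zero q (t zero) (q≈0 zero)
    (vanishing (t ∘ suc) (λ i j i≢j → t# (suc i) (suc j) (i≢j ∘ Fin.suc-injective)) (quotient q (t zero)) λ i →
      *-cancel-0 (#-sub (t# (suc i) zero λ ())) (begin
        (t (suc i) - t zero) * eval (quotient q (t zero)) (t (suc i))                 ≈⟨ +-identityˡ _ ⟨
        0# + (t (suc i) - t zero) * eval (quotient q (t zero)) (t (suc i))            ≈⟨ +-congʳ (q≈0 zero) ⟨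
        eval q (t zero) + (t (suc i) - t zero) * eval (quotient q (t zero)) (t (suc i))
          ≈⟨ eval-quotient q (t zero) (t (suc i)) ⟨
        eval q (t (suc i))                                                            ≈⟨ q≈0 (suc i) ⟩
        0#                                                                            ∎))

  -- Here `m` counts coefficients, so the degree is less than `m`.
  IsPoly : ℕ → (Carrier → Carrier) → Set _
  IsPoly m f = ∃ λ (q : Vector Carrier m) → ∀ x → f x ≈ eval q x

  isPoly-cong : ∀ {m f g} → (∀ x → g x ≈ f x) → IsPoly m f → IsPoly m g
  isPoly-cong g≈f (q , f≈q) = q , λ x → trans (g≈f x) (f≈q x)

  isPoly-one : IsPoly 1 (λ _ → 1#)
  isPoly-one = (λ _ → 1#) , λ x → sym (trans (+-congˡ (zeroʳ x)) (+-identityʳ 1#))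

  isPoly-root : ∀ {m f} r → IsPoly m f → IsPoly (suc m) (λ x → (x - r) * f x)
  isPoly-root r (q , f≈q) = times q , λ x → trans (*-congˡ (f≈q x)) (eval-times q x)
    where
    times : ∀ {m} → Vector Carrier m → Vector Carrier (suc m)
    times {zero}  q _             = 0#
    times {suc m} q zero          = - (r * q zero)
    times {suc m} q (suc zero)    = q zero + times (q ∘ suc) zero
    times {suc m} q (suc (suc k)) = times (q ∘ suc) (suc k)
    eval-times : ∀ {m} (q : Vector Carrier m) x → (x - r) * eval q x ≈ eval (times q) x
    eval-times {zero}  q x = trans (zeroʳ _) (sym (trans (+-identityˡ _) (zeroʳ x)))
    eval-times {suc m} q x = begin
      (x - r) * (q zero + x * e)
        ≈⟨ solve 4 (λ x r a e → (x :- r) :* (a :+ x :* e) := :- (r :* a) :+ x :* (a :+ (x :- r) :* e)) refl x r (q zero) e ⟩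
      - (r * q zero) + x * (q zero + (x - r) * e)
        ≈⟨ +-congˡ (*-congˡ (trans (+-congˡ (eval-times (q ∘ suc) x)) (sym (+-assoc _ _ _)))) ⟩
      eval (times q) x                            ∎
      where e = eval (q ∘ suc) x

  isPoly-≤ : ∀ {m n f} → m ℕ.≤ n → IsPoly m f → IsPoly n f
  isPoly-≤ m≤n (q , f≈q) = pad m≤n q , λ x → trans (f≈q x) (sym (eval-pad m≤n q x))
    where
    pad : ∀ {m n} → m ℕ.≤ n → Vector Carrier m → Vector Carrier n
    pad ℕ.z≤n     q _       = 0#
    pad (ℕ.s≤s l) q zero    = q zero
    pad (ℕ.s≤s l) q (suc k) = pad l (q ∘ suc) k
    eval-0 : ∀ n x → eval {n} (λ _ → 0#) x ≈ 0#
    eval-0 zero    x = refl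
    eval-0 (suc n) x = trans (+-identityˡ _) (trans (*-congˡ (eval-0 n x)) (zeroʳ x))
    eval-pad : ∀ {m n} (l : m ℕ.≤ n) (q : Vector Carrier m) x → eval (pad l q) x ≈ eval q x
    eval-pad {n = n} ℕ.z≤n     q x = eval-0 n x
    eval-pad         (ℕ.s≤s l) q x = +-congˡ (*-congˡ (eval-pad l (q ∘ suc) x))

  rooted : ∀ {n} → Vector Carrier n → Carrier → Carrier
  rooted {zero}  rs x = 1#
  rooted {suc n} rs x = (x - rs zero) * rooted (rs ∘ suc) x

  rooted-zero : ∀ {n} (rs : Vector Carrier n) {x} i → x ≈ rs i → rooted rs x ≈ 0#
  rooted-zero rs zero    e = trans (*-congʳ (trans (+-congʳ e) (-‿inverseʳ _))) (zeroˡ _)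
  rooted-zero rs (suc i) e = trans (*-congˡ (rooted-zero (rs ∘ suc) i e)) (zeroʳ _)

  rooted-# : ∀ {n} (rs : Vector Carrier n) {x} → (∀ i → x # rs i) → rooted rs x # 0#
  rooted-# {zero}  rs x# = pos⇒# 0<1
  rooted-# {suc n} rs x# = *-# (#-sub (x# zero)) (rooted-# (rs ∘ suc) (x# ∘ suc))

  isPoly-rooted : ∀ {n} (rs : Vector Carrier n) → IsPoly (suc n) (rooted rs)
  isPoly-rooted {zero}  rs = isPoly-one
  isPoly-rooted {suc n} rs = isPoly-root (rs zero) (isPoly-rooted (rs ∘ suc))

  isPoly-rooted² : ∀ {n} (rs : Vector Carrier n) → IsPoly (suc (n ℕ.* 2)) (λ x → rooted rs x * rooted rs x)
  isPoly-rooted² {zero}  rs = isPoly-cong (λ _ → *-identityʳ 1#) isPoly-one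
  isPoly-rooted² {suc n} rs =
    isPoly-cong (λ x → solve 2 (λ a b → (a :* b) :* (a :* b) := a :* (a :* (b :* b))) refl _ _)
      (isPoly-root (rs zero) (isPoly-root (rs zero) (isPoly-rooted² (rs ∘ suc))))

  Annihilates : ∀ {n} → ℕ → Vector Carrier n → Vector Carrier n → Set _
  Annihilates m t λ′ = ∀ {f} → IsPoly m f → sum (λ l → λ′ l * f (t l)) ≈ 0#

  -- Divided differences: the weights are those of Lagrange interpolation.
  annihilator : ∀ {m} (t : Vector Carrier (suc m)) → Apart t →
                ∃ λ (w : Vector Carrier (suc m)) → (∀ l → w l # 0#) × Annihilates m t w
  annihilator {zero}  t t# = (λ _ → 1#) , (λ _ → pos⇒# 0<1) ,
    λ { (q , f≈q) → trans (+-identityʳ _) (trans (*-identityˡ _) (f≈q _)) }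
  annihilator {suc m} t t# with annihilator (t ∘ suc) (λ i j i≢j → t# (suc i) (suc j) (i≢j ∘ Fin.suc-injective))
  ... | w′ , w′# , w′⊥ = w , w# , w⊥
    where
    r = t zero
    u : ∀ l → ∃ λ y → (t (suc l) - r) * y ≈ 1#
    u l = recip (#-sub (t# (suc l) zero λ ()))
    v : Vector Carrier (suc m)
    -- In `f (t l) = f r + (t l - r) * d l`, dividing the old weights by `t l - r` makes the parts
    -- with `d` cancel by induction. The weight `- sum v` at `r` cancels the constant parts.
    v l = w′ l * proj₁ (u l)
    w : Vector Carrier (suc (suc m))
    w zero    = - sum v
    w (suc l) = v l

    w⊥ : Annihilates (suc m) t w
    w⊥ {f} (q , f≈q) = begin
      w zero * f r + sum (λ l → v l * f (t (suc l)))  ≈⟨ +-cong (*-congˡ (f≈q r)) (sum-cong-≋ term) ⟩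
      w zero * f₀ + sum (λ l → v l * f₀ + w′ l * d l) ≈⟨ +-congˡ (∑-distrib-+ (λ l → v l * f₀) (λ l → w′ l * d l)) ⟩
      w zero * f₀ + (sum (λ l → v l * f₀) + sum (λ l → w′ l * d l))
        ≈⟨ +-congˡ (+-cong (*-distribʳ-sum f₀ v) (sym (w′⊥ (quotient q r , λ _ → refl)))) ⟨
      - sum v * f₀ + (sum v * f₀ + 0#)
        ≈⟨ solve 2 (λ s f → (:- s) :* f :+ (s :* f :+ con (0 , 0)) := con (0 , 0)) refl (sum v) f₀ ⟩
      0#                                              ∎
      where
      f₀ = eval q r
      d : Vector Carrier (suc m)
      d l = eval (quotient q r) (t (suc l))
      term : ∀ l → v l * f (t (suc l)) ≈ v l * f₀ + w′ l * d l
      term l = begin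
        v l * f (t (suc l))                               ≈⟨ *-congˡ (trans (f≈q _) (eval-quotient q r (t (suc l)))) ⟩
        v l * (f₀ + x * d l)
          ≈⟨ solve 5 (λ w y f x d → (w :* y) :* (f :+ x :* d) := (w :* y) :* f :+ w :* ((x :* y) :* d)) refl (w′ l) (proj₁ (u l)) f₀ x (d l) ⟩
        v l * f₀ + w′ l * ((x * proj₁ (u l)) * d l)
          ≈⟨ +-congˡ (*-congˡ (trans (*-congʳ (proj₂ (u l))) (*-identityˡ _))) ⟩
        v l * f₀ + w′ l * d l                             ∎
        where x = t (suc l) - r

    v# : ∀ l → v l # 0#
    v# l = *-# (w′# l) (*-#-factorʳ (#-resp (sym (proj₂ (u l))) (pos⇒# 0<1)))

    w# : ∀ l → w l # 0#
    w# (suc l) = v# l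
    -- As `g` vanishes at all points but `r` and `s`, the relation says that `w zero * g r` is the
    -- negative of `v zero * g s`, which is apart from zero.
    w# zero    = *-#-factorˡ (#-resp (sym (begin
        w zero * g r                               ≈⟨ solve 2 (λ a b → a := (a :+ b) :- b) refl _ (v zero * g s) ⟩
        (w zero * g r + v zero * g s) - v zero * g s
          ≈⟨ +-congʳ (+-congˡ (sum-single (λ l → v l * g (t (suc l))) zero others)) ⟨
        sum (λ l → w l * g (t l)) - v zero * g s   ≈⟨ +-congʳ (w⊥ (isPoly-rooted rest)) ⟩
        0# - v zero * g s                          ≈⟨ solve 1 (λ x → con (0 , 0) :- x := (:- con (1 , 0)) :* x) refl _ ⟩
        - 1# * (v zero * g s)                      ∎))
      (*-# (-‿# (pos⇒# 0<1)) (*-# (v# zero) (rooted-# rest λ i → t# (suc zero) (suc (suc i)) λ ()))))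
      where
      rest : Vector Carrier m
      rest l = t (suc (suc l))
      g = rooted rest
      s = t (suc zero)
      others : ∀ l → l ≢ zero → v l * g (t (suc l)) ≈ 0#
      others zero    0≢0 = ⊥-elim (0≢0 ≡.refl)
      others (suc l) _   = trans (*-congˡ (rooted-zero rest l refl)) (zeroʳ _)

  module _ {m n : ℕ} {t : Vector Carrier n} where

    -- Negation exchanges rows and columns, so `many-positive` bounds both numbers.
    annihilates-neg : ∀ {w} → Annihilates m t w → Annihilates m t (λ l → - w l)
    annihilates-neg {w} w⊥ {f} poly = begin
      sum (λ l → - w l * f (t l))
        ≈⟨ sum-cong-≋ {n} (λ l → solve 2 (λ w x → (:- w) :* x := :- (w :* x)) refl (w l) (f (t l))) ⟩
      sum (λ l → - (w l * f (t l)))     ≈⟨ sum-neg (λ l → w l * f (t l)) ⟩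
      - sum (λ l → w l * f (t l))       ≈⟨ -‿cong (w⊥ poly) ⟩
      - 0#                              ≈⟨ solve 0 (:- con (0 , 0) := con (0 , 0)) refl ⟩
      0#                                ∎

    -- Otherwise the square of the polynomial with these roots would have degree at most 2k, but
    -- all its values would be weighted nonpositively.
    many-positive : Apart t → ∀ {w} → (∀ l → w l # 0#) → Annihilates m t w → Fin n → ∀ {p k} → k ℕ.* 2 ℕ.< m →
                    Embed p n (λ l → 0# < w l) → k ℕ.< p
    many-positive t# {w} w# w⊥ l₀ {p} {k} 2k<m E = ℕ.≰⇒> λ p≤k → absurd p≤k some-negative
      where
      module E = Embed E
      g : Carrier → Carrier
      g = rooted (t ∘ E.f)
      -- If all weights were positive, the constant polynomial 1 would contradict the relation.
      some-negative : ∃ λ l → w l < 0#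
      some-negative with Fin.any? {P = λ l → w l < 0#} (λ l → Sum.[ (λ 0<w → no (<-asym 0<w)) , yes ] (sign (w# l)))
      ... | yes l = l
      ... | no ¬neg = ⊥-elim (<-irrefl (sym (w⊥ (isPoly-≤ (ℕ.≤-trans (ℕ.s≤s ℕ.z≤n) 2k<m) isPoly-one)))
                        (sum-pos (λ l → w l * 1#) (<⇒≤ ∘ positive) l₀ (positive l₀)))
        where
        positive : ∀ l → 0# < w l * 1#
        positive l = <-respʳ-≈ (sym (*-identityʳ _)) (Sum.[ (λ 0<w → 0<w) , (λ w<0 → ⊥-elim (¬neg (l , w<0))) ] (sign (w# l)))
      term-neg : ∀ l → w l < 0# → 0# < - w l * (g (t l) * g (t l))
      term-neg l w<0 = *-pos (neg⇒pos w<0) (square-pos (rooted-# (t ∘ E.f) λ i → t# l (E.f i) λ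
        { ≡.refl → <-asym w<0 (E.into i) }))
      term-nonneg : ∀ l → 0# ≤ - w l * (g (t l) * g (t l))
      term-nonneg l with sign (w# l)
      ... | inj₂ w<0 = <⇒≤ (term-neg l w<0)
      ... | inj₁ 0<w with E.onto l 0<w
      ...   | i , ≡.refl = ≈⇒≤ (sym (trans (*-congˡ (trans (*-congʳ (rooted-zero (t ∘ E.f) i refl)) (zeroˡ _))) (zeroʳ _)))
      absurd : p ℕ.≤ k → (∃ λ l → w l < 0#) → ⊥
      absurd p≤k (l , w<0) = <-irrefl
        (sym (annihilates-neg {w} w⊥ (isPoly-≤ (ℕ.≤-trans (ℕ.s≤s (ℕ.*-monoˡ-≤ 2 p≤k)) 2k<m) (isPoly-rooted² (t ∘ E.f)))))
        (sum-pos (λ l → - w l * (g (t l) * g (t l))) term-nonneg l (term-neg l w<0))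

-- Slacks and faces of the dual polytope

module Slacks {c ℓ₁ ℓ₂} (ℝ : RealNumbers c ℓ₁ ℓ₂) where
  open RealNumbers ℝ hiding (zero)
  open OrderedField ℝ
  open Polynomials ℝ
  open Polytopes ℝ
  open DifferenceSolver commutativeRing
  open SetoidReasoning setoid
  open VectorEquality setoid using (_≋_)

  ·-combine : ∀ {d} (p y z : Point d) u v → p · (λ k → u * y k + v * z k) ≈ u * (p · y) + v * (p · z)
  ·-combine {d} p y z u v = begin
    sum (λ k → p k * (u * y k + v * z k))
      ≈⟨ sum-cong-≋ {d} (λ k → solve 5 (λ p y z u v → p :* (u :* y :+ v :* z) := u :* (p :* y) :+ v :* (p :* z)) refl (p k) (y k) (z k) u v) ⟩
    sum (λ k → u * (p k * y k) + v * (p k * z k))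
      ≈⟨ ∑-distrib-+ (λ k → u * (p k * y k)) (λ k → v * (p k * z k)) ⟩
    sum (λ k → u * (p k * y k)) + sum (λ k → v * (p k * z k))
      ≈⟨ +-cong (*-distribˡ-sum u (λ k → p k * y k)) (*-distribˡ-sum v (λ k → p k * z k)) ⟨
    u * (p · y) + v * (p · z)                                      ∎

  ·-cong : ∀ {d} (p : Point d) {y z : Point d} → y ≋ z → p · y ≈ p · z
  ·-cong {d} p y≋z = sum-cong-≋ {d} (λ k → *-congˡ {p k} (y≋z k))

  module Configuration {d N} (p : Vector (Point d) N) where

    -- Homogenised: points of the dual have `e = 1`, but letting `e` vary makes the slack linear in
    -- `e` and `y` together, so that points can be scaled and subtracted.
    slack : Carrier → Point d → Fin N → Carrier
    slack e y l = e - p l · y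

    slack-combine : ∀ u e y v e′ z l → slack (u * e + v * e′) (λ k → u * y k + v * z k) l ≈ u * slack e y l + v * slack e′ z l
    slack-combine u e y v e′ z l = trans (+-congˡ (-‿cong (·-combine (p l) y z u v)))
      (solve 6 (λ u e v e′ s t → (u :* e :+ v :* e′) :- (u :* s :+ v :* t) := u :* (e :- s) :+ v :* (e′ :- t)) refl u e v e′ (p l · y) (p l · z))

    slack-cong : ∀ {e e′ y z} → e ≈ e′ → y ≋ z → ∀ l → slack e y l ≈ slack e′ z l
    slack-cong e≈e′ y≋z l = +-cong e≈e′ (-‿cong (·-cong (p l) y≋z))

    weighted : Vector Carrier N → Point d
    weighted ν k = sum (λ l → ν l * p l k)

    weighted-· : ∀ ν y → weighted ν · y ≈ sum (λ l → ν l * (p l · y))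
    weighted-· ν y = begin
      sum (λ k → sum (λ l → ν l * p l k) * y k)
        ≈⟨ sum-cong-≋ {d} (λ k → *-distribʳ-sum (y k) (λ l → ν l * p l k)) ⟩
      sum (λ k → sum (λ l → ν l * p l k * y k))       ≈⟨ ∑-comm (λ k l → ν l * p l k * y k) ⟩
      sum (λ l → sum (λ k → ν l * p l k * y k))
        ≈⟨ sum-cong-≋ {N} (λ l → trans (sum-cong-≋ {d} (λ k → *-assoc (ν l) (p l k) (y k))) (sym (*-distribˡ-sum (ν l) (λ k → p l k * y k)))) ⟩
      sum (λ l → ν l * (p l · y))                     ∎

    sum-slack : ∀ ν e y → sum (λ l → ν l * slack e y l) ≈ e * sum ν - weighted ν · y
    sum-slack ν e y = begin
      sum (λ l → ν l * (e - p l · y))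
        ≈⟨ sum-cong-≋ {N} (λ l → solve 3 (λ n e s → n :* (e :- s) := e :* n :- n :* s) refl (ν l) e (p l · y)) ⟩
      sum (λ l → e * ν l - ν l * (p l · y))                   ≈⟨ sum-sub (λ l → e * ν l) (λ l → ν l * (p l · y)) ⟩
      sum (λ l → e * ν l) - sum (λ l → ν l * (p l · y))       ≈⟨ +-cong (*-distribˡ-sum e ν) (-‿cong (weighted-· ν y)) ⟨
      e * sum ν - weighted ν · y                              ∎

  unit : ∀ {n} → Fin n → Vector Carrier n
  unit i j with j ≟ i
  ... | yes _ = 1#
  ... | no _  = 0#

  unit-nonneg : ∀ {n} (i j : Fin n) → 0# ≤ unit i j
  unit-nonneg i j with j ≟ i
  ... | yes _ = <⇒≤ 0<1
  ... | no _  = ≈⇒≤ refl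

  sum-unit : ∀ {n} (i : Fin n) (f : Vector Carrier n) → sum (λ j → unit i j * f j) ≈ f i
  sum-unit i f = trans (sum-single (λ j → unit i j * f j) i off) on
    where
    off : ∀ j → j ≢ i → unit i j * f j ≈ 0#
    off j j≢i with j ≟ i
    ... | yes j≡i = ⊥-elim (j≢i j≡i)
    ... | no _    = zeroˡ _
    on : unit i i * f i ≈ f i
    on with i ≟ i
    ... | yes _  = *-identityˡ _
    ... | no i≢i = ⊥-elim (i≢i ≡.refl)

  module TranslatedHull {d N} (m : Vector (Point d) N) (a : Point d) where

    P Q : PointSet d
    P = translate (convexHull m) a
    Q = dual P

    p : Vector (Point d) N
    p l k = m l k + a k

    open Configuration p public

    weighted-p : ∀ w → sum w ≈ 1# → ∀ k → sum (λ l → w l * m l k) + a k ≈ weighted w k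
    weighted-p w Σw≈1 k = begin
      sum (λ l → w l * m l k) + a k
        ≈⟨ +-congˡ (trans (sym (*-identityˡ _)) (*-congʳ (sym Σw≈1))) ⟩
      sum (λ l → w l * m l k) + sum w * a k                  ≈⟨ +-congˡ (*-distribʳ-sum (a k) w) ⟩
      sum (λ l → w l * m l k) + sum (λ l → w l * a k)        ≈⟨ ∑-distrib-+ (λ l → w l * m l k) (λ l → w l * a k) ⟨
      sum (λ l → w l * m l k + w l * a k)
        ≈⟨ sum-cong-≋ {N} (λ l → sym (distribˡ (w l) (m l k) (a k))) ⟩
      weighted w k                                           ∎

    P⇒weighted : ∀ {x} → x ∈ P → ∃ λ w → (∀ l → 0# ≤ w l) × sum w ≈ 1# × x ≋ weighted w
    P⇒weighted {x} (w , 0≤w , Σw≈1 , x≈) = w , 0≤w , Σw≈1 , λ k → begin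
      x k                              ≈⟨ solve 2 (λ x a → x := (x :- a) :+ a) refl (x k) (a k) ⟩
      (x k - a k) + a k                ≈⟨ +-congʳ (x≈ k) ⟩
      sum (λ l → w l * m l k) + a k    ≈⟨ weighted-p w Σw≈1 k ⟩
      weighted w k                     ∎

    p∈P : ∀ l → p l ∈ P
    p∈P l = unit l , unit-nonneg l ,
      trans (sum-cong-≋ {N} (λ j → sym (*-identityʳ (unit l j)))) (sum-unit l (λ _ → 1#)) ,
      λ k → trans (solve 2 (λ m a → (m :+ a) :- a := m) refl (m l k) (a k)) (sym (sum-unit l (λ j → m j k)))

    Q⇒slack : ∀ {y} → y ∈ Q → ∀ l → 0# ≤ slack 1# y l
    Q⇒slack y∈Q l = ≤⇒nonneg (y∈Q (p l) (p∈P l))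

    -- For `x` in `P`, the number `1 - x · y` is a convex combination of the slacks of `y`.
    slack⇒Q : ∀ {y} → (∀ l → 0# ≤ slack 1# y l) → y ∈ Q
    slack⇒Q {y} 0≤ x x∈P with P⇒weighted x∈P
    ... | w , 0≤w , Σw≈1 , x≋ = nonneg⇒≤ (≤-respʳ (begin
        sum (λ l → w l * slack 1# y l)   ≈⟨ sum-slack w 1# y ⟩
        1# * sum w - weighted w · y
          ≈⟨ +-cong (trans (*-identityˡ _) Σw≈1) (-‿cong (sum-cong-≋ {d} (λ k → *-congʳ {y k} (sym (x≋ k))))) ⟩
        1# - x · y                       ∎)
      (sum-nonneg (λ l → w l * slack 1# y l) λ l → *-nonneg (0≤w l) (0≤ l)))

    -- The functional is the sum of all p l with l outside S.
    isFace : ∀ {ℓ} {F : Pred (Point d) ℓ} {S : Fin N → Set} → (∀ l → Dec (S l)) →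
             (∀ {x} → x ∈ F → x ∈ Q × (∀ l → ¬ S l → slack 1# x l ≈ 0#)) →
             (∀ {x} → x ∈ Q → (∀ l → ¬ S l → slack 1# x l ≈ 0#) → x ∈ F) →
             IsFace Q F
    isFace {F = F} {S} S? F⇒ ⇒F = weighted χ , sum χ ,
      (λ x x∈Q → nonneg⇒≤ (≤-respʳ (gap x) (sum-nonneg (λ l → χ l * slack 1# x l) (terms x∈Q)))) ,
      (λ {x} x∈F → proj₁ (F⇒ x∈F) , sym (x-y≈0⇒x≈y (trans (sym (gap x)) (sum-zero (λ l → χ l * slack 1# _ l) (vanish x (proj₂ (F⇒ x∈F))))))) ,
      (λ { {x} (x∈Q , tight-x) → ⇒F x∈Q (λ l l∉S → vanished x l l∉S
        (sum-nonneg-zero (λ l → χ l * slack 1# x l) (terms x∈Q) (trans (gap x) (trans (+-congˡ (-‿cong tight-x)) (-‿inverseʳ _))) l)) })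
      where
      χ : Vector Carrier N
      χ l with S? l
      ... | yes _ = 0#
      ... | no _  = 1#
      gap : ∀ x → sum (λ l → χ l * slack 1# x l) ≈ sum χ - weighted χ · x
      gap x = trans (sum-slack χ 1# x) (+-congʳ (*-identityˡ _))
      terms : ∀ {x} → x ∈ Q → ∀ l → 0# ≤ χ l * slack 1# x l
      terms x∈Q l with S? l
      ... | yes _ = ≈⇒≤ (sym (zeroˡ _))
      ... | no _  = ≤-respʳ (sym (*-identityˡ _)) (Q⇒slack x∈Q l)
      vanish : ∀ x → (∀ l → ¬ S l → slack 1# x l ≈ 0#) → ∀ l → χ l * slack 1# x l ≈ 0#
      vanish x zeros l with S? l
      ... | yes _  = zeroˡ _
      ... | no l∉S = trans (*-congˡ (zeros l l∉S)) (zeroʳ _)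
      vanished : ∀ x l → ¬ S l → χ l * slack 1# x l ≈ 0# → slack 1# x l ≈ 0#
      vanished x l l∉S e with S? l
      ... | yes l∈S = ⊥-elim (l∉S l∈S)
      ... | no _    = trans (sym (*-identityˡ _)) e

    -- A small multiple −δ · Σ p l of the sum of the points is still in P; moving it to the
    -- other side makes all coefficients positive.
    positive-dependence : origin ∈ Interior P → ∃ λ (μ : Vector Carrier N) → (∀ l → 0# < μ l) × (∀ k → weighted μ k ≈ 0#)
    positive-dependence (ε , 0<ε , box) = μ , 0<μ , λ k → begin
      sum (λ l → (w l + δ) * p l k)
        ≈⟨ sum-cong-≋ {N} (λ l → solve 3 (λ w d p → (w :+ d) :* p := w :* p :+ d :* p) refl (w l) δ (p l k)) ⟩
      sum (λ l → w l * p l k + δ * p l k)                     ≈⟨ ∑-distrib-+ (λ l → w l * p l k) (λ l → δ * p l k) ⟩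
      weighted w k + sum (λ l → δ * p l k)
        ≈⟨ +-cong (sym (y≋ k)) (sym (*-distribˡ-sum δ (λ l → p l k))) ⟩
      - (δ * S k) + δ * S k                                   ≈⟨ -‿inverseˡ _ ⟩
      0#                                                      ∎
      where
      S : Point d
      S k = sum (λ l → p l k)
      ub = upper-bound S
      M = proj₁ ub
      r = recip-pos (proj₁ (proj₂ ub))
      -- Since `M` exceeds every `S k` and every `- S k`, this choice `ε / M` puts `- (δ * S k)`
      -- strictly between `- ε` and `ε`.
      δ = ε * proj₁ r
      0<δ : 0# < δ
      0<δ = *-pos 0<ε (proj₁ (proj₂ r))
      δM≈ε : δ * M ≈ ε
      δM≈ε = begin
        ε * proj₁ r * M      ≈⟨ solve 3 (λ e r m → e :* r :* m := e :* (m :* r)) refl ε (proj₁ r) M ⟩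
        ε * (M * proj₁ r)    ≈⟨ *-congˡ (proj₂ (proj₂ r)) ⟩
        ε * 1#               ≈⟨ *-identityʳ ε ⟩
        ε                    ∎
      y : Point d
      y k = - (δ * S k)
      y∈box : ∀ k → 0# < y k + ε × y k < 0# + ε
      y∈box k =
        <-respʳ-≈ (trans (solve 3 (λ d m s → d :* (m :- s) := (:- (d :* s)) :+ d :* m) refl δ M (S k)) (+-congˡ δM≈ε))
          (*-pos 0<δ (<⇒pos (proj₁ (proj₂ (proj₂ ub)) k))) ,
        pos⇒< (<-respʳ-≈ (trans (solve 3 (λ d m s → d :* (m :- (:- s)) := (con (0 , 0) :+ d :* m) :- (:- (d :* s))) refl δ M (S k)) (+-congʳ (+-congˡ δM≈ε)))
          (*-pos 0<δ (<⇒pos (proj₂ (proj₂ (proj₂ ub)) k))))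
      hull = P⇒weighted (box y y∈box)
      w = proj₁ hull
      y≋ : y ≋ weighted w
      y≋ = proj₂ (proj₂ (proj₂ hull))
      μ : Vector Carrier N
      μ l = w l + δ
      0<μ : ∀ l → 0# < μ l
      0<μ l = +-pos (proj₁ (proj₂ hull) l) 0<δ

-- Vertices and edges of the dual from index pairs of opposite sign

module Gale {c ℓ₁ ℓ₂} (ℝ : RealNumbers c ℓ₁ ℓ₂) where
  open RealNumbers ℝ hiding (zero)
  open OrderedField ℝ
  open Polynomials ℝ
  open Slacks ℝ
  open Polytopes ℝ
  open DifferenceSolver commutativeRing
  open SetoidReasoning setoid
  open VectorEquality setoid using (_≋_)

  module Dependent {d} (t : Vector Carrier (suc (suc d))) (t# : Apart t) (a : Point d)
    (μ : Vector Carrier (suc (suc d))) (0<μ : ∀ l → 0# < μ l)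
    (Σμp≈0 : ∀ k → TranslatedHull.weighted (λ l → momentCurve d (t l)) a μ k ≈ 0#)
    (w : Vector Carrier (suc (suc d))) (w# : ∀ l → w l # 0#) (w⊥ : Annihilates (suc d) t w) where

    open TranslatedHull (λ l → momentCurve d (t l)) a

    N : ℕ
    N = suc (suc d)

    coefficients : Carrier → Point d → Vector Carrier (suc d)
    coefficients e y zero    = e - a · y
    coefficients e y (suc k) = - y k

    -- The only use of the moment curve: all slacks of `(e, y)` are values of one polynomial of
    -- degree at most `d`, so `w` becomes a relation among slacks.
    slack-poly : ∀ e y l → slack e y l ≈ eval (coefficients e y) (t l)
    slack-poly e y l = begin
      e - sum (λ k → (x ^ suc (toℕ k) + a k) * y k)
        ≈⟨ +-congˡ (-‿cong (trans (sum-cong-≋ {d} (λ k → distribʳ (y k) _ _)) (∑-distrib-+ (λ k → x ^ suc (toℕ k) * y k) (λ k → a k * y k)))) ⟩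
      e - (sum (λ k → x ^ suc (toℕ k) * y k) + a · y)
        ≈⟨ +-congˡ (-‿cong (+-congʳ (trans (sum-cong-≋ {d} (λ k → *-assoc x (x ^ toℕ k) (y k))) (sym (*-distribˡ-sum x (λ k → x ^ toℕ k * y k)))))) ⟩
      e - (x * s + a · y)
        ≈⟨ solve 4 (λ e x s b → e :- (x :* s :+ b) := (e :- b) :+ x :* (:- s)) refl e x s (a · y) ⟩
      (e - a · y) + x * - s
        ≈⟨ +-congˡ (*-congˡ (sym (trans (eval-sum (λ k → - y k) x) (trans (sum-cong-≋ {d} (λ k → solve 2 (λ p y → p :* (:- y) := :- (p :* y)) refl (x ^ toℕ k) (y k))) (sum-neg (λ k → x ^ toℕ k * y k)))))) ⟩
      (e - a · y) + x * eval (λ k → - y k) x                      ∎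
      where
      x = t l
      s = sum (λ k → x ^ toℕ k * y k)

    0<Σμ : 0# < sum μ
    0<Σμ = sum-pos μ (<⇒≤ ∘ 0<μ) zero (0<μ zero)

    -- The weights `μ` balance the points around the origin, so the part with `y` drops out and the
    -- relation measures `e` alone.
    μ-slack : ∀ e y → sum (λ l → μ l * slack e y l) ≈ e * sum μ
    μ-slack e y = begin
      sum (λ l → μ l * slack e y l)   ≈⟨ sum-slack μ e y ⟩
      e * sum μ - weighted μ · y
        ≈⟨ +-congˡ (-‿cong (sum-zero (λ k → weighted μ k * y k) λ k → trans (*-congʳ (Σμp≈0 k)) (zeroˡ _))) ⟩
      e * sum μ - 0#                  ≈⟨ x-0≈x _ ⟩
      e * sum μ                       ∎

    w-slack : ∀ e y → sum (λ l → w l * slack e y l) ≈ 0#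
    w-slack e y = trans (sum-cong-≋ {N} (λ l → *-congˡ {w l} (slack-poly e y l))) (w⊥ (coefficients e y , λ _ → refl))

    -- By the relation w, one more slack vanishes; by the relation μ, so does e.
    slacks-determine : ∀ {e y} i → (∀ l → l ≢ i → slack e y l ≈ 0#) → e ≈ 0# × (∀ k → y k ≈ 0#)
    slacks-determine {e} {y} i off = e≈0 , λ k → begin
        y k                          ≈⟨ solve 1 (λ y → y := :- (:- y)) refl (y k) ⟩
        - (- y k)
          ≈⟨ -‿cong (vanishing (t ∘ suc) (λ i j i≢j → t# (suc i) (suc j) (i≢j ∘ Fin.suc-injective)) (coefficients e y) (λ l → trans (sym (slack-poly e y (suc l))) (all (suc l))) (suc k)) ⟩
        - 0#                         ≈⟨ solve 0 (:- con (0 , 0) := con (0 , 0)) refl ⟩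
        0#                           ∎
      where
      on : slack e y i ≈ 0#
      on = *-cancel-0 (w# i) (trans (sym (sum-single (λ l → w l * slack e y l) i λ l l≢i → trans (*-congˡ (off l l≢i)) (zeroʳ _))) (w-slack e y))
      all : ∀ l → slack e y l ≈ 0#
      all l with l ≟ i
      ... | yes ≡.refl = on
      ... | no l≢i     = off l l≢i
      e≈0 : e ≈ 0#
      e≈0 = *-cancel-0 (pos⇒# 0<Σμ) (trans (*-comm _ _) (trans (sym (μ-slack e y))
        (sum-zero (λ l → μ l * slack e y l) λ l → trans (*-congˡ (all l)) (zeroʳ _))))

    -- The signs of `w` are left out to keep `i` and `j` symmetric: by `flip`, one argument yields
    -- the edges along rows and along columns.
    record Corner (i j : Fin N) : Set (c Level.⊔ ℓ₁ Level.⊔ ℓ₂) where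
      field
        point   : Point d
        inside  : point ∈ Q
        vanish  : ∀ l → l ≢ i → l ≢ j → slack 1# point l ≈ 0#
        pos-i   : 0# < slack 1# point i
        pos-j   : 0# < slack 1# point j

    flip : ∀ {i j} → Corner i j → Corner j i
    flip V = record
      { point = V.point ; inside = V.inside ; vanish = λ l l≢j l≢i → V.vanish l l≢i l≢j
      ; pos-i = V.pos-j ; pos-j = V.pos-i }
      where module V = Corner V

    module _ {i j} (0<wi : 0# < w i) (0<-wj : 0# < - w j) where

      i≢j : i ≢ j
      i≢j ≡.refl = <-asym 0<wi (<-respˡ-≈ (solve 1 (λ x → :- (:- x) := x) refl (w i)) (pos⇒neg 0<-wj))

      rest : Embed d N (λ l → l ≢ i × l ≢ j)
      rest = skip₂ i j i≢j

      others : Vector Carrier d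
      others = t ∘ Embed.f rest

      others-zero : ∀ l → l ≢ i → l ≢ j → rooted others (t l) ≈ 0#
      others-zero l l≢i l≢j = let k , e = Embed.onto rest l (l≢i , l≢j) in
        rooted-zero others k (reflexive (≡.cong t (≡.sym e)))

      -- Only `i` and `j` contribute to the relation `w`, and with opposite signs, so positivity
      -- passes from `t i` to `t j`. The relation `μ` then makes `e` positive, and dividing by `e`
      -- gives a point of the dual.
      normalised : ∀ {q : Vector Carrier (suc d)} → (∀ l → l ≢ i → l ≢ j → eval q (t l) ≈ 0#) → 0# < eval q (t i) → Corner i j
      normalised {q} zeros 0<qi = record
        { point  = λ k → r * y k
        ; inside = slack⇒Q nonneg
        ; vanish = λ l l≢i l≢j → trans (scaled l) (trans (*-congˡ (zeros l l≢i l≢j)) (zeroʳ r))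
        ; pos-i  = <-respʳ-≈ (sym (scaled i)) (*-pos 0<r 0<qi)
        ; pos-j  = <-respʳ-≈ (sym (scaled j)) (*-pos 0<r 0<qj)
        }
        where
        y : Point d
        y k = - q (suc k)
        e = q zero + a · y
        slack≈ : ∀ l → slack e y l ≈ eval q (t l)
        slack≈ l = trans (slack-poly e y l) (eval-cong {q = coefficients e y} {q} λ
          { zero    → solve 2 (λ q b → (q :+ b) :- b := q) refl (q zero) (a · y)
          ; (suc k) → solve 1 (λ q → :- (:- q) := q) refl (q (suc k)) })
          where
          eval-cong : ∀ {m} {q q′ : Vector Carrier m} {x} → (∀ k → q k ≈ q′ k) → eval q x ≈ eval q′ x
          eval-cong {zero}  _ = refl
          eval-cong {suc m} h = +-cong (h zero) (*-congˡ (eval-cong (h ∘ suc)))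
        0<qj : 0# < eval q (t j)
        0<qj = *-cancelˡ-pos 0<-wj (<-respʳ-≈ (begin
          w i * eval q (t i)
            ≈⟨ solve 3 (λ x y z → x := (x :+ y :* z) :+ (:- y) :* z) refl _ (w j) (eval q (t j)) ⟩
          (w i * eval q (t i) + w j * eval q (t j)) + - w j * eval q (t j)
            ≈⟨ +-congʳ (sum-pair (λ l → w l * eval q (t l)) i≢j λ l l≢i l≢j → trans (*-congˡ (zeros l l≢i l≢j)) (zeroʳ _)) ⟨
          sum (λ l → w l * eval q (t l)) + - w j * eval q (t j) ≈⟨ +-congʳ (w⊥ (q , λ _ → refl)) ⟩
          0# + - w j * eval q (t j)                          ≈⟨ +-identityˡ _ ⟩
          - w j * eval q (t j)                               ∎) (*-pos 0<wi 0<qi))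
        slack-nonneg : ∀ l → 0# ≤ slack e y l
        slack-nonneg l = ≤-respʳ (sym (slack≈ l)) (value-nonneg l)
          where
          value-nonneg : ∀ l → 0# ≤ eval q (t l)
          value-nonneg l with l ≟ i | l ≟ j
          ... | yes ≡.refl | _          = <⇒≤ 0<qi
          ... | no _       | yes ≡.refl = <⇒≤ 0<qj
          ... | no l≢i     | no l≢j     = ≈⇒≤ (sym (zeros l l≢i l≢j))
        0<e : 0# < e
        0<e = *-cancelˡ-pos 0<Σμ (<-respʳ-≈ (trans (μ-slack e y) (*-comm _ _))
          (sum-pos (λ l → μ l * slack e y l) (λ l → *-nonneg (<⇒≤ (0<μ l)) (slack-nonneg l)) i
            (*-pos (0<μ i) (<-respʳ-≈ (sym (slack≈ i)) 0<qi))))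
        r = proj₁ (recip-pos 0<e)
        0<r : 0# < r
        0<r = proj₁ (proj₂ (recip-pos 0<e))
        scaled : ∀ l → slack 1# (λ k → r * y k) l ≈ r * eval q (t l)
        scaled l = begin
          slack 1# (λ k → r * y k) l
            -- Scaling is written as a combination whose second coefficient is zero, to match
            -- `slack-combine`.
            ≈⟨ slack-cong (trans (sym (proj₂ (proj₂ (recip-pos 0<e)))) (solve 2 (λ e r → e :* r := r :* e :+ con (0 , 0) :* e) refl e r)) (λ k → solve 2 (λ r y → r :* y := r :* y :+ con (0 , 0) :* y) refl r (y k)) l ⟩
          slack (r * e + 0# * e) (λ k → r * y k + 0# * y k) l             ≈⟨ slack-combine r e y 0# e y l ⟩
          r * slack e y l + 0# * slack e y l
            ≈⟨ solve 2 (λ r s → r :* s :+ con (0 , 0) :* s := r :* s) refl r (slack e y l) ⟩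
          r * slack e y l                                                 ≈⟨ *-congˡ (slack≈ l) ⟩
          r * eval q (t l)                                                ∎
        nonneg : ∀ l → 0# ≤ slack 1# (λ k → r * y k) l
        nonneg l = ≤-respʳ (trans (*-congˡ (slack≈ l)) (sym (scaled l))) (*-nonneg (<⇒≤ 0<r) (slack-nonneg l))

      -- The polynomial with the other `d` parameters as roots has an unknown sign at `t i`; it is
      -- negated if necessary.
      corner : Corner i j
      corner with isPoly-rooted others
      ... | q , f≈q with sign (#-resp (f≈q (t i)) (rooted-# others λ k → t# i _ (proj₁ (Embed.into rest k) ∘ ≡.sym)))
      ...   | inj₁ 0<qi = normalised {q} (λ l l≢i l≢j → trans (sym (f≈q _)) (others-zero l l≢i l≢j)) 0<qi
      ...   | inj₂ qi<0 = normalised {λ k → - q k}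
                (λ l l≢i l≢j → trans (eval-neg q (t l)) (trans (-‿cong (trans (sym (f≈q _)) (others-zero l l≢i l≢j))) (solve 0 (:- con (0 , 0) := con (0 , 0)) refl)))
                (<-respʳ-≈ (sym (eval-neg q (t i))) (neg⇒pos qi<0))
        where
        eval-neg : ∀ {m} (q : Vector Carrier m) x → eval (λ k → - q k) x ≈ - eval q x
        eval-neg {zero}  q x = solve 0 (con (0 , 0) := :- con (0 , 0)) refl
        eval-neg {suc m} q x = trans (+-congˡ (*-congˡ (eval-neg (q ∘ suc) x)))
          (solve 3 (λ q x e → (:- q) :+ x :* (:- e) := :- (q :+ x :* e)) refl (q zero) x (eval (q ∘ suc) x))

    module _ {i j} (V : Corner i j) where
      private module V = Corner V

      -- Subtract the multiple `u` of the corner that cancels the slack of `x` at `j`. Only the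
      -- slack at `i` is left, so by `slacks-determine` the difference is zero and `u` is 1.
      corner-unique : ∀ {x} → (∀ l → l ≢ i → l ≢ j → slack 1# x l ≈ 0#) → x ≋ V.point
      corner-unique {x} zeros k = begin
        x k
          ≈⟨ solve 3 (λ x u v → x := (con (1 , 0) :* x :+ (:- u) :* v) :+ u :* v) refl (x k) u (V.point k) ⟩
        (1# * x k + - u * V.point k) + u * V.point k ≈⟨ +-cong (proj₂ both k) (*-congʳ u≈1) ⟩
        0# + 1# * V.point k             ≈⟨ solve 1 (λ v → con (0 , 0) :+ con (1 , 0) :* v := v) refl (V.point k) ⟩
        V.point k                       ∎
        where
        r = recip (pos⇒# V.pos-j)
        u = slack 1# x j * proj₁ r
        off : ∀ l → l ≢ i → slack (1# * 1# + - u * 1#) (λ k → 1# * x k + - u * V.point k) l ≈ 0#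
        off l l≢i = trans (slack-combine 1# 1# x (- u) 1# V.point l) (off′ (l ≟ j))
          where
          off′ : Dec (l ≡ j) → 1# * slack 1# x l + - u * slack 1# V.point l ≈ 0#
          off′ (no l≢j) = trans (+-cong (*-congˡ (zeros l l≢i l≢j)) (*-congˡ (V.vanish l l≢i l≢j)))
            (solve 1 (λ u → con (1 , 0) :* con (0 , 0) :+ u :* con (0 , 0) := con (0 , 0)) refl (- u))
          off′ (yes ≡.refl) = begin
            1# * s + - (s * proj₁ r) * slack 1# V.point j
              ≈⟨ solve 3 (λ s r v → con (1 , 0) :* s :+ (:- (s :* r)) :* v := s :+ (:- (s :* (v :* r)))) refl s (proj₁ r) (slack 1# V.point j) ⟩
            s + - (s * (slack 1# V.point j * proj₁ r))
              ≈⟨ +-congˡ (-‿cong (trans (*-congˡ (proj₂ r)) (*-identityʳ s))) ⟩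
            s + - s                                     ≈⟨ -‿inverseʳ s ⟩
            0#                                          ∎
            where s = slack 1# x j
        both = slacks-determine {1# * 1# + - u * 1#} {λ k → 1# * x k + - u * V.point k} i off
        u≈1 : u ≈ 1#
        u≈1 = sym (x-y≈0⇒x≈y (trans (solve 1 (λ u → con (1 , 0) :- u := con (1 , 0) :* con (1 , 0) :+ (:- u) :* con (1 , 0)) refl u) (proj₁ both)))

      corner-isVertex : IsVertex Q V.point
      corner-isVertex = isFace {F = _≋ V.point} {S = λ l → l ≡ i ⊎ l ≡ j} (λ l → (l ≟ i) ⊎-dec (l ≟ j))
        (λ {x} x≋V → slack⇒Q (λ l → ≤-respʳ (slack-cong refl (sym ∘ x≋V) l) (Q⇒slack V.inside l)) ,
               λ l l∉ → trans (slack-cong refl x≋V l) (V.vanish l (l∉ ∘ inj₁) (l∉ ∘ inj₂)))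
        (λ x∈Q zeros → corner-unique λ l l≢i l≢j → zeros l Sum.[ l≢i , l≢j ])

    module _ {i j j′} (V : Corner i j) (W : Corner i j′) (i≢j : i ≢ j) (i≢j′ : i ≢ j′) (j≢j′ : j ≢ j′) where
      private
        module V = Corner V
        module W = Corner W

      segment-slack : ∀ {x} ((u , _) : x ∈ segment V.point W.point) l →
                      slack 1# x l ≈ u zero * slack 1# V.point l + u (suc zero) * slack 1# W.point l
      segment-slack {x} (u , 0≤u , Σu≈1 , x≈) l = begin
        slack 1# x l
          ≈⟨ slack-cong (trans (sym Σu≈1) (solve 2 (λ u v → u :+ (v :+ con (0 , 0)) := u :* con (1 , 0) :+ v :* con (1 , 0)) refl (u zero) (u (suc zero)))) (λ k → trans (x≈ k) (+-congˡ (+-identityʳ _))) l ⟩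
        slack (u zero * 1# + u (suc zero) * 1#) (λ k → u zero * V.point k + u (suc zero) * W.point k) l
          ≈⟨ slack-combine (u zero) 1# V.point (u (suc zero)) 1# W.point l ⟩
        u zero * slack 1# V.point l + u (suc zero) * slack 1# W.point l        ∎

      -- The slack at `j` comes from `V` alone and that at `j′` from `W` alone, so the slacks of `x`
      -- there dictate both coefficients. After subtraction only the slack at `i` is left, and
      -- `slacks-determine` also shows that the coefficients sum to 1.
      segment-complete : ∀ {x} → x ∈ Q → (∀ l → l ≢ i → l ≢ j → l ≢ j′ → slack 1# x l ≈ 0#) → x ∈ segment V.point W.point
      segment-complete {x} x∈Q zeros =
        (λ { zero → u ; (suc zero) → v }) ,
        (λ { zero → *-nonneg (Q⇒slack x∈Q j) (<⇒≤ (proj₁ (proj₂ r))) ; (suc zero) → *-nonneg (Q⇒slack x∈Q j′) (<⇒≤ (proj₁ (proj₂ r′))) }) ,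
        sym (x-y≈0⇒x≈y (trans (solve 2 (λ u v → con (1 , 0) :- (u :+ (v :+ con (0 , 0))) := con (1 , 0) :* (con (1 , 0) :* con (1 , 0) :+ (:- u) :* con (1 , 0)) :+ (:- v) :* con (1 , 0)) refl u v) (proj₁ both))) ,
        λ k → x-y≈0⇒x≈y (trans (solve 5 (λ x u y v z → x :- (u :* y :+ (v :* z :+ con (0 , 0))) := con (1 , 0) :* (con (1 , 0) :* x :+ (:- u) :* y) :+ (:- v) :* z) refl (x k) u (V.point k) v (W.point k)) (proj₂ both k))
        where
        r  = recip-pos V.pos-j
        r′ = recip-pos W.pos-j
        u  = slack 1# x j * proj₁ r
        v  = slack 1# x j′ * proj₁ r′
        e₁ = 1# * 1# + - u * 1#
        y₁ : Point d
        y₁ k = 1# * x k + - u * V.point k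
        term : ∀ {s q} → s * q ≈ 1# → ∀ x → x + - (x * q) * s ≈ 0#
        term {s} {q} sq≈1 x = begin
          x + - (x * q) * s   ≈⟨ solve 3 (λ x q s → x :+ (:- (x :* q)) :* s := x :- x :* (s :* q)) refl x q s ⟩
          x - x * (s * q)     ≈⟨ +-congˡ (-‿cong (trans (*-congˡ sq≈1) (*-identityʳ x))) ⟩
          x - x               ≈⟨ -‿inverseʳ x ⟩
          0#                  ∎
        off : ∀ l → l ≢ i → slack (1# * e₁ + - v * 1#) (λ k → 1# * y₁ k + - v * W.point k) l ≈ 0#
        off l l≢i = begin
          slack (1# * e₁ + - v * 1#) (λ k → 1# * y₁ k + - v * W.point k) l
            ≈⟨ slack-combine 1# e₁ y₁ (- v) 1# W.point l ⟩
          1# * slack e₁ y₁ l + - v * slack 1# W.point l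
            ≈⟨ +-congʳ (*-congˡ (slack-combine 1# 1# x (- u) 1# V.point l)) ⟩
          1# * (1# * slack 1# x l + - u * slack 1# V.point l) + - v * slack 1# W.point l
            ≈⟨ +-congʳ (trans (*-identityˡ _) (+-congʳ (*-identityˡ _))) ⟩
          (slack 1# x l + - u * slack 1# V.point l) + - v * slack 1# W.point l ≈⟨ off′ (l ≟ j) (l ≟ j′) ⟩
          0#                                                                ∎
          where
          off′ : Dec (l ≡ j) → Dec (l ≡ j′) → (slack 1# x l + - u * slack 1# V.point l) + - v * slack 1# W.point l ≈ 0#
          off′ (yes ≡.refl) (yes j≡j′)   = ⊥-elim (j≢j′ j≡j′)
          off′ (yes ≡.refl) (no _)       = trans (+-cong (term (proj₂ (proj₂ r)) (slack 1# x j)) (trans (*-congˡ (W.vanish l l≢i j≢j′)) (zeroʳ _))) (+-identityˡ _)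
          off′ (no l≢j)     (yes ≡.refl) = trans (+-congʳ (trans (+-congˡ (trans (*-congˡ (V.vanish l l≢i l≢j)) (zeroʳ _))) (+-identityʳ _))) (term (proj₂ (proj₂ r′)) (slack 1# x j′))
          off′ (no l≢j)     (no l≢j′)    = trans (+-cong (+-cong (zeros l l≢i l≢j l≢j′) (*-congˡ (V.vanish l l≢i l≢j))) (*-congˡ (W.vanish l l≢i l≢j′)))
            (solve 2 (λ u v → (con (0 , 0) :+ u :* con (0 , 0)) :+ v :* con (0 , 0) := con (0 , 0)) refl (- u) (- v))
        both = slacks-determine {1# * e₁ + - v * 1#} {λ k → 1# * y₁ k + - v * W.point k} i off

      corners-isEdge : IsEdge Q V.point W.point
      corners-isEdge =
        (λ V≋W → <-irrefl (sym (trans (slack-cong refl V≋W j) (W.vanish j (i≢j ∘ ≡.sym) j≢j′))) V.pos-j) ,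
        isFace {F = segment V.point W.point} {S = λ l → l ≡ i ⊎ l ≡ j ⊎ l ≡ j′} (λ l → (l ≟ i) ⊎-dec ((l ≟ j) ⊎-dec (l ≟ j′)))
          (λ {x} x∈seg →
            slack⇒Q (λ l → ≤-respʳ (sym (segment-slack x∈seg l))
              (+-nonneg (*-nonneg (proj₁ (proj₂ x∈seg) zero) (Q⇒slack V.inside l)) (*-nonneg (proj₁ (proj₂ x∈seg) (suc zero)) (Q⇒slack W.inside l)))) ,
            λ l l∉ → trans (segment-slack x∈seg l)
              (trans (+-cong (*-congˡ (V.vanish l (l∉ ∘ inj₁) (l∉ ∘ inj₂ ∘ inj₁))) (*-congˡ (W.vanish l (l∉ ∘ inj₁) (l∉ ∘ inj₂ ∘ inj₂))))
                (trans (+-cong (zeroʳ _) (zeroʳ _)) (+-identityˡ _))))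
          (λ x∈Q zeros → segment-complete x∈Q λ l l≢i l≢j l≢j′ → zeros l Sum.[ l≢i , Sum.[ l≢j , l≢j′ ] ])

    -- If the slacks of a vertex v at i and j are positive, v can be moved away from the corner
    -- V within Q, so a functional which is maximal on Q only at v is maximal at V too.
    module _ {v i j} (V : Corner i j) (v∈Q : v ∈ Q) {θ} (0<θ : 0# < θ)
             (0<A : 0# < slack 1# v i) (0<B : 0# < slack 1# v j)
             (θC≤A : θ * slack 1# (Corner.point V) i ≤ slack 1# v i)
             (θD≤B : θ * slack 1# (Corner.point V) j ≤ slack 1# v j) where
      private module V = Corner V

      away : Point d
      away k = (1# + θ) * v k + - θ * V.point k
      away-slack : ∀ l → slack 1# away l ≈ (1# + θ) * slack 1# v l + - θ * slack 1# V.point l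
      away-slack l = trans (slack-cong (solve 1 (λ t → con (1 , 0) := (con (1 , 0) :+ t) :* con (1 , 0) :+ (:- t) :* con (1 , 0)) refl θ) (λ _ → refl) l)
        (slack-combine (1# + θ) 1# v (- θ) 1# V.point l)
      0≤1+θ : 0# ≤ 1# + θ
      0≤1+θ = +-nonneg (<⇒≤ 0<1) (<⇒≤ 0<θ)
      push : ∀ {s u} → 0# < s → θ * u ≤ s → 0# ≤ (1# + θ) * s + - θ * u
      push {s} {u} 0<s θu≤s =
        ≤-respʳ (solve 3 (λ s t u → (s :- t :* u) :+ t :* s := (con (1 , 0) :+ t) :* s :+ (:- t) :* u) refl s θ u)
          (+-nonneg (≤⇒nonneg θu≤s) (<⇒≤ (*-pos 0<θ 0<s)))
      nonneg : ∀ l → Dec (l ≡ i) → Dec (l ≡ j) → 0# ≤ (1# + θ) * slack 1# v l + - θ * slack 1# V.point l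
      nonneg l (yes ≡.refl) _ = push 0<A θC≤A
      nonneg l (no _) (yes ≡.refl) = push 0<B θD≤B
      nonneg l (no l≢i) (no l≢j) = ≤-respʳ (begin
          (1# + θ) * slack 1# v l             ≈⟨ +-identityʳ _ ⟨
          (1# + θ) * slack 1# v l + 0#        ≈⟨ +-congˡ (trans (*-congˡ (V.vanish l l≢i l≢j)) (zeroʳ (- θ))) ⟨
          (1# + θ) * slack 1# v l + - θ * slack 1# V.point l ∎)
        (*-nonneg 0≤1+θ (Q⇒slack v∈Q l))
      away∈Q : away ∈ Q
      away∈Q = slack⇒Q λ l → ≤-respʳ (sym (away-slack l)) (nonneg l (l ≟ i) (l ≟ j))
    vertex-is-corner : ∀ {v i j} → IsVertex Q v → 0# < slack 1# v i → 0# < slack 1# v j → (V : Corner i j) → v ≋ Corner.point V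
    vertex-is-corner {v} {i} {j} (α , β , valid , F⊆ , ⊆F) 0<A 0<B V =
      sym ∘ ⊆F (V.inside , maximal (common-lower-bound (proj₁ (proj₂ θ₁)) (proj₁ (proj₂ θ₂))))
      where
      module V = Corner V
      v∈Q : v ∈ Q
      v∈Q = proj₁ (F⊆ (λ _ → refl))
      θ₁ = small-multiple 0<A V.pos-i
      θ₂ = small-multiple 0<B V.pos-j
      -- If the functional falls short of `β` at `V`, it exceeds `β` at the moved point by `θ` times
      -- that amount.
      gap : ∀ θ → β - α · (λ k → (1# + θ) * v k + - θ * V.point k) ≈ - (θ * (β - α · V.point))
      gap θ = begin
        β - α · (λ k → (1# + θ) * v k + - θ * V.point k)   ≈⟨ +-congˡ (-‿cong (·-combine α v V.point (1# + θ) (- θ))) ⟩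
        β - ((1# + θ) * (α · v) + - θ * (α · V.point))
          ≈⟨ +-congˡ (-‿cong (+-congʳ (*-congˡ (proj₂ (F⊆ (λ _ → refl)))))) ⟩
        β - ((1# + θ) * β + - θ * (α · V.point))
          ≈⟨ solve 3 (λ b t s → b :- ((con (1 , 0) :+ t) :* b :+ (:- t) :* s) := :- (t :* (b :- s))) refl β θ (α · V.point) ⟩
        - (θ * (β - α · V.point))                          ∎
      maximal : (∃ λ θ → 0# < θ × θ ≤ proj₁ θ₁ × θ ≤ proj₁ θ₂) → α · V.point ≈ β
      maximal (θ , 0<θ , θ≤θ₁ , θ≤θ₂) = ≤-antisym (valid V.point V.inside) λ αV<β →
        ≤⇒nonneg (valid _ (away∈Q V v∈Q 0<θ 0<A 0<B (proj₂ (proj₂ θ₁) θ≤θ₁) (proj₂ (proj₂ θ₂) θ≤θ₂)))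
          (<-respˡ-≈ (sym (gap θ)) (pos⇒neg (*-pos 0<θ (<⇒pos αV<β))))

    -- A positive term in a vanishing sum forces a negative one, and as slacks are nonnegative its
    -- weight is negative. The weights are a parameter so that the lemma also applies to the negated
    -- `w`.
    opposite-slack : ∀ {v} (w : Vector Carrier N) → (∀ l → w l # 0#) → sum (λ l → w l * slack 1# v l) ≈ 0# → v ∈ Q →
                     ∀ {i} → 0# < w i → 0# < slack 1# v i → ∃ λ j → 0# < - w j × 0# < slack 1# v j
    opposite-slack {v} w w# Σ≈0 v∈Q {i} 0<wi 0<si = conclude (sum-pos⇒ (λ m → - f (punchIn i m)) (<-respʳ-≈ (begin
          f i
            ≈⟨ solve 2 (λ a b → a := (a :+ b) :- b) refl (f i) (sum (f ∘ punchIn i)) ⟩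
          (f i + sum (f ∘ punchIn i)) - sum (f ∘ punchIn i) ≈⟨ +-congʳ (trans (sym (sum-remove i f)) Σ≈0) ⟩
          0# - sum (f ∘ punchIn i)                   ≈⟨ +-identityˡ _ ⟩
          - sum (f ∘ punchIn i)                      ≈⟨ sum-neg (f ∘ punchIn i) ⟨
          sum (λ m → - f (punchIn i m))              ∎) (*-pos 0<wi 0<si)))
      where
      f : Vector Carrier N
      f l = w l * slack 1# v l
      conclude : (∃ λ m → 0# < - f (punchIn i m)) → ∃ λ j → 0# < - w j × 0# < slack 1# v j
      conclude (m , 0<-f) with sign (w# (punchIn i m))
      ... | inj₁ 0<wj = ⊥-elim (*-nonneg (<⇒≤ 0<wj) (Q⇒slack v∈Q _) (<-respˡ-≈ (solve 1 (λ f → :- (:- f) := f) refl _) (pos⇒neg 0<-f)))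
      ... | inj₂ wj<0 = punchIn i m , neg⇒pos wj<0 , *-cancelˡ-pos (neg⇒pos wj<0)
        (<-respʳ-≈ (solve 2 (λ w s → :- (w :* s) := (:- w) :* s) refl _ _) 0<-f)

    -- The relation `μ` yields one positive slack; the sign of `w` there is decidable, and `w`
    -- yields a positive slack with the opposite sign.
    vertex-support : ∀ {v} → v ∈ Q → ∃ λ i → ∃ λ j → 0# < w i × 0# < - w j × 0# < slack 1# v i × 0# < slack 1# v j
    vertex-support {v} v∈Q = found (sum-pos⇒ (λ l → μ l * slack 1# v l) (<-respʳ-≈ (sym (trans (μ-slack 1# v) (*-identityˡ _))) 0<Σμ))
      where
      -Σ≈0 : sum (λ l → - w l * slack 1# v l) ≈ 0#
      -Σ≈0 = begin
        sum (λ l → - w l * slack 1# v l)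
          ≈⟨ sum-cong-≋ {N} (λ l → solve 2 (λ w s → (:- w) :* s := :- (w :* s)) refl (w l) (slack 1# v l)) ⟩
        sum (λ l → - (w l * slack 1# v l))  ≈⟨ sum-neg (λ l → w l * slack 1# v l) ⟩
        - sum (λ l → w l * slack 1# v l)    ≈⟨ -‿cong (w-slack 1# v) ⟩
        - 0#                                ≈⟨ solve 0 (:- con (0 , 0) := con (0 , 0)) refl ⟩
        0#                                  ∎
      Support : Set _
      Support = ∃ λ i → ∃ λ j → 0# < w i × 0# < - w j × 0# < slack 1# v i × 0# < slack 1# v j
      from-pos : ∀ l → 0# < slack 1# v l → 0# < w l → Support
      from-pos l 0<s 0<wl = let j , 0<-wj , 0<sj = opposite-slack {v} w w# (w-slack 1# v) v∈Q 0<wl 0<s in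
        l , j , 0<wl , 0<-wj , 0<s , 0<sj
      from-neg : ∀ l → 0# < slack 1# v l → w l < 0# → Support
      from-neg l 0<s wl<0 = let i , 0<--wi , 0<si = opposite-slack {v} (λ l → - w l) (-‿# ∘ w#) -Σ≈0 v∈Q (neg⇒pos wl<0) 0<s in
        i , l , <-respʳ-≈ (solve 1 (λ x → :- (:- x) := x) refl (w i)) 0<--wi , neg⇒pos wl<0 , 0<si , 0<s
      found : (∃ λ l → 0# < μ l * slack 1# v l) → Support
      found (l , 0<μs) = Sum.[ from-pos l 0<s , from-neg l 0<s ] (sign (w# l))
        where 0<s = *-cancelˡ-pos (0<μ l) 0<μs

    module _ {p q} (rows : Embed p N (λ l → 0# < w l)) (cols : Embed q N (λ l → 0# < - w l)) where
      open Graph (graph Q) using (Vertex)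
      private
        module rows = Embed rows
        module cols = Embed cols

      row≢col : ∀ r s → rows.f r ≢ cols.f s
      row≢col r s = i≢j (rows.into r) (cols.into s)

      corner-at : ∀ ((r , s) : Cell p q) → Corner (rows.f r) (cols.f s)
      corner-at (r , s) = corner (rows.into r) (cols.into s)

      point-at : Cell p q → Point d
      point-at x = Corner.point (corner-at x)

      vertex-at : Cell p q → Vertex
      vertex-at x = point-at x , corner-isVertex (corner-at x)

      edge-at : ∀ {x y} → x ∼ y → x ≢ y → IsEdge Q (point-at x) (point-at y)
      edge-at {r , s} {_ , s′} (inj₁ ≡.refl) x≢y =
        corners-isEdge (corner-at (r , s)) (corner-at (r , s′)) (row≢col r s) (row≢col r s′)
          (x≢y ∘ ≡.cong (r ,_) ∘ cols.inj)
      edge-at {r , s} {r′ , _} (inj₂ ≡.refl) x≢y =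
        corners-isEdge (flip (corner-at (r , s))) (flip (corner-at (r′ , s))) (row≢col r s ∘ ≡.sym) (row≢col r′ s ∘ ≡.sym)
          (x≢y ∘ ≡.cong (_, s) ∘ rows.inj)

      point-at-injective : ∀ {x y} → point-at x ≋ point-at y → x ≡ y
      point-at-injective {x@(r , s)} {y@(r′ , s′)} e = ≡.cong₂ _,_ (rows.inj same-row) (cols.inj same-col)
        where
        module X = Corner (corner-at x)
        module Y = Corner (corner-at y)
        clash : ∀ {l} → 0# < slack 1# (point-at x) l → l ≢ rows.f r′ → l ≢ cols.f s′ → ⊥
        clash {l} 0<s l≢r l≢s = <-irrefl (sym (trans (slack-cong refl e l) (Y.vanish l l≢r l≢s))) 0<s
        same-row : rows.f r ≡ rows.f r′
        same-row = decidable-stable (_ ≟ _) λ r≢r′ → clash X.pos-i r≢r′ (row≢col r s′)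
        same-col : cols.f s ≡ cols.f s′
        same-col = decidable-stable (_ ≟ _) λ s≢s′ → clash X.pos-j (row≢col r′ s ∘ ≡.sym) s≢s′

      cell-of : ∀ (v : Vertex) → ∃ λ x → proj₁ v ≋ point-at x
      cell-of (v , v-vertex@(_ , _ , _ , F⊆ , _)) = found (vertex-support (proj₁ (F⊆ λ _ → refl)))
        where
        at : ∀ {i j} → 0# < slack 1# v i → 0# < slack 1# v j → (∃ λ r → rows.f r ≡ i) → (∃ λ s → cols.f s ≡ j) → ∃ λ x → v ≋ point-at x
        at 0<si 0<sj (r , ≡.refl) (s , ≡.refl) = (r , s) , vertex-is-corner v-vertex 0<si 0<sj (corner-at (r , s))
        found : (∃ λ i → ∃ λ j → 0# < w i × 0# < - w j × 0# < slack 1# v i × 0# < slack 1# v j) → ∃ λ x → v ≋ point-at x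
        found (i , j , 0<wi , 0<-wj , 0<si , 0<sj) = at 0<si 0<sj (rows.onto i 0<wi) (cols.onto j 0<-wj)

      graph-linked : ∀ {k} → 1 ℕ.≤ k → k ℕ.< p → k ℕ.< q → IsLinked (graph Q) k
      graph-linked = rook-graph-linked (graph Q) vertex-at edge-at point-at-injective cell-of

  -- Matching on the equation turns the number of points into the constructor form that
  -- `annihilator` requires.
  dual-cyclic-linked : ∀ d {n} → n ≡ suc (suc d) → 2 ℕ.≤ d → (t : Vector Carrier n) → Apart t →
    (a : Point d) → origin ∈ Interior (translate (cyclicPolytope d t) a) →
    IsLinked (graph (dual (translate (cyclicPolytope d t) a))) ⌊ d /2⌋
  dual-cyclic-linked d ≡.refl 2≤d t t# a 0∈int =
    build (positive-dependence 0∈int) (annihilator t t#)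
    where
    open TranslatedHull (λ l → momentCurve d (t l)) a
    k = ⌊ d /2⌋
    -- The bound is `d + 1` because `Annihilates` counts coefficients: degree `2k ≤ d` is allowed.
    2k<1+d : k ℕ.* 2 ℕ.< suc d
    2k<1+d = ℕ.s≤s (ℕ.≤-trans (ℕ.≤-reflexive (≡.trans (ℕ.*-comm k 2) (≡.cong (k ℕ.+_) (ℕ.+-identityʳ k))))
      (ℕ.≤-trans (ℕ.+-monoʳ-≤ k (ℕ.⌊n/2⌋≤⌈n/2⌉ d)) (ℕ.≤-reflexive (ℕ.⌊n/2⌋+⌈n/2⌉≡n d))))
    positive? : ∀ {x} → x # 0# → Dec (0# < x)
    positive? x#0 = Sum.[ yes , (λ x<0 → no (<-asym x<0)) ] (sign x#0)
    build : (∃ λ (μ : Vector Carrier (suc (suc d))) → (∀ l → 0# < μ l) × (∀ k → weighted μ k ≈ 0#)) →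
            (∃ λ (w : Vector Carrier (suc (suc d))) → (∀ l → w l # 0#) × Annihilates (suc d) t w) →
            IsLinked (graph Q) k
    build (μ , 0<μ , Σμp≈0) (w , w# , w⊥) =
      Dependent.graph-linked t t# a μ 0<μ Σμp≈0 w w# w⊥ (proj₂ rows) (proj₂ cols) (ℕ.⌊n/2⌋-mono 2≤d)
        (many-positive t# w# w⊥ zero 2k<1+d (proj₂ rows))
        (many-positive t# -w# (annihilates-neg {t = t} {w} w⊥) zero 2k<1+d (proj₂ cols))
      where
      -w# : ∀ l → - w l # 0#
      -w# l = -‿# (w# l)
      rows = enumerate (λ l → positive? (w# l))
      cols = enumerate (λ l → positive? (-w# l))

open import Data.Nat.Base using (_≤_; _+_)

corollary10 : ∀ {c ℓ₁ ℓ₂} (ℝ : RealNumbers c ℓ₁ ℓ₂) →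
    let open RealNumbers ℝ using (Carrier)
        open RealNumbers ℝ using (_#_)
        open Polytopes ℝ
    in
    (d : ℕ) → 2 ≤ d →
    (t : Fin (d + 2) → Carrier) → (∀ i j → i ≢ j → t i # t j) →
    (a : Point d) → origin ∈ Interior (translate (cyclicPolytope d t) a) →
    IsLinked (graph (dual (translate (cyclicPolytope d t) a))) ⌊ d /2⌋
corollary10 ℝ d = Gale.dual-cyclic-linked ℝ d (ℕ.+-comm d 2)
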